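{- Let $(G_m)_{m\in\mathbb{Z}}$ be a generalized Fibonacci sequence, let $a,b$ be integers, let $\phi=\frac12(1+\sqrt5)$, let $x$ be a complex number with $|x|<\phi^{ -|b|}$, and put $\Delta = 1-L_b x+(-1)^b x^2$. Then the following infinite series identities hold: $$\begin{aligned} \sum_{k=0}^{\infty} x^k G_{a+bk} &= \frac{1}{\Delta} P(1,0),\\ \sum_{k=0}^{\infty} x^k k\, G_{a+bk} &= \frac{1}{\Delta^2} x P(2,1),\\ \sum_{k=0}^{\infty} x^k k^2 G_{a+bk} &= \frac{1}{\Delta^2} x P(2,1) + \frac{2}{\Delta^3} x^2 P(3,2),\\ \sum_{k=0}^{\infty} x^k k^3 G_{a+bk} &= \frac{1}{\Delta^2} x P(2,1) + \frac{6}{\Delta^3} x^2 P(3,2) + \frac{6}{\Delta^4} x^3 P(4,3),\\ \sum_{k=0}^{\infty} x^k k^4 G_{a+bk} &= \frac{1}{\Delta^2} x P(2,1) + \frac{14}{\Delta^3} x^2 P(3,2) + \frac{36}{\Delta^4} x^3 P(4,3) + \frac{24}{\Delta^5} x^4 P(5,4),\\ \sum_{k=0}^{\infty} x^k k^5 G_{a+bk} &= \frac{1}{\Delta^2} x P(2,1) + \frac{30}{\Delta^3} x^2 P(3,2) + \frac{150}{\Delta^4} x^3 P(4,3) + \frac{240}{\Delta^5} x^4 P(5,4) + \frac{120}{\Delta^6} x^5 P(6,5). \end{aligned}$$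
   Context: A generalized Fibonacci sequence is a sequence $(G_m)_{m\in\mathbb{Z}}$ of complex numbers with $G_{m+2}=G_{m+1}+G_m$ for all integers $m$ (with arbitrary seed $G_0,G_1$). $L_m$ is the Lucas number: $L_0=2$, $L_1=1$, $L_{m+2}=L_{m+1}+L_m$ for all integers $m$ (including negative indices). For given $a,b,x$ and $G$, and for integers $v,w\ge 0$, $P(v,w) = \sum_{k=0}^v \binom{v}{k} (-1)^{(b+1)k} x^k G_{a+bw-bk}$. Convention: $x^0=1$, also for $x=0$. -}

module Defs where

open import Algebra.Bundles.Raw using (RawSemiring)
import Algebra.Definitions.RawSemiring as RawSemiringDefs
open import Data.Fin.Base using (toℕ)
open import Data.Integer.Base as ℤ using (ℤ; +_; -[1+_])
import Data.Integer.Properties as ℤₚ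
open import Data.Nat.Base as ℕ using (ℕ; zero; suc)
open import Data.Nat.Combinatorics using (_C_)
import Data.Nat.Properties as ℕₚ
open import Data.Product using (Σ-syntax; ∃-syntax; _×_; _,_; proj₁; proj₂)
open import Data.Rational.Base as ℚ using (ℚ; 0ℚ; 1ℚ; ½; mkℚ; ↥_; ↧_; ↧ₙ_)
import Data.Rational.Properties as ℚₚ
open import Data.Rational.Unnormalised.Base as ℚᵘ using (mkℚᵘ)
import Data.Rational.Unnormalised.Properties as ℚᵘₚ
open import Data.Sum.Base using (_⊎_; inj₁; inj₂; map)
open import Level using (0ℓ)
open import Relation.Binary.PropositionalEquality
open import Relation.Nullary using (Dec; ¬_; yes; no)
open import Relation.Nullary.Decidable.Core using (dec⇒maybe)
open import Tactic.RingSolver using (solve-∀)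
open import Tactic.RingSolver.Core.AlmostCommutativeRing
  using (AlmostCommutativeRing; fromCommutativeRing)

Cauchy : (ℕ → ℚ) → Set
Cauchy s = ∀ ε → 0ℚ ℚ.< ε → ∃[ N ] ∀ m n → N ℕ.≤ m → N ℕ.≤ n →
           ℚ.∣ s m ℚ.- s n ∣ ℚ.< ε

-- A real number is such a sequence up to _≈ᵣ_, not up to _≡_.
record ℝ : Set where
  no-eta-equality
  field
    seq    : ℕ → ℚ
    cauchy : Cauchy seq

open ℝ public

infix 4 _≈ᵣ_ _<ᵣ_

record _≈ᵣ_ (x y : ℝ) : Set where
  constructor mk≈ᵣ
  field
    close : ∀ ε → 0ℚ ℚ.< ε → ∃[ N ] ∀ n → N ℕ.≤ n →
            ℚ.∣ seq x n ℚ.- seq y n ∣ ℚ.< ε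

-- The terms of x are eventually below those of y by a fixed positive margin.
record _<ᵣ_ (x y : ℝ) : Set where
  constructor mk<ᵣ
  field
    margin   : ℚ
    margin>0 : 0ℚ ℚ.< margin
    from     : ℕ
    gap      : ∀ n → from ℕ.≤ n → seq x n ℚ.+ margin ℚ.< seq y n

ℚ-ring : AlmostCommutativeRing 0ℓ 0ℓ
ℚ-ring = fromCommutativeRing ℚₚ.+-*-commutativeRing (λ q → dec⇒maybe (0ℚ ℚₚ.≟ q))

opaque

  neg-minus : ∀ p q → ℚ.- (p ℚ.- q) ≡ q ℚ.- p
  neg-minus = solve-∀ ℚ-ring

  +-minus-+ : ∀ a b c d → (a ℚ.+ b) ℚ.- (c ℚ.+ d) ≡ (a ℚ.- c) ℚ.+ (b ℚ.- d)
  +-minus-+ = solve-∀ ℚ-ring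

  *-minus-* : ∀ a b c d → a ℚ.* b ℚ.- c ℚ.* d ≡ a ℚ.* (b ℚ.- d) ℚ.+ d ℚ.* (a ℚ.- c)
  *-minus-* = solve-∀ ℚ-ring

  minus-* : ∀ p q p′ q′ →
            (p′ ℚ.- q′) ℚ.* (p ℚ.* q) ≡ (p′ ℚ.* p) ℚ.* q ℚ.- (q′ ℚ.* q) ℚ.* p
  minus-* = solve-∀ ℚ-ring

  minus-plus : ∀ p q → p ≡ (p ℚ.- q) ℚ.+ q
  minus-plus = solve-∀ ℚ-ring

  plus-minus : ∀ p q → p ≡ q ℚ.+ (p ℚ.- q)
  plus-minus = solve-∀ ℚ-ring

  square-+ : ∀ u e → (u ℚ.* u ℚ.+ e ℚ.* e) ℚ.+ (u ℚ.* e ℚ.+ u ℚ.* e) ≡ (u ℚ.+ e) ℚ.* (u ℚ.+ e)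
  square-+ = solve-∀ ℚ-ring

  half>0 : ∀ {ε} → 0ℚ ℚ.< ε → 0ℚ ℚ.< ½ ℚ.* ε
  half>0 {ε} p = subst (ℚ._< ½ ℚ.* ε) (ℚₚ.*-zeroʳ ½) (ℚₚ.*-monoʳ-<-pos ½ p)

  half+half : ∀ ε → ½ ℚ.* ε ℚ.+ ½ ℚ.* ε ≡ ε
  half+half ε = trans (sym (ℚₚ.*-distribʳ-+ ε ½ ½)) (ℚₚ.*-identityˡ ε)

  *>0 : ∀ {p q} → 0ℚ ℚ.< p → 0ℚ ℚ.< q → 0ℚ ℚ.< p ℚ.* q
  *>0 {p} {q} p>0 q>0 = subst (ℚ._< p ℚ.* q) (ℚₚ.*-zeroʳ p)
    (ℚₚ.*-monoʳ-<-pos p {{ℚ.positive p>0}} q>0)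

  *-mono-< : ∀ {p q r s} → 0ℚ ℚ.< p → 0ℚ ℚ.< s → p ℚ.< q → r ℚ.< s →
             p ℚ.* r ℚ.< q ℚ.* s
  *-mono-< {p} {q} {r} {s} p>0 s>0 p<q r<s = ℚₚ.<-trans
    (ℚₚ.*-monoʳ-<-pos p {{ℚ.positive p>0}} r<s)
    (ℚₚ.*-monoˡ-<-pos s {{ℚ.positive s>0}} p<q)

  *-mono-≤ : ∀ {p q r s} → 0ℚ ℚ.≤ p → 0ℚ ℚ.≤ s → p ℚ.≤ q → r ℚ.≤ s →
             p ℚ.* r ℚ.≤ q ℚ.* s
  *-mono-≤ {p} {q} {r} {s} p≥0 s≥0 p≤q r≤s = ℚₚ.≤-trans
    (ℚₚ.*-monoˡ-≤-nonNeg p {{ℚ.nonNegative p≥0}} r≤s)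
    (ℚₚ.*-monoʳ-≤-nonNeg s {{ℚ.nonNegative s≥0}} p≤q)

  p≤∣p∣ : ∀ p → p ℚ.≤ ℚ.∣ p ∣
  p≤∣p∣ p with ℚₚ.≤-total 0ℚ p
  ... | inj₁ 0≤p = ℚₚ.≤-reflexive (sym (ℚₚ.0≤p⇒∣p∣≡p 0≤p))
  ... | inj₂ p≤0 = ℚₚ.≤-trans p≤0 (ℚₚ.0≤∣p∣ p)

  const-cauchy : ∀ q → Cauchy (λ _ → q)
  const-cauchy q ε ε>0 = 0 , λ _ _ _ _ →
    subst (ℚ._< ε) (sym (cong ℚ.∣_∣ (ℚₚ.+-inverseʳ q))) ε>0

  +-cauchy : ∀ {s t} → Cauchy s → Cauchy t → Cauchy (λ n → s n ℚ.+ t n)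
  +-cauchy {s} {t} cs ct ε ε>0 with cs (½ ℚ.* ε) (half>0 ε>0) | ct (½ ℚ.* ε) (half>0 ε>0)
  ... | M , hs | N , ht = M ℕ.+ N , λ m n ≤m ≤n → begin-strict
    ℚ.∣ (s m ℚ.+ t m) ℚ.- (s n ℚ.+ t n) ∣
      ≡⟨ cong ℚ.∣_∣ (+-minus-+ (s m) (t m) (s n) (t n)) ⟩
    ℚ.∣ (s m ℚ.- s n) ℚ.+ (t m ℚ.- t n) ∣
      ≤⟨ ℚₚ.∣p+q∣≤∣p∣+∣q∣ (s m ℚ.- s n) (t m ℚ.- t n) ⟩
    ℚ.∣ s m ℚ.- s n ∣ ℚ.+ ℚ.∣ t m ℚ.- t n ∣
      <⟨ ℚₚ.+-mono-<
           (hs m n (ℕₚ.m+n≤o⇒m≤o M ≤m) (ℕₚ.m+n≤o⇒m≤o M ≤n))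
           (ht m n (ℕₚ.m+n≤o⇒n≤o M ≤m) (ℕₚ.m+n≤o⇒n≤o M ≤n)) ⟩
    ½ ℚ.* ε ℚ.+ ½ ℚ.* ε
      ≡⟨ half+half ε ⟩
    ε ∎
    where
    open ℚₚ.≤-Reasoning

  neg-cauchy : ∀ {s} → Cauchy s → Cauchy (λ n → ℚ.- s n)
  neg-cauchy {s} cs ε ε>0 with cs ε ε>0
  ... | N , h = N , λ m n ≤m ≤n → subst (ℚ._< ε)
    (trans (sym (ℚₚ.∣-p∣≡∣p∣ (s m ℚ.- s n)))
           (cong ℚ.∣_∣ (ℚₚ.neg-distrib-+ (s m) (ℚ.- s n))))
    (h m n ≤m ≤n)

  bounded : ∀ {s} → Cauchy s →
            ∃[ B ] 0ℚ ℚ.< B × ∃[ N ] ∀ n → N ℕ.≤ n → ℚ.∣ s n ∣ ℚ.≤ B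
  bounded {s} cs with cs 1ℚ (ℚₚ.positive⁻¹ 1ℚ)
  ... | N , h = 1ℚ ℚ.+ ℚ.∣ s N ∣
    , ℚₚ.+-mono-<-≤ {0ℚ} {1ℚ} {0ℚ} (ℚₚ.positive⁻¹ 1ℚ) (ℚₚ.0≤∣p∣ (s N))
    , N , λ n N≤n → begin
      ℚ.∣ s n ∣
        ≡⟨ cong ℚ.∣_∣ (minus-plus (s n) (s N)) ⟩
      ℚ.∣ (s n ℚ.- s N) ℚ.+ s N ∣
        ≤⟨ ℚₚ.∣p+q∣≤∣p∣+∣q∣ (s n ℚ.- s N) (s N) ⟩
      ℚ.∣ s n ℚ.- s N ∣ ℚ.+ ℚ.∣ s N ∣
        ≤⟨ ℚₚ.+-monoˡ-≤ ℚ.∣ s N ∣ (ℚₚ.<⇒≤ (h n N N≤n ℕₚ.≤-refl)) ⟩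
      1ℚ ℚ.+ ℚ.∣ s N ∣ ∎
    where
    open ℚₚ.≤-Reasoning

  *-shrink : ∀ {a B d} ε (B>0 : 0ℚ ℚ.< B) → ℚ.∣ a ∣ ℚ.≤ B →
             ℚ.∣ d ∣ ℚ.< (ℚ.1/ B) {{ℚ.>-nonZero B>0}} ℚ.* ε →
             ℚ.∣ a ∣ ℚ.* ℚ.∣ d ∣ ℚ.< ε
  *-shrink {a} {B} {d} ε B>0 a≤B d< = begin-strict
    ℚ.∣ a ∣ ℚ.* ℚ.∣ d ∣
      ≤⟨ ℚₚ.*-monoʳ-≤-nonNeg ℚ.∣ d ∣ {{ℚₚ.∣-∣-nonNeg d}} a≤B ⟩
    B ℚ.* ℚ.∣ d ∣
      <⟨ ℚₚ.*-monoʳ-<-pos B {{ℚ.positive B>0}} d< ⟩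
    B ℚ.* (B⁻¹ ℚ.* ε)
      ≡⟨ ℚₚ.*-assoc B B⁻¹ ε ⟨
    B ℚ.* B⁻¹ ℚ.* ε
      ≡⟨ cong (ℚ._* ε) (ℚₚ.*-inverseʳ B {{ℚ.>-nonZero B>0}}) ⟩
    1ℚ ℚ.* ε
      ≡⟨ ℚₚ.*-identityˡ ε ⟩
    ε ∎
    where
    open ℚₚ.≤-Reasoning
    B⁻¹ : ℚ
    B⁻¹ = (ℚ.1/ B) {{ℚ.>-nonZero B>0}}

  1/>0 : ∀ {p} (p>0 : 0ℚ ℚ.< p) → 0ℚ ℚ.< (ℚ.1/ p) {{ℚ.>-nonZero p>0}}
  1/>0 {p} p>0 = ℚₚ.positive⁻¹ _ {{ℚₚ.1/pos⇒pos p {{ℚ.positive p>0}}}}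

  *-close : ∀ {a b c d A B} ε (A>0 : 0ℚ ℚ.< A) (B>0 : 0ℚ ℚ.< B) →
            ℚ.∣ a ∣ ℚ.≤ A → ℚ.∣ d ∣ ℚ.≤ B →
            ℚ.∣ a ℚ.- c ∣ ℚ.< (ℚ.1/ B) {{ℚ.>-nonZero B>0}} ℚ.* (½ ℚ.* ε) →
            ℚ.∣ b ℚ.- d ∣ ℚ.< (ℚ.1/ A) {{ℚ.>-nonZero A>0}} ℚ.* (½ ℚ.* ε) →
            ℚ.∣ a ℚ.* b ℚ.- c ℚ.* d ∣ ℚ.< ε
  *-close {a} {b} {c} {d} {A} {B} ε A>0 B>0 a≤A d≤B a-c b-d = begin-strict
    ℚ.∣ a ℚ.* b ℚ.- c ℚ.* d ∣
      ≡⟨ cong ℚ.∣_∣ (*-minus-* a b c d) ⟩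
    ℚ.∣ a ℚ.* (b ℚ.- d) ℚ.+ d ℚ.* (a ℚ.- c) ∣
      ≤⟨ ℚₚ.∣p+q∣≤∣p∣+∣q∣ (a ℚ.* (b ℚ.- d)) (d ℚ.* (a ℚ.- c)) ⟩
    ℚ.∣ a ℚ.* (b ℚ.- d) ∣ ℚ.+ ℚ.∣ d ℚ.* (a ℚ.- c) ∣
      ≡⟨ cong₂ ℚ._+_ (ℚₚ.∣p*q∣≡∣p∣*∣q∣ a (b ℚ.- d)) (ℚₚ.∣p*q∣≡∣p∣*∣q∣ d (a ℚ.- c)) ⟩
    ℚ.∣ a ∣ ℚ.* ℚ.∣ b ℚ.- d ∣ ℚ.+ ℚ.∣ d ∣ ℚ.* ℚ.∣ a ℚ.- c ∣
      <⟨ ℚₚ.+-mono-< (*-shrink {a} {A} {b ℚ.- d} (½ ℚ.* ε) A>0 a≤A b-d)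
                     (*-shrink {d} {B} {a ℚ.- c} (½ ℚ.* ε) B>0 d≤B a-c) ⟩
    ½ ℚ.* ε ℚ.+ ½ ℚ.* ε
      ≡⟨ half+half ε ⟩
    ε ∎
    where open ℚₚ.≤-Reasoning

  *-cauchy : ∀ {s t} → Cauchy s → Cauchy t → Cauchy (λ n → s n ℚ.* t n)
  *-cauchy {s} {t} cs ct ε ε>0 =
    let A , A>0 , K , hA = bounded {s} cs
        B , B>0 , L , hB = bounded {t} ct
        M , hs = cs ((ℚ.1/ B) {{ℚ.>-nonZero B>0}} ℚ.* (½ ℚ.* ε)) (*>0 (1/>0 B>0) (half>0 ε>0))
        N , ht = ct ((ℚ.1/ A) {{ℚ.>-nonZero A>0}} ℚ.* (½ ℚ.* ε)) (*>0 (1/>0 A>0) (half>0 ε>0))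
        KL = K ℕ.+ L
    in KL ℕ.+ (M ℕ.+ N) , λ m n ≤m ≤n →
      let MN≤m = ℕₚ.m+n≤o⇒n≤o KL ≤m
          MN≤n = ℕₚ.m+n≤o⇒n≤o KL ≤n
      in *-close {s m} {t m} {s n} {t n} {A} {B} ε A>0 B>0
           (hA m (ℕₚ.m+n≤o⇒m≤o K (ℕₚ.m+n≤o⇒m≤o KL ≤m)))
           (hB n (ℕₚ.m+n≤o⇒n≤o K (ℕₚ.m+n≤o⇒m≤o KL ≤n)))
           (hs m n (ℕₚ.m+n≤o⇒m≤o M MN≤m) (ℕₚ.m+n≤o⇒m≤o M MN≤n))
           (ht m n (ℕₚ.m+n≤o⇒n≤o M MN≤m) (ℕₚ.m+n≤o⇒n≤o M MN≤n))

infixl 6 _+ᵣ_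
infixl 7 _*ᵣ_
infix  8 -ᵣ_

ℚ→ℝ : ℚ → ℝ
ℚ→ℝ q .seq _  = q
ℚ→ℝ q .cauchy = const-cauchy q

0ᵣ 1ᵣ : ℝ
0ᵣ = ℚ→ℝ 0ℚ
1ᵣ = ℚ→ℝ 1ℚ

_+ᵣ_ : ℝ → ℝ → ℝ
(x +ᵣ y) .seq n  = seq x n ℚ.+ seq y n
(x +ᵣ y) .cauchy = +-cauchy {seq x} {seq y} (cauchy x) (cauchy y)

_*ᵣ_ : ℝ → ℝ → ℝ
(x *ᵣ y) .seq n  = seq x n ℚ.* seq y n
(x *ᵣ y) .cauchy = *-cauchy {seq x} {seq y} (cauchy x) (cauchy y)

-ᵣ_ : ℝ → ℝ
(-ᵣ x) .seq n  = ℚ.- seq x n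
(-ᵣ x) .cauchy = neg-cauchy {seq x} (cauchy x)

ℝ-rawSemiring : RawSemiring 0ℓ 0ℓ
ℝ-rawSemiring = record
  { Carrier = ℝ ; _≈_ = _≈ᵣ_ ; _+_ = _+ᵣ_ ; _*_ = _*ᵣ_ ; 0# = 0ᵣ ; 1# = 1ᵣ }

open RawSemiringDefs ℝ-rawSemiring public using () renaming (_^_ to _^ᵣ_)

opaque

  margin<term : ∀ {x} (x>0 : 0ᵣ <ᵣ x) n →
                _<ᵣ_.margin x>0 ℚ.< seq x (_<ᵣ_.from x>0 ℕ.+ n)
  margin<term (mk<ᵣ ε _ N gap) n =
    subst (ℚ._< _) (ℚₚ.+-identityˡ ε) (gap (N ℕ.+ n) (ℕₚ.m≤m+n N n))

  term>0 : ∀ {x} (x>0 : 0ᵣ <ᵣ x) n → 0ℚ ℚ.< seq x (_<ᵣ_.from x>0 ℕ.+ n)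
  term>0 x>0 n = ℚₚ.<-trans (_<ᵣ_.margin>0 x>0) (margin<term x>0 n)

-- The sequence is shifted past the index from which all terms are positive.
inv-seq : ∀ x → 0ᵣ <ᵣ x → ℕ → ℚ
inv-seq x x>0 n = (ℚ.1/ seq x (_<ᵣ_.from x>0 ℕ.+ n)) {{ℚ.>-nonZero (term>0 x>0 n)}}

opaque

  1/-diff : ∀ p q .{{_ : ℚ.NonZero p}} .{{_ : ℚ.NonZero q}} →
            (ℚ.1/ p ℚ.- ℚ.1/ q) ℚ.* (p ℚ.* q) ≡ q ℚ.- p
  1/-diff p q = begin
    (ℚ.1/ p ℚ.- ℚ.1/ q) ℚ.* (p ℚ.* q)
      ≡⟨ minus-* p q (ℚ.1/ p) (ℚ.1/ q) ⟩
    (ℚ.1/ p ℚ.* p) ℚ.* q ℚ.- (ℚ.1/ q ℚ.* q) ℚ.* p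
      ≡⟨ cong₂ (λ u v → u ℚ.* q ℚ.- v ℚ.* p) (ℚₚ.*-inverseˡ p) (ℚₚ.*-inverseˡ q) ⟩
    1ℚ ℚ.* q ℚ.- 1ℚ ℚ.* p
      ≡⟨ cong₂ ℚ._-_ (ℚₚ.*-identityˡ q) (ℚₚ.*-identityˡ p) ⟩
    q ℚ.- p ∎
    where
    open ≡-Reasoning

  inv-close : ∀ {δ p q} η .{{_ : ℚ.NonZero p}} .{{_ : ℚ.NonZero q}} →
              0ℚ ℚ.< η → 0ℚ ℚ.< δ → δ ℚ.< p → δ ℚ.< q →
              ℚ.∣ q ℚ.- p ∣ ℚ.< η ℚ.* (δ ℚ.* δ) →
              ℚ.∣ ℚ.1/ p ℚ.- ℚ.1/ q ∣ ℚ.< η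
  inv-close {δ} {p} {q} η η>0 δ>0 δ<p δ<q h =
    ℚₚ.*-cancelʳ-<-nonNeg (p ℚ.* q) {{ℚ.nonNegative (ℚₚ.<⇒≤ pq>0)}} (begin-strict
    ℚ.∣ ℚ.1/ p ℚ.- ℚ.1/ q ∣ ℚ.* (p ℚ.* q)
      ≡⟨ cong (ℚ.∣ ℚ.1/ p ℚ.- ℚ.1/ q ∣ ℚ.*_) (ℚₚ.0≤p⇒∣p∣≡p (ℚₚ.<⇒≤ pq>0)) ⟨
    ℚ.∣ ℚ.1/ p ℚ.- ℚ.1/ q ∣ ℚ.* ℚ.∣ p ℚ.* q ∣
      ≡⟨ ℚₚ.∣p*q∣≡∣p∣*∣q∣ (ℚ.1/ p ℚ.- ℚ.1/ q) (p ℚ.* q) ⟨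
    ℚ.∣ (ℚ.1/ p ℚ.- ℚ.1/ q) ℚ.* (p ℚ.* q) ∣
      ≡⟨ cong ℚ.∣_∣ (1/-diff p q) ⟩
    ℚ.∣ q ℚ.- p ∣
      <⟨ h ⟩
    η ℚ.* (δ ℚ.* δ)
      <⟨ ℚₚ.*-monoʳ-<-pos η {{ℚ.positive η>0}} (*-mono-< δ>0 q>0 δ<p δ<q) ⟩
    η ℚ.* (p ℚ.* q) ∎)
    where
    open ℚₚ.≤-Reasoning
    q>0 : 0ℚ ℚ.< q
    q>0 = ℚₚ.<-trans δ>0 δ<q
    pq>0 : 0ℚ ℚ.< p ℚ.* q
    pq>0 = *>0 (ℚₚ.<-trans δ>0 δ<p) q>0

  inv-cauchy : ∀ x (x>0 : 0ᵣ <ᵣ x) → Cauchy (inv-seq x x>0)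
  inv-cauchy x x>0@(mk<ᵣ δ δ>0 N₀ _) η η>0
    with cauchy x (η ℚ.* (δ ℚ.* δ)) (*>0 η>0 (*>0 δ>0 δ>0))
  ... | N , h = N , λ m n ≤m ≤n →
    inv-close η {{ℚ.>-nonZero (term>0 x>0 m)}} {{ℚ.>-nonZero (term>0 x>0 n)}}
      η>0 δ>0 (margin<term x>0 m) (margin<term x>0 n)
      (h (N₀ ℕ.+ n) (N₀ ℕ.+ m)
         (ℕₚ.≤-trans ≤n (ℕₚ.m≤n+m n N₀)) (ℕₚ.≤-trans ≤m (ℕₚ.m≤n+m m N₀)))

inv : ∀ x → 0ᵣ <ᵣ x → ℝ
inv x x>0 .seq    = inv-seq x x>0
inv x x>0 .cauchy = inv-cauchy x x>0

opaque

  1>0ᵣ : 0ᵣ <ᵣ 1ᵣ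
  1>0ᵣ = mk<ᵣ ½ (ℚₚ.positive⁻¹ ½) 0 λ _ _ →
    ℚ.*<* (ℤ.+<+ (ℕ.s≤s (ℕ.s≤s ℕ.z≤n)))

  *>0ᵣ : ∀ {x y} → 0ᵣ <ᵣ x → 0ᵣ <ᵣ y → 0ᵣ <ᵣ x *ᵣ y
  *>0ᵣ {x} {y} (mk<ᵣ ε ε>0 M g) (mk<ᵣ δ δ>0 N h) =
    mk<ᵣ (ε ℚ.* δ) (*>0 ε>0 δ>0) (M ℕ.+ N) λ n ≤n →
      let ε<x = subst (ℚ._< seq x n) (ℚₚ.+-identityˡ ε) (g n (ℕₚ.m+n≤o⇒m≤o M ≤n))
          δ<y = subst (ℚ._< seq y n) (ℚₚ.+-identityˡ δ) (h n (ℕₚ.m+n≤o⇒n≤o M ≤n))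
      in subst (ℚ._< seq x n ℚ.* seq y n) (sym (ℚₚ.+-identityˡ (ε ℚ.* δ)))
           (*-mono-< {ε} {seq x n} {δ} {seq y n} ε>0 (ℚₚ.<-trans δ>0 δ<y) ε<x δ<y)

  ^>0ᵣ : ∀ {x} → 0ᵣ <ᵣ x → ∀ n → 0ᵣ <ᵣ x ^ᵣ n
  ^>0ᵣ     x>0 zero    = 1>0ᵣ
  ^>0ᵣ {x} x>0 (suc n) = *>0ᵣ {x} {x ^ᵣ n} x>0 (^>0ᵣ x>0 n)

-- The largest k ≤ the given bound such that A k, or 0 if there is none.
search : ∀ {A : ℕ → Set} → (∀ k → Dec (A k)) → ℕ → ℕ
search A? zero    = zero
search A? (suc k) with A? (suc k)
... | yes _ = suc k
... | no  _ = search A? k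

SquareBelow : ℚ → ℕ → ℕ → Set
SquareBelow q n s = (+ s ℚ./ suc n) ℚ.* (+ s ℚ./ suc n) ℚ.≤ q

squareBelow? : ∀ q n s → Dec (SquareBelow q n s)
squareBelow? q n s = _ ℚₚ.≤? q

-- ⌊(n+1)√q⌋ for q ≥ 0, and 0 for q < 0. The search bound is
-- (n+1)(∣numerator of q∣+1) - 1, which is at least ⌊(n+1)√q⌋.
rootNum : ℚ → ℕ → ℕ
rootNum q n = search (squareBelow? q n) (ℤ.∣ ↥ q ∣ ℕ.+ n ℕ.* suc ℤ.∣ ↥ q ∣)

opaque

  approxRoot : ℚ → ℕ → ℚ
  approxRoot q n = + rootNum q n ℚ./ suc n

opaque

  frac-≤ : ∀ i m j n → i ℤ.* + suc n ℤ.≤ j ℤ.* + suc m → i ℚ./ suc m ℚ.≤ j ℚ./ suc n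
  frac-≤ i m j n h = ℚₚ.toℚᵘ-cancel-≤
    (ℚᵘₚ.≤-respˡ-≃ (ℚᵘₚ.≃-sym (ℚₚ.toℚᵘ-fromℚᵘ (mkℚᵘ i m)))
      (ℚᵘₚ.≤-respʳ-≃ (ℚᵘₚ.≃-sym (ℚₚ.toℚᵘ-fromℚᵘ (mkℚᵘ j n))) (ℚᵘ.*≤* h)))

  frac-< : ∀ i m j n → i ℤ.* + suc n ℤ.< j ℤ.* + suc m → i ℚ./ suc m ℚ.< j ℚ./ suc n
  frac-< i m j n h = ℚₚ.toℚᵘ-cancel-<
    (ℚᵘₚ.<-respˡ-≃ (ℚᵘₚ.≃-sym (ℚₚ.toℚᵘ-fromℚᵘ (mkℚᵘ i m)))
      (ℚᵘₚ.<-respʳ-≃ (ℚᵘₚ.≃-sym (ℚₚ.toℚᵘ-fromℚᵘ (mkℚᵘ j n))) (ℚᵘ.*<* h)))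

  frac-+ : ∀ s n → + suc s ℚ./ suc n ≡ (+ s ℚ./ suc n) ℚ.+ (+ 1 ℚ./ suc n)
  frac-+ s n = ℚₚ.toℚᵘ-injective (begin
    ℚ.toℚᵘ (+ suc s ℚ./ suc n)
      ≈⟨ ℚₚ.toℚᵘ-fromℚᵘ (mkℚᵘ (+ suc s) n) ⟩
    mkℚᵘ (+ suc s) n
      ≈⟨ ℚᵘ.*≡* lemma ⟩
    mkℚᵘ (+ s) n ℚᵘ.+ mkℚᵘ (+ 1) n
      ≈⟨ ℚᵘₚ.+-cong (ℚₚ.toℚᵘ-fromℚᵘ (mkℚᵘ (+ s) n)) (ℚₚ.toℚᵘ-fromℚᵘ (mkℚᵘ (+ 1) n)) ⟨
    ℚ.toℚᵘ (+ s ℚ./ suc n) ℚᵘ.+ ℚ.toℚᵘ (+ 1 ℚ./ suc n)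
      ≈⟨ ℚₚ.toℚᵘ-homo-+ (+ s ℚ./ suc n) (+ 1 ℚ./ suc n) ⟨
    ℚ.toℚᵘ ((+ s ℚ./ suc n) ℚ.+ (+ 1 ℚ./ suc n)) ∎)
    where
    open ℚᵘₚ.≃-Reasoning
    d : ℤ
    d = + suc n
    lemma : + suc s ℤ.* (d ℤ.* d) ≡ (+ s ℤ.* d ℤ.+ + 1 ℤ.* d) ℤ.* d
    lemma = trans (sym (ℤₚ.*-assoc (+ suc s) d d)) (cong (ℤ._* d)
      (trans (cong (ℤ._* d) (cong +_ (ℕₚ.+-comm 1 s))) (ℤₚ.*-distribʳ-+ d (+ s) (+ 1))))

  search-fails : ∀ {A : ℕ → Set} (A? : ∀ k → Dec (A k)) k → ¬ A (suc k) → ¬ A (suc (search A? k))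
  search-fails A? zero    h = h
  search-fails A? (suc k) h with A? (suc k)
  ... | yes _ = h
  ... | no  p = search-fails A? k p

  search-holds : ∀ {A : ℕ → Set} (A? : ∀ k → Dec (A k)) k → search A? k ≡ 0 ⊎ A (search A? k)
  search-holds A? zero    = inj₁ refl
  search-holds A? (suc k) with A? (suc k)
  ... | yes p = inj₂ p
  ... | no  _ = search-holds A? k

  q<1+∣↥q∣ : ∀ q → q ℚ.< + suc ℤ.∣ ↥ q ∣ ℚ./ 1
  q<1+∣↥q∣ q = subst (ℚ._< + suc ℤ.∣ ↥ q ∣ ℚ./ 1) (ℚₚ.fromℚᵘ-toℚᵘ q) (go q)
    where
    go : ∀ q → ℚ.fromℚᵘ (ℚ.toℚᵘ q) ℚ.< + suc ℤ.∣ ↥ q ∣ ℚ./ 1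
    go (mkℚ (+ k) d _)    = frac-< (+ k) d (+ suc k) 0
      (subst₂ ℤ._<_ (ℤₚ.pos-* k 1) (ℤₚ.pos-* (suc k) (suc d)) (ℤ.+<+ (begin-strict
        k ℕ.* 1         ≡⟨ ℕₚ.*-identityʳ k ⟩
        k               <⟨ ℕₚ.n<1+n k ⟩
        suc k           ≤⟨ ℕₚ.m≤m*n (suc k) (suc d) ⟩
        suc k ℕ.* suc d ∎)))
      where open ℕₚ.≤-Reasoning
    go (mkℚ (-[1+ k ]) d _) = frac-< (-[1+ k ]) d (+ suc (suc k)) 0 ℤ.-<+

opaque

  unfolding approxRoot

  approxRoot≥0 : ∀ q n → 0ℚ ℚ.≤ approxRoot q n
  approxRoot≥0 q n = ℚₚ.nonNegative⁻¹ _ {{ℚₚ.normalize-nonNeg (rootNum q n) (suc n)}}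

  approxRoot-lower : ∀ q n → approxRoot q n ≡ 0ℚ ⊎ approxRoot q n ℚ.* approxRoot q n ℚ.≤ q
  approxRoot-lower q n = map
    (λ e → trans (cong (λ s → + s ℚ./ suc n) e) (ℚₚ.0/n≡0 (suc n)))
    (λ h → h)
    (search-holds {SquareBelow q n} (squareBelow? q n) (ℤ.∣ ↥ q ∣ ℕ.+ n ℕ.* suc ℤ.∣ ↥ q ∣))

  approxRoot-upper : ∀ q n → let r = approxRoot q n ℚ.+ (+ 1 ℚ./ suc n) in q ℚ.< r ℚ.* r
  approxRoot-upper q n = subst (λ r → q ℚ.< r ℚ.* r) (frac-+ (rootNum q n) n)
    (ℚₚ.≰⇒> (search-fails {SquareBelow q n} (squareBelow? q n) k top))
    where
    open ℚₚ.≤-Reasoning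
    c k : ℕ
    c = ℤ.∣ ↥ q ∣
    k = c ℕ.+ n ℕ.* suc c
    B : ℚ
    B = + suc c ℚ./ 1
    B≡ : + suc k ℚ./ suc n ≡ B
    B≡ = ℚₚ.fromℚᵘ-cong {mkℚᵘ (+ suc k) n} {mkℚᵘ (+ suc c) 0}
      (ℚᵘ.*≡* (trans (ℤₚ.*-identityʳ (+ suc k))
        (trans (ℤₚ.pos-* (suc n) (suc c)) (ℤₚ.*-comm (+ suc n) (+ suc c)))))
    1≤B : 1ℚ ℚ.≤ B
    1≤B = frac-≤ (+ 1) 0 (+ suc c) 0 (ℤ.+≤+ (ℕ.s≤s ℕ.z≤n))
    B≥0 : 0ℚ ℚ.≤ B
    B≥0 = ℚₚ.≤-trans (ℚₚ.nonNegative⁻¹ 1ℚ) 1≤B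
    q<BB : q ℚ.< B ℚ.* B
    q<BB = begin-strict
      q        <⟨ q<1+∣↥q∣ q ⟩
      B        ≡⟨ ℚₚ.*-identityˡ B ⟨
      1ℚ ℚ.* B ≤⟨ ℚₚ.*-monoʳ-≤-nonNeg B {{ℚ.nonNegative B≥0}} 1≤B ⟩
      B ℚ.* B  ∎
    top : ¬ (+ suc k ℚ./ suc n) ℚ.* (+ suc k ℚ./ suc n) ℚ.≤ q
    top h = ℚₚ.<-irrefl refl (ℚₚ.<-≤-trans q<BB (subst (λ r → r ℚ.* r ℚ.≤ q) B≡ h))

opaque

  archimedean : ∀ ε → 0ℚ ℚ.< ε → ∃[ N ] ∀ n → N ℕ.≤ n → + 1 ℚ./ suc n ℚ.< ε
  archimedean ε ε>0 = ↧ₙ ε , λ n ≤n →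
    subst (+ 1 ℚ./ suc n ℚ.<_) (ℚₚ.fromℚᵘ-toℚᵘ ε) (go ε (ℚ.positive ε>0) n ≤n)
    where
    go : ∀ ε → ℚ.Positive ε → ∀ n → ↧ₙ ε ℕ.≤ n → + 1 ℚ./ suc n ℚ.< ℚ.fromℚᵘ (ℚ.toℚᵘ ε)
    go (mkℚ (+ suc k) d _) _ n d≤n = frac-< (+ 1) n (+ suc k) d
      (subst₂ ℤ._<_ (ℤₚ.pos-* 1 (suc d)) (ℤₚ.pos-* (suc k) (suc n)) (ℤ.+<+ (begin-strict
        1 ℕ.* suc d     ≡⟨ ℕₚ.*-identityˡ (suc d) ⟩
        suc d           <⟨ ℕ.s≤s d≤n ⟩
        suc n           ≤⟨ ℕₚ.m≤n*m (suc n) (suc k) ⟩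
        suc k ℕ.* suc n ∎)))
      where open ℕₚ.≤-Reasoning

  root-close : ∀ {p q r t δ} η → 0ℚ ℚ.< η → 0ℚ ℚ.≤ r → 0ℚ ℚ.≤ t → 0ℚ ℚ.≤ δ →
    r ≡ 0ℚ ⊎ r ℚ.* r ℚ.≤ p → q ℚ.< (t ℚ.+ δ) ℚ.* (t ℚ.+ δ) →
    ℚ.∣ p ℚ.- q ∣ ℚ.< η ℚ.* η → δ ℚ.< η →
    r ℚ.- t ℚ.< η ℚ.+ η
  root-close {r = r} {t} η η>0 _ t≥0 _ (inj₁ r≡0) _ _ _ = begin-strict
    r ℚ.- t     ≡⟨ cong (ℚ._- t) r≡0 ⟩
    0ℚ ℚ.- t    ≤⟨ ℚₚ.+-monoʳ-≤ 0ℚ (ℚₚ.neg-antimono-≤ t≥0) ⟩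
    0ℚ ℚ.- 0ℚ   <⟨ ℚₚ.+-mono-< η>0 η>0 ⟩
    η ℚ.+ η     ∎
    where open ℚₚ.≤-Reasoning
  root-close {p} {q} {r} {t} {δ} η η>0 r≥0 t≥0 δ≥0 (inj₂ rr≤p) q<uu p-q δ<η =
    ℚₚ.≰⇒> λ 2η≤ → ℚₚ.<-irrefl refl (begin-strict
    r ℚ.* r
      ≤⟨ rr≤p ⟩
    p
      ≡⟨ plus-minus p q ⟩
    q ℚ.+ (p ℚ.- q)
      <⟨ ℚₚ.+-mono-< q<uu (ℚₚ.≤-<-trans (p≤∣p∣ (p ℚ.- q)) p-q) ⟩
    u ℚ.* u ℚ.+ η ℚ.* η
      ≡⟨ ℚₚ.+-identityʳ (u ℚ.* u ℚ.+ η ℚ.* η) ⟨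
    (u ℚ.* u ℚ.+ η ℚ.* η) ℚ.+ 0ℚ
      ≤⟨ ℚₚ.+-monoʳ-≤ (u ℚ.* u ℚ.+ η ℚ.* η) w≥0 ⟩
    (u ℚ.* u ℚ.+ η ℚ.* η) ℚ.+ w
      ≡⟨ square-+ u η ⟩
    (u ℚ.+ η) ℚ.* (u ℚ.+ η)
      ≤⟨ *-mono-≤ v≥0 r≥0 (v≤r 2η≤) (v≤r 2η≤) ⟩
    r ℚ.* r ∎)
    where
    open ℚₚ.≤-Reasoning
    u w : ℚ
    u = t ℚ.+ δ
    w = u ℚ.* η ℚ.+ u ℚ.* η
    u≥0 : 0ℚ ℚ.≤ u
    u≥0 = ℚₚ.+-mono-≤ {0ℚ} {t} {0ℚ} t≥0 δ≥0
    uη≥0 : 0ℚ ℚ.≤ u ℚ.* η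
    uη≥0 = subst (ℚ._≤ u ℚ.* η) (ℚₚ.*-zeroˡ η)
             (ℚₚ.*-monoʳ-≤-nonNeg η {{ℚ.nonNegative (ℚₚ.<⇒≤ η>0)}} u≥0)
    w≥0 : 0ℚ ℚ.≤ w
    w≥0 = ℚₚ.+-mono-≤ {0ℚ} {u ℚ.* η} {0ℚ} uη≥0 uη≥0
    v≥0 : 0ℚ ℚ.≤ u ℚ.+ η
    v≥0 = ℚₚ.+-mono-≤ {0ℚ} {u} {0ℚ} u≥0 (ℚₚ.<⇒≤ η>0)
    v≤r : η ℚ.+ η ℚ.≤ r ℚ.- t → u ℚ.+ η ℚ.≤ r
    v≤r h = begin
      t ℚ.+ δ ℚ.+ η     ≤⟨ ℚₚ.+-monoˡ-≤ η (ℚₚ.+-monoʳ-≤ t (ℚₚ.<⇒≤ δ<η)) ⟩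
      t ℚ.+ η ℚ.+ η     ≡⟨ ℚₚ.+-assoc t η η ⟩
      t ℚ.+ (η ℚ.+ η)   ≤⟨ ℚₚ.+-monoʳ-≤ t h ⟩
      t ℚ.+ (r ℚ.- t)   ≡⟨ plus-minus r t ⟨
      r                 ∎

  approxRoot-close : ∀ p q m n η → 0ℚ ℚ.< η →
    ℚ.∣ p ℚ.- q ∣ ℚ.< η ℚ.* η → + 1 ℚ./ suc n ℚ.< η →
    approxRoot p m ℚ.- approxRoot q n ℚ.< η ℚ.+ η
  approxRoot-close p q m n η η>0 = root-close {p} {q} {approxRoot p m} {approxRoot q n}
    η η>0 (approxRoot≥0 p m) (approxRoot≥0 q n)
    (ℚₚ.nonNegative⁻¹ (+ 1 ℚ./ suc n) {{ℚₚ.normalize-nonNeg 1 (suc n)}})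
    (approxRoot-lower p m) (approxRoot-upper q n)

  ∣∣-intro : ∀ {p ε} → p ℚ.< ε → ℚ.- p ℚ.< ε → ℚ.∣ p ∣ ℚ.< ε
  ∣∣-intro {p} {ε} h k with ℚₚ.∣p∣≡p∨∣p∣≡-p p
  ... | inj₁ e = subst (ℚ._< ε) (sym e) h
  ... | inj₂ e = subst (ℚ._< ε) (sym e) k

  sqrt-cauchy : ∀ {s} → Cauchy s → Cauchy (λ n → approxRoot (s n) n)
  sqrt-cauchy {s} cs ε ε>0 =
    let η = ½ ℚ.* ε
        η>0 = half>0 ε>0
        M , h = cs (η ℚ.* η) (*>0 η>0 η>0)
        N , k = archimedean η η>0
        close : ∀ m n → M ℕ.≤ m → M ℕ.≤ n → N ℕ.≤ n →
                approxRoot (s m) m ℚ.- approxRoot (s n) n ℚ.< ε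
        close m n M≤m M≤n N≤n = subst (approxRoot (s m) m ℚ.- approxRoot (s n) n ℚ.<_) (half+half ε)
          (approxRoot-close (s m) (s n) m n η η>0 (h m n M≤m M≤n) (k n N≤n))
    in M ℕ.+ N , λ m n ≤m ≤n →
      let M≤m = ℕₚ.m+n≤o⇒m≤o M ≤m
          M≤n = ℕₚ.m+n≤o⇒m≤o M ≤n
      in ∣∣-intro (close m n M≤m M≤n (ℕₚ.m+n≤o⇒n≤o M ≤n))
           (subst (ℚ._< ε) (sym (neg-minus (approxRoot (s m) m) (approxRoot (s n) n)))
             (close n m M≤n M≤m (ℕₚ.m+n≤o⇒n≤o M ≤m)))

-- The square root of max(x, 0): the n-th term is ⌊(n+1)√(max(xₙ,0))⌋ / (n+1).
√_ : ℝ → ℝ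
(√ x) .seq n  = approxRoot (seq x n) n
(√ x) .cauchy = sqrt-cauchy {seq x} (cauchy x)

φ : ℝ
φ = ℚ→ℝ ½ *ᵣ (1ᵣ +ᵣ √ ℚ→ℝ (+ 5 ℚ./ 1))

opaque

  golden>0 : ∀ {r} → 0ℚ ℚ.≤ r → 0ℚ ℚ.+ ½ ℚ.* ½ ℚ.< ½ ℚ.* (1ℚ ℚ.+ r)
  golden>0 {r} r≥0 = begin-strict
    0ℚ ℚ.+ ½ ℚ.* ½      <⟨ ℚ.*<* (ℤ.+<+ (ℕ.s≤s (ℕ.s≤s (ℕ.s≤s ℕ.z≤n)))) ⟩
    ½ ℚ.* (1ℚ ℚ.+ 0ℚ)   ≤⟨ ℚₚ.*-monoˡ-≤-nonNeg ½ (ℚₚ.+-monoʳ-≤ 1ℚ r≥0) ⟩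
    ½ ℚ.* (1ℚ ℚ.+ r)    ∎
    where open ℚₚ.≤-Reasoning

  φ>0 : 0ᵣ <ᵣ φ
  φ>0 = mk<ᵣ (½ ℚ.* ½) (ℚₚ.positive⁻¹ (½ ℚ.* ½)) 0 λ n _ → golden>0 (approxRoot≥0 (+ 5 ℚ./ 1) n)

φ^_ : ℤ → ℝ
φ^ (+ n)    = φ ^ᵣ n
φ^ -[1+ n ] = inv (φ ^ᵣ suc n) (^>0ᵣ φ>0 (suc n))

record ℂ : Set where
  no-eta-equality
  field
    re im : ℝ

open ℂ public

infix  4 _≈_
infixl 6 _+_ _-_
infixl 7 _*_
infix  8 -_

record _≈_ (z w : ℂ) : Set where
  constructor mk≈
  field
    re-≈ : re z ≈ᵣ re w
    im-≈ : im z ≈ᵣ im w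

_+_ : ℂ → ℂ → ℂ
(z + w) .re = re z +ᵣ re w
(z + w) .im = im z +ᵣ im w

-_ : ℂ → ℂ
(- z) .re = -ᵣ re z
(- z) .im = -ᵣ im z

_-_ : ℂ → ℂ → ℂ
z - w = z + (- w)

_*_ : ℂ → ℂ → ℂ
(z * w) .re = re z *ᵣ re w +ᵣ -ᵣ (im z *ᵣ im w)
(z * w) .im = re z *ᵣ im w +ᵣ im z *ᵣ re w

ℤ→ℂ : ℤ → ℂ
ℤ→ℂ m .re = ℚ→ℝ (m ℚ./ 1)
ℤ→ℂ m .im = 0ᵣ

ℕ→ℂ : ℕ → ℂ
ℕ→ℂ n = ℤ→ℂ (+ n)

ℂ-rawSemiring : RawSemiring 0ℓ 0ℓ
ℂ-rawSemiring = record
  { Carrier = ℂ ; _≈_ = _≈_ ; _+_ = _+_ ; _*_ = _*_ ; 0# = ℕ→ℂ 0 ; 1# = ℕ→ℂ 1 }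

open RawSemiringDefs ℂ-rawSemiring public using (_^_; sum)

normSq : ℂ → ℝ
normSq z = re z *ᵣ re z +ᵣ im z *ᵣ im z

∣_∣ : ℂ → ℝ
∣ z ∣ = √ normSq z

-- z ≠ 0, in the positive form that the reciprocal requires constructively.
_≉0 : ℂ → Set
z ≉0 = 0ᵣ <ᵣ normSq z

-- z⁻¹ = z̄ / |z|²
recip : ∀ z → z ≉0 → ℂ
recip z z≉0 .re = re z *ᵣ inv (normSq z) z≉0
recip z z≉0 .im = (-ᵣ im z) *ᵣ inv (normSq z) z≉0

∑[k<_] : ℕ → (ℕ → ℂ) → ℂ
∑[k< n ] f = sum {n} (λ i → f (toℕ i))

HasSum : (ℕ → ℂ) → ℂ → Set
HasSum f s = ∀ (ε : ℝ) → 0ᵣ <ᵣ ε → ∃[ N ] ∀ n → N ℕ.≤ n → ∣ ∑[k< n ] f - s ∣ <ᵣ ε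

IsGeneralizedFibonacci : (ℤ → ℂ) → Set
IsGeneralizedFibonacci G = ∀ m → G (m ℤ.+ + 2) ≈ G (m ℤ.+ + 1) + G m

-- At negative indices the recurrence is run backwards: L_m = L_{m+2} - L_{m+1}.
lucas : ℤ → ℤ
lucas (+ 0)             = + 2
lucas (+ 1)             = + 1
lucas (+ suc (suc n))   = lucas (+ suc n) ℤ.+ lucas (+ n)
lucas -[1+ 0 ]          = lucas (+ 1) ℤ.- lucas (+ 0)
lucas -[1+ 1 ]          = lucas (+ 0) ℤ.- lucas -[1+ 0 ]
lucas -[1+ suc (suc n) ] = lucas -[1+ n ] ℤ.- lucas -[1+ suc n ]

-- (-1)^m for an integer exponent; (-1)^(-m) = (-1)^m since -1 is its own inverse.
[-1]^_ : ℤ → ℤ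
[-1]^ m = ℤ.-1ℤ ℤ.^ ℤ.∣ m ∣

Δ : ℤ → ℂ → ℂ
Δ b x = ℕ→ℂ 1 - ℤ→ℂ (lucas b) * x + ℤ→ℂ ([-1]^ b) * x ^ 2

P : (ℤ → ℂ) → ℤ → ℤ → ℂ → ℕ → ℕ → ℂ
P G a b x v w = ∑[k< suc v ] λ k →
  ℕ→ℂ (v C k) * ℤ→ℂ ([-1]^ ((b ℤ.+ + 1) ℤ.* + k)) * x ^ k
    * G (a ℤ.+ b ℤ.* + w ℤ.- b ℤ.* + k)

-- Let E be the shift on sequences c with c (i + 2) = L_b c (i + 1) - (-1)^b c i; the
-- sequences i ↦ G (a + b i) are such. Then Δ = (1 - x E) D for D = 1 - L_b x + x E, and
-- also D = 1 - (-1)^b x E⁻¹, so that D^v c evaluated at w is P (v , w). Hence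
-- Δ xᵏ c k = xᵏ (D c) k - xᵏ⁺¹ (D c) (k + 1) telescopes, and summation by parts with
-- binomial weights gives by induction on j
--   Σ C(k , j) xᵏ c k = xʲ (D^(j+1) c) j / Δ^(j+1).
-- The powers kᵐ are combinations of the C(k , j) with coefficients j! S(m , j).
-- All boundary terms vanish because |G m| ≤ A ψ^|m| for every rational ψ with
-- ψ² ≥ ψ + 1, and ψ can be chosen such that |x| ψ^|b| < 1. The same telescoping for the
-- Lucas numbers shows Δ ≠ 0 constructively.
module Submission where

open import Defs
open import Algebra.Bundles using (CommutativeRing)
import Algebra.Solver.Ring as RingSolver
import Algebra.Solver.Ring.AlmostCommutativeRing as ACR
open import Data.Empty using (⊥-elim)
open import Data.Integer.Base as ℤ using (ℤ; +_; -[1+_])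
import Data.Integer.Properties as ℤₚ
import Data.Integer.Tactic.RingSolver as ℤ-Solver
open import Data.Maybe.Base using (Maybe; just; nothing)
open import Data.Nat.Base as ℕ using (ℕ; zero; suc)
open import Data.Nat.Combinatorics
  using (_C_; nCn≡1; nCk≡nC[n∸k]; nCk+nC[k+1]≡[n+1]C[k+1]; k>n⇒nCk≡0)
import Data.Nat.Properties as ℕₚ
import Data.Nat.Tactic.RingSolver as ℕ-Solver
open import Data.Product using (Σ-syntax; ∃-syntax; _×_; _,_; proj₁; proj₂)
open import Data.Rational.Base as ℚ using (ℚ; 0ℚ; 1ℚ; ½)
import Data.Rational.Properties as ℚₚ
open import Data.Rational.Unnormalised.Base as ℚᵘ using (mkℚᵘ)
import Data.Rational.Unnormalised.Properties as ℚᵘₚ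
open import Data.Sum.Base using (_⊎_; inj₁; inj₂)
open import Level using (0ℓ)
import Relation.Binary.Reasoning.Setoid as SetoidReasoning
open import Relation.Binary.PropositionalEquality
open import Relation.Nullary using (yes; no)
open import Relation.Nullary.Decidable using (from-yes)
open import Tactic.RingSolver using (solve-∀)
open import Algebra.Properties.CommutativeSemiring.Exp
  (CommutativeRing.commutativeSemiring ℚₚ.+-*-commutativeRing)
  using () renaming (_^_ to _^ℚ_; ^-distrib-* to ^ℚ-distrib-*; ^-homo-* to ^ℚ-homo-*;
                     ^-assocʳ to ^ℚ-assocʳ)

-- Why the Lucas numbers settle Δ ≠ 0: formally Σ L_{bk} xᵏ = (2 - L_b x) / Δ, and subtracting 1
-- leaves the numerator 1 - (-1)^b x², whose distance from 1 is |x|² < 1 whatever b is. Convergence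
-- cannot be used for this, since it is obtained by dividing by Δ. But the telescoped identity is
-- free of division, so one partial sum S with a small boundary term already puts Δ (S - 1) at a
-- distance less than 1 from 1, and this bounds |Δ| from below. The hypothesis on x speaks of reals
-- whose terms are rounded down. Rounded-down approximations of φ violate ψ² ≥ ψ + 1, which the
-- induction along the recurrence needs; the passage to upper approximations is paid for out of the
-- margin in |x| < φ^(-|b|). Elsewhere moduli are bounded through `_≺_`, which compares squares, so
-- real square roots occur only at the hypothesis and at the conclusion.

-- Cauchy reals up to equivalence: congruences and the reciprocal.

≗⇒≈ᵣ : ∀ {x y} → (∀ n → seq x n ≡ seq y n) → x ≈ᵣ y
≗⇒≈ᵣ {x} {y} h = mk≈ᵣ λ ε ε>0 → 0 , λ n _ →
  subst (λ q → ℚ.∣ q ∣ ℚ.< ε)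
    (sym (trans (cong (ℚ._- seq y n) (h n)) (ℚₚ.+-inverseʳ (seq y n)))) ε>0

≈ᵣ-refl : ∀ {x} → x ≈ᵣ x
≈ᵣ-refl = ≗⇒≈ᵣ λ _ → refl

opaque

  ∣-∣-swap : ∀ p q → ℚ.∣ p ℚ.- q ∣ ≡ ℚ.∣ q ℚ.- p ∣
  ∣-∣-swap p q = trans (sym (ℚₚ.∣-p∣≡∣p∣ (p ℚ.- q))) (cong ℚ.∣_∣ (neg-minus p q))

  insert-middle : ∀ p q r → p ℚ.- r ≡ (p ℚ.- q) ℚ.+ (q ℚ.- r)
  insert-middle = solve-∀ ℚ-ring

  ∣-∣-triangle : ∀ p q r → ℚ.∣ p ℚ.- r ∣ ℚ.≤ ℚ.∣ p ℚ.- q ∣ ℚ.+ ℚ.∣ q ℚ.- r ∣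
  ∣-∣-triangle p q r = subst (λ t → ℚ.∣ t ∣ ℚ.≤ ℚ.∣ p ℚ.- q ∣ ℚ.+ ℚ.∣ q ℚ.- r ∣)
    (sym (insert-middle p q r)) (ℚₚ.∣p+q∣≤∣p∣+∣q∣ (p ℚ.- q) (q ℚ.- r))

≈ᵣ-sym : ∀ {x y} → x ≈ᵣ y → y ≈ᵣ x
≈ᵣ-sym {x} {y} (mk≈ᵣ h) = mk≈ᵣ λ ε ε>0 → let N , k = h ε ε>0 in
  N , λ n N≤n → subst (ℚ._< ε) (∣-∣-swap (seq x n) (seq y n)) (k n N≤n)

≈ᵣ-trans : ∀ {x y z} → x ≈ᵣ y → y ≈ᵣ z → x ≈ᵣ z
≈ᵣ-trans {x} {y} {z} (mk≈ᵣ h) (mk≈ᵣ k) = mk≈ᵣ λ ε ε>0 →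
  let M , h′ = h (½ ℚ.* ε) (half>0 ε>0)
      N , k′ = k (½ ℚ.* ε) (half>0 ε>0)
  in M ℕ.+ N , λ n ≤n → begin-strict
    ℚ.∣ seq x n ℚ.- seq z n ∣
      ≤⟨ ∣-∣-triangle (seq x n) (seq y n) (seq z n) ⟩
    ℚ.∣ seq x n ℚ.- seq y n ∣ ℚ.+ ℚ.∣ seq y n ℚ.- seq z n ∣
      <⟨ ℚₚ.+-mono-< (h′ n (ℕₚ.m+n≤o⇒m≤o M ≤n)) (k′ n (ℕₚ.m+n≤o⇒n≤o M ≤n)) ⟩
    ½ ℚ.* ε ℚ.+ ½ ℚ.* ε
      ≡⟨ half+half ε ⟩
    ε ∎
  where open ℚₚ.≤-Reasoning

+ᵣ-cong : ∀ {x x′ y y′} → x ≈ᵣ x′ → y ≈ᵣ y′ → x +ᵣ y ≈ᵣ x′ +ᵣ y′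
+ᵣ-cong {x} {x′} {y} {y′} (mk≈ᵣ h) (mk≈ᵣ k) = mk≈ᵣ λ ε ε>0 →
  let M , h′ = h (½ ℚ.* ε) (half>0 ε>0)
      N , k′ = k (½ ℚ.* ε) (half>0 ε>0)
  in M ℕ.+ N , λ n ≤n → begin-strict
    ℚ.∣ (seq x n ℚ.+ seq y n) ℚ.- (seq x′ n ℚ.+ seq y′ n) ∣
      ≡⟨ cong ℚ.∣_∣ (+-minus-+ (seq x n) (seq y n) (seq x′ n) (seq y′ n)) ⟩
    ℚ.∣ (seq x n ℚ.- seq x′ n) ℚ.+ (seq y n ℚ.- seq y′ n) ∣
      ≤⟨ ℚₚ.∣p+q∣≤∣p∣+∣q∣ (seq x n ℚ.- seq x′ n) (seq y n ℚ.- seq y′ n) ⟩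
    ℚ.∣ seq x n ℚ.- seq x′ n ∣ ℚ.+ ℚ.∣ seq y n ℚ.- seq y′ n ∣
      <⟨ ℚₚ.+-mono-< (h′ n (ℕₚ.m+n≤o⇒m≤o M ≤n)) (k′ n (ℕₚ.m+n≤o⇒n≤o M ≤n)) ⟩
    ½ ℚ.* ε ℚ.+ ½ ℚ.* ε
      ≡⟨ half+half ε ⟩
    ε ∎
  where open ℚₚ.≤-Reasoning

-ᵣ-cong : ∀ {x y} → x ≈ᵣ y → -ᵣ x ≈ᵣ -ᵣ y
-ᵣ-cong {x} {y} (mk≈ᵣ h) = mk≈ᵣ λ ε ε>0 → let N , k = h ε ε>0 in
  N , λ n N≤n → subst (ℚ._< ε)
    (trans (sym (ℚₚ.∣-p∣≡∣p∣ (seq x n ℚ.- seq y n)))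
           (cong ℚ.∣_∣ (ℚₚ.neg-distrib-+ (seq x n) (ℚ.- seq y n))))
    (k n N≤n)

*ᵣ-cong : ∀ {x x′ y y′} → x ≈ᵣ x′ → y ≈ᵣ y′ → x *ᵣ y ≈ᵣ x′ *ᵣ y′
*ᵣ-cong {x} {x′} {y} {y′} (mk≈ᵣ h) (mk≈ᵣ k) = mk≈ᵣ λ ε ε>0 →
  let A , A>0 , K , hA = bounded {seq x} (cauchy x)
      B , B>0 , L , hB = bounded {seq y′} (cauchy y′)
      M , h′ = h ((ℚ.1/ B) {{ℚ.>-nonZero B>0}} ℚ.* (½ ℚ.* ε)) (*>0 (1/>0 B>0) (half>0 ε>0))
      N , k′ = k ((ℚ.1/ A) {{ℚ.>-nonZero A>0}} ℚ.* (½ ℚ.* ε)) (*>0 (1/>0 A>0) (half>0 ε>0))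
      KL = K ℕ.+ L
  in KL ℕ.+ (M ℕ.+ N) , λ n ≤n →
    let MN≤n = ℕₚ.m+n≤o⇒n≤o KL ≤n
        KL≤n = ℕₚ.m+n≤o⇒m≤o KL ≤n
    in *-close {seq x n} {seq y n} {seq x′ n} {seq y′ n} {A} {B} ε A>0 B>0
         (hA n (ℕₚ.m+n≤o⇒m≤o K KL≤n)) (hB n (ℕₚ.m+n≤o⇒n≤o K KL≤n))
         (h′ n (ℕₚ.m+n≤o⇒m≤o M MN≤n)) (k′ n (ℕₚ.m+n≤o⇒n≤o M MN≤n))

opaque

  -- `inv` reads `x` from a later index on, so the product at n pairs the reciprocal of one term
  -- with a different term. They cancel only in the limit: |p / q - 1| q = |p - q|, and this is
  -- below ε δ < ε q by the Cauchy property.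
  inv-inverse : ∀ x (x>0 : 0ᵣ <ᵣ x) → x *ᵣ inv x x>0 ≈ᵣ 1ᵣ
  inv-inverse x x>0@(mk<ᵣ δ δ>0 M _) = mk≈ᵣ λ ε ε>0 →
    let N , h = cauchy x (ε ℚ.* δ) (*>0 ε>0 δ>0)
    in N , λ n N≤n →
      let p = seq x n
          q = seq x (M ℕ.+ n)
          q>0 = term>0 x>0 n
          instance
            q≢0 : ℚ.NonZero q
            q≢0 = ℚ.>-nonZero q>0
      in ℚₚ.*-cancelʳ-<-nonNeg q {{ℚ.nonNegative (ℚₚ.<⇒≤ q>0)}} (begin-strict
        ℚ.∣ p ℚ.* ℚ.1/ q ℚ.- 1ℚ ∣ ℚ.* q
          ≡⟨ cong (ℚ.∣ p ℚ.* ℚ.1/ q ℚ.- 1ℚ ∣ ℚ.*_) (ℚₚ.0≤p⇒∣p∣≡p (ℚₚ.<⇒≤ q>0)) ⟨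
        ℚ.∣ p ℚ.* ℚ.1/ q ℚ.- 1ℚ ∣ ℚ.* ℚ.∣ q ∣
          ≡⟨ ℚₚ.∣p*q∣≡∣p∣*∣q∣ (p ℚ.* ℚ.1/ q ℚ.- 1ℚ) q ⟨
        ℚ.∣ (p ℚ.* ℚ.1/ q ℚ.- 1ℚ) ℚ.* q ∣
          ≡⟨ cong ℚ.∣_∣ (trans (rearrange p (ℚ.1/ q) q)
               (cong (λ u → p ℚ.* u ℚ.- q) (ℚₚ.*-inverseˡ q))) ⟩
        ℚ.∣ p ℚ.* 1ℚ ℚ.- q ∣
          ≡⟨ cong (λ u → ℚ.∣ u ℚ.- q ∣) (ℚₚ.*-identityʳ p) ⟩
        ℚ.∣ p ℚ.- q ∣
          <⟨ h n (M ℕ.+ n) N≤n (ℕₚ.≤-trans N≤n (ℕₚ.m≤n+m n M)) ⟩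
        ε ℚ.* δ
          <⟨ ℚₚ.*-monoʳ-<-pos ε {{ℚ.positive ε>0}} (margin<term x>0 n) ⟩
        ε ℚ.* q ∎)
    where
    open ℚₚ.≤-Reasoning
    rearrange : ∀ p i q → (p ℚ.* i ℚ.- 1ℚ) ℚ.* q ≡ p ℚ.* (i ℚ.* q) ℚ.- q
    rearrange = solve-∀ ℚ-ring

-- The complex numbers as a commutative ring, with a ring solver.

≗⇒≈ : ∀ {z w} → (∀ n → seq (re z) n ≡ seq (re w) n) →
      (∀ n → seq (im z) n ≡ seq (im w) n) → z ≈ w
≗⇒≈ h k = mk≈ (≗⇒≈ᵣ h) (≗⇒≈ᵣ k)

≈-refl : ∀ {z} → z ≈ z
≈-refl = mk≈ ≈ᵣ-refl ≈ᵣ-refl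

≈-sym : ∀ {z w} → z ≈ w → w ≈ z
≈-sym (mk≈ h k) = mk≈ (≈ᵣ-sym h) (≈ᵣ-sym k)

≈-trans : ∀ {z w v} → z ≈ w → w ≈ v → z ≈ v
≈-trans (mk≈ h k) (mk≈ h′ k′) = mk≈ (≈ᵣ-trans h h′) (≈ᵣ-trans k k′)

ℚ-assoc-re : ∀ a b c d e f →
  (a ℚ.* c ℚ.+ ℚ.- (b ℚ.* d)) ℚ.* e ℚ.+ ℚ.- ((a ℚ.* d ℚ.+ b ℚ.* c) ℚ.* f)
  ≡ a ℚ.* (c ℚ.* e ℚ.+ ℚ.- (d ℚ.* f)) ℚ.+ ℚ.- (b ℚ.* (c ℚ.* f ℚ.+ d ℚ.* e))
ℚ-assoc-re = solve-∀ ℚ-ring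

ℚ-assoc-im : ∀ a b c d e f →
  (a ℚ.* c ℚ.+ ℚ.- (b ℚ.* d)) ℚ.* f ℚ.+ (a ℚ.* d ℚ.+ b ℚ.* c) ℚ.* e
  ≡ a ℚ.* (c ℚ.* f ℚ.+ d ℚ.* e) ℚ.+ b ℚ.* (c ℚ.* e ℚ.+ ℚ.- (d ℚ.* f))
ℚ-assoc-im = solve-∀ ℚ-ring

ℚ-distrib-re : ∀ a b c d e f →
  a ℚ.* (c ℚ.+ e) ℚ.+ ℚ.- (b ℚ.* (d ℚ.+ f))
  ≡ (a ℚ.* c ℚ.+ ℚ.- (b ℚ.* d)) ℚ.+ (a ℚ.* e ℚ.+ ℚ.- (b ℚ.* f))
ℚ-distrib-re = solve-∀ ℚ-ring

ℚ-distrib-im : ∀ a b c d e f →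
  a ℚ.* (d ℚ.+ f) ℚ.+ b ℚ.* (c ℚ.+ e)
  ≡ (a ℚ.* d ℚ.+ b ℚ.* c) ℚ.+ (a ℚ.* f ℚ.+ b ℚ.* e)
ℚ-distrib-im = solve-∀ ℚ-ring

ℚ-comm-re : ∀ a b c d → a ℚ.* c ℚ.+ ℚ.- (b ℚ.* d) ≡ c ℚ.* a ℚ.+ ℚ.- (d ℚ.* b)
ℚ-comm-re = solve-∀ ℚ-ring

ℚ-comm-im : ∀ a b c d → a ℚ.* d ℚ.+ b ℚ.* c ≡ c ℚ.* b ℚ.+ d ℚ.* a
ℚ-comm-im = solve-∀ ℚ-ring

ℚ-identity-re : ∀ a b → 1ℚ ℚ.* a ℚ.+ ℚ.- (0ℚ ℚ.* b) ≡ a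
ℚ-identity-re = solve-∀ ℚ-ring

ℚ-identity-im : ∀ a b → 1ℚ ℚ.* b ℚ.+ 0ℚ ℚ.* a ≡ b
ℚ-identity-im = solve-∀ ℚ-ring

+-cong : ∀ {z z′ w w′} → z ≈ z′ → w ≈ w′ → z + w ≈ z′ + w′
+-cong (mk≈ h k) (mk≈ h′ k′) = mk≈ (+ᵣ-cong h h′) (+ᵣ-cong k k′)

*-cong : ∀ {z z′ w w′} → z ≈ z′ → w ≈ w′ → z * w ≈ z′ * w′
*-cong (mk≈ h k) (mk≈ h′ k′) = mk≈
  (+ᵣ-cong (*ᵣ-cong h h′) (-ᵣ-cong (*ᵣ-cong k k′)))
  (+ᵣ-cong (*ᵣ-cong h k′) (*ᵣ-cong k h′))

*-comm : ∀ z w → z * w ≈ w * z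
*-comm z w = ≗⇒≈
  (λ n → ℚ-comm-re (seq (re z) n) (seq (im z) n) (seq (re w) n) (seq (im w) n))
  (λ n → ℚ-comm-im (seq (re z) n) (seq (im z) n) (seq (re w) n) (seq (im w) n))

+-comm : ∀ z w → z + w ≈ w + z
+-comm z w = ≗⇒≈
  (λ n → ℚₚ.+-comm (seq (re z) n) (seq (re w) n))
  (λ n → ℚₚ.+-comm (seq (im z) n) (seq (im w) n))

+-identityˡ : ∀ z → ℕ→ℂ 0 + z ≈ z
+-identityˡ z = ≗⇒≈ (λ n → ℚₚ.+-identityˡ (seq (re z) n)) (λ n → ℚₚ.+-identityˡ (seq (im z) n))

+-inverseˡ : ∀ z → - z + z ≈ ℕ→ℂ 0
+-inverseˡ z = ≗⇒≈ (λ n → ℚₚ.+-inverseˡ (seq (re z) n)) (λ n → ℚₚ.+-inverseˡ (seq (im z) n))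

*-identityˡ : ∀ z → ℕ→ℂ 1 * z ≈ z
*-identityˡ z = ≗⇒≈
  (λ n → ℚ-identity-re (seq (re z) n) (seq (im z) n))
  (λ n → ℚ-identity-im (seq (re z) n) (seq (im z) n))

*-distribˡ-+ : ∀ z w v → z * (w + v) ≈ z * w + z * v
*-distribˡ-+ z w v = ≗⇒≈
  (λ n → ℚ-distrib-re (seq (re z) n) (seq (im z) n) (seq (re w) n) (seq (im w) n)
           (seq (re v) n) (seq (im v) n))
  (λ n → ℚ-distrib-im (seq (re z) n) (seq (im z) n) (seq (re w) n) (seq (im w) n)
           (seq (re v) n) (seq (im v) n))

ℂ-commutativeRing : CommutativeRing 0ℓ 0ℓ
ℂ-commutativeRing = record
  { Carrier = ℂ ; _≈_ = _≈_ ; _+_ = _+_ ; _*_ = _*_ ; -_ = -_ ; 0# = ℕ→ℂ 0 ; 1# = ℕ→ℂ 1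
  ; isCommutativeRing = record
    { isRing = record
      { +-isAbelianGroup = record
        { isGroup = record
          { isMonoid = record
            { isSemigroup = record
              { isMagma = record
                { isEquivalence = record { refl = ≈-refl ; sym = ≈-sym ; trans = ≈-trans }
                ; ∙-cong = +-cong
                }
              ; assoc = λ z w v → ≗⇒≈
                  (λ n → ℚₚ.+-assoc (seq (re z) n) (seq (re w) n) (seq (re v) n))
                  (λ n → ℚₚ.+-assoc (seq (im z) n) (seq (im w) n) (seq (im v) n))
              }
            ; identity = +-identityˡ , λ z → ≈-trans (+-comm z (ℕ→ℂ 0)) (+-identityˡ z)
            }
          ; inverse = +-inverseˡ , λ z → ≈-trans (+-comm z (- z)) (+-inverseˡ z)
          ; ⁻¹-cong = λ { (mk≈ h k) → mk≈ (-ᵣ-cong h) (-ᵣ-cong k) }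
          }
        ; comm = +-comm
        }
      ; *-cong = *-cong
      ; *-assoc = λ z w v → ≗⇒≈
          (λ n → ℚ-assoc-re (seq (re z) n) (seq (im z) n) (seq (re w) n) (seq (im w) n)
                   (seq (re v) n) (seq (im v) n))
          (λ n → ℚ-assoc-im (seq (re z) n) (seq (im z) n) (seq (re w) n) (seq (im w) n)
                   (seq (re v) n) (seq (im v) n))
      ; *-identity = *-identityˡ , λ z → ≈-trans (*-comm z (ℕ→ℂ 1)) (*-identityˡ z)
      ; distrib = *-distribˡ-+ , λ z w v → ≈-trans (*-comm (w + v) z)
          (≈-trans (*-distribˡ-+ z w v) (+-cong (*-comm z w) (*-comm z v)))
      }
    ; *-comm = *-comm
    }
  }

opaque

  /1-homo-+ : ∀ i j → (i ℤ.+ j) ℚ./ 1 ≡ i ℚ./ 1 ℚ.+ j ℚ./ 1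
  /1-homo-+ i j = ℚₚ.toℚᵘ-injective (begin
    ℚ.toℚᵘ ((i ℤ.+ j) ℚ./ 1)
      ≈⟨ ℚₚ.toℚᵘ-fromℚᵘ (mkℚᵘ (i ℤ.+ j) 0) ⟩
    mkℚᵘ (i ℤ.+ j) 0
      ≈⟨ ℚᵘ.*≡* (cong (ℤ._* + 1)
           (sym (cong₂ ℤ._+_ (ℤₚ.*-identityʳ i) (ℤₚ.*-identityʳ j)))) ⟩
    mkℚᵘ i 0 ℚᵘ.+ mkℚᵘ j 0
      ≈⟨ ℚᵘₚ.+-cong (ℚₚ.toℚᵘ-fromℚᵘ (mkℚᵘ i 0)) (ℚₚ.toℚᵘ-fromℚᵘ (mkℚᵘ j 0)) ⟨
    ℚ.toℚᵘ (i ℚ./ 1) ℚᵘ.+ ℚ.toℚᵘ (j ℚ./ 1)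
      ≈⟨ ℚₚ.toℚᵘ-homo-+ (i ℚ./ 1) (j ℚ./ 1) ⟨
    ℚ.toℚᵘ (i ℚ./ 1 ℚ.+ j ℚ./ 1) ∎)
    where open ℚᵘₚ.≃-Reasoning

  /1-homo-* : ∀ i j → (i ℤ.* j) ℚ./ 1 ≡ (i ℚ./ 1) ℚ.* (j ℚ./ 1)
  /1-homo-* i j = ℚₚ.toℚᵘ-injective (begin
    ℚ.toℚᵘ ((i ℤ.* j) ℚ./ 1)
      ≈⟨ ℚₚ.toℚᵘ-fromℚᵘ (mkℚᵘ (i ℤ.* j) 0) ⟩
    mkℚᵘ i 0 ℚᵘ.* mkℚᵘ j 0
      ≈⟨ ℚᵘₚ.*-cong (ℚₚ.toℚᵘ-fromℚᵘ (mkℚᵘ i 0)) (ℚₚ.toℚᵘ-fromℚᵘ (mkℚᵘ j 0)) ⟨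
    ℚ.toℚᵘ (i ℚ./ 1) ℚᵘ.* ℚ.toℚᵘ (j ℚ./ 1)
      ≈⟨ ℚₚ.toℚᵘ-homo-* (i ℚ./ 1) (j ℚ./ 1) ⟨
    ℚ.toℚᵘ ((i ℚ./ 1) ℚ.* (j ℚ./ 1)) ∎)
    where open ℚᵘₚ.≃-Reasoning

  /1-homo-neg : ∀ i → (ℤ.- i) ℚ./ 1 ≡ ℚ.- (i ℚ./ 1)
  /1-homo-neg i = begin
    j                           ≡⟨ ℚₚ.+-identityʳ j ⟨
    j ℚ.+ 0ℚ                    ≡⟨ cong (j ℚ.+_) (ℚₚ.+-inverseʳ k) ⟨
    j ℚ.+ (k ℚ.- k)             ≡⟨ ℚₚ.+-assoc j k (ℚ.- k) ⟨
    j ℚ.+ k ℚ.- k               ≡⟨ cong (ℚ._- k) (/1-homo-+ (ℤ.- i) i) ⟨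
    (ℤ.- i ℤ.+ i) ℚ./ 1 ℚ.- k   ≡⟨ cong (λ m → m ℚ./ 1 ℚ.- k) (ℤₚ.+-inverseˡ i) ⟩
    0ℚ ℚ.- k                    ≡⟨ ℚₚ.+-identityˡ (ℚ.- k) ⟩
    ℚ.- k                       ∎
    where
    open ≡-Reasoning
    j k : ℚ
    j = (ℤ.- i) ℚ./ 1
    k = i ℚ./ 1

  *-real-re : ∀ p q → p ℚ.* q ≡ p ℚ.* q ℚ.+ ℚ.- (0ℚ ℚ.* 0ℚ)
  *-real-re = solve-∀ ℚ-ring

  *-real-im : ∀ p q → 0ℚ ≡ p ℚ.* 0ℚ ℚ.+ 0ℚ ℚ.* q
  *-real-im = solve-∀ ℚ-ring

ℤ→ℂ-homo-+ : ∀ i j → ℤ→ℂ (i ℤ.+ j) ≈ ℤ→ℂ i + ℤ→ℂ j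
ℤ→ℂ-homo-+ i j = ≗⇒≈ (λ _ → /1-homo-+ i j) (λ _ → refl)

ℤ→ℂ-homo-* : ∀ i j → ℤ→ℂ (i ℤ.* j) ≈ ℤ→ℂ i * ℤ→ℂ j
ℤ→ℂ-homo-* i j = ≗⇒≈
  (λ _ → trans (/1-homo-* i j) (*-real-re (i ℚ./ 1) (j ℚ./ 1)))
  (λ _ → *-real-im (i ℚ./ 1) (j ℚ./ 1))

ℤ→ℂ-homo-neg : ∀ i → ℤ→ℂ (ℤ.- i) ≈ - ℤ→ℂ i
ℤ→ℂ-homo-neg i = ≗⇒≈ (λ _ → /1-homo-neg i) (λ _ → refl)

ℤ→ℂ-morphism : CommutativeRing.rawRing ℤₚ.+-*-commutativeRing
               ACR.-Raw-AlmostCommutative⟶ ACR.fromCommutativeRing ℂ-commutativeRing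
ℤ→ℂ-morphism = record
  { ⟦_⟧    = ℤ→ℂ
  ; +-homo = ℤ→ℂ-homo-+
  ; *-homo = ℤ→ℂ-homo-*
  ; -‿homo = ℤ→ℂ-homo-neg
  ; 0-homo = ≈-refl
  ; 1-homo = ≈-refl
  }

ℤ→ℂ-≟ : ∀ i j → Maybe (ℤ→ℂ i ≈ ℤ→ℂ j)
ℤ→ℂ-≟ i j with i ℤₚ.≟ j
... | yes refl = just ≈-refl
... | no  _    = nothing

-- Coefficients are integers, on which equality is decidable, as it is not on ℂ; numerals enter the
-- equations as `con`.
module ℂ-Solver = RingSolver
  (CommutativeRing.rawRing ℤₚ.+-*-commutativeRing)
  (ACR.fromCommutativeRing ℂ-commutativeRing) ℤ→ℂ-morphism ℤ→ℂ-≟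

open ℂ-Solver using (solve; con; _:=_; _:+_; _:*_; :-_; _:-_)

open CommutativeRing ℂ-commutativeRing using (-‿cong)
open import Algebra.Properties.CommutativeSemiring.Exp
  (CommutativeRing.commutativeSemiring ℂ-commutativeRing) using (^-distrib-*; ^-congˡ)

module ≈-Reasoning = SetoidReasoning (CommutativeRing.setoid ℂ-commutativeRing)

-- Rational estimates for moduli.

opaque

  square-neg : ∀ p → (ℚ.- p) ℚ.* (ℚ.- p) ≡ p ℚ.* p
  square-neg = solve-∀ ℚ-ring

  square-∣∣ : ∀ p → ℚ.∣ p ∣ ℚ.* ℚ.∣ p ∣ ≡ p ℚ.* p
  square-∣∣ p with ℚₚ.∣p∣≡p∨∣p∣≡-p p
  ... | inj₁ e = cong₂ ℚ._*_ e e
  ... | inj₂ e = trans (cong₂ ℚ._*_ e e) (square-neg p)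

  square≥0 : ∀ p → 0ℚ ℚ.≤ p ℚ.* p
  square≥0 p = subst (0ℚ ℚ.≤_) (square-∣∣ p)
    (subst (ℚ._≤ ℚ.∣ p ∣ ℚ.* ℚ.∣ p ∣) (ℚₚ.*-zeroʳ ℚ.∣ p ∣)
      (ℚₚ.*-monoˡ-≤-nonNeg ℚ.∣ p ∣ {{ℚ.nonNegative (ℚₚ.0≤∣p∣ p)}} (ℚₚ.0≤∣p∣ p)))

  *≥0 : ∀ {p q} → 0ℚ ℚ.≤ p → 0ℚ ℚ.≤ q → 0ℚ ℚ.≤ p ℚ.* q
  *≥0 {p} {q} p≥0 q≥0 = subst (ℚ._≤ p ℚ.* q) (ℚₚ.*-zeroʳ p)
    (ℚₚ.*-monoˡ-≤-nonNeg p {{ℚ.nonNegative p≥0}} q≥0)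

  +≥0 : ∀ {p q} → 0ℚ ℚ.≤ p → 0ℚ ℚ.≤ q → 0ℚ ℚ.≤ p ℚ.+ q
  +≥0 {p} {q} p≥0 q≥0 = ℚₚ.+-mono-≤ {0ℚ} {p} {0ℚ} p≥0 q≥0

  +>0 : ∀ {p q} → 0ℚ ℚ.< p → 0ℚ ℚ.≤ q → 0ℚ ℚ.< p ℚ.+ q
  +>0 {p} {q} p>0 q≥0 = ℚₚ.+-mono-<-≤ {0ℚ} {p} {0ℚ} p>0 q≥0

  p≤p+q : ∀ {p q} → 0ℚ ℚ.≤ q → p ℚ.≤ p ℚ.+ q
  p≤p+q {p} {q} q≥0 = subst (ℚ._≤ p ℚ.+ q) (ℚₚ.+-identityʳ p) (ℚₚ.+-monoʳ-≤ p q≥0)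

  p<p+q : ∀ {p q} → 0ℚ ℚ.< q → p ℚ.< p ℚ.+ q
  p<p+q {p} {q} q>0 = subst (ℚ._< p ℚ.+ q) (ℚₚ.+-identityʳ p) (ℚₚ.+-monoʳ-< p q>0)

  p<q⇒0<q-p : ∀ {p q} → p ℚ.< q → 0ℚ ℚ.< q ℚ.- p
  p<q⇒0<q-p {p} {q} p<q = subst (ℚ._< q ℚ.- p) (ℚₚ.+-inverseʳ p) (ℚₚ.+-monoˡ-< (ℚ.- p) p<q)

  p≤q⇒0≤q-p : ∀ {p q} → p ℚ.≤ q → 0ℚ ℚ.≤ q ℚ.- p
  p≤q⇒0≤q-p {p} {q} p≤q = subst (ℚ._≤ q ℚ.- p) (ℚₚ.+-inverseʳ p) (ℚₚ.+-monoˡ-≤ (ℚ.- p) p≤q)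

  square-cancel-≤ : ∀ {p q} → 0ℚ ℚ.≤ q → p ℚ.* p ℚ.≤ q ℚ.* q → p ℚ.≤ q
  square-cancel-≤ {p} {q} q≥0 pp≤qq with p ℚₚ.≤? q
  ... | yes p≤q = p≤q
  ... | no  p≰q = ⊥-elim (ℚₚ.<-irrefl refl (begin-strict
    q ℚ.* q ≤⟨ ℚₚ.*-monoˡ-≤-nonNeg q {{ℚ.nonNegative q≥0}} (ℚₚ.<⇒≤ q<p) ⟩
    q ℚ.* p <⟨ ℚₚ.*-monoˡ-<-pos p {{ℚ.positive (ℚₚ.≤-<-trans q≥0 q<p)}} q<p ⟩
    p ℚ.* p ≤⟨ pp≤qq ⟩
    q ℚ.* q ∎))
    where
    open ℚₚ.≤-Reasoning
    q<p : q ℚ.< p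
    q<p = ℚₚ.≰⇒> p≰q

  -- Lagrange's identity. Moduli need not be rational, so they are represented by rational upper
  -- bounds `p` and `q`, of which only the squares are compared.
  cauchy-schwarz : ∀ a b c d {p q} → 0ℚ ℚ.≤ p → 0ℚ ℚ.≤ q →
    a ℚ.* a ℚ.+ b ℚ.* b ℚ.≤ p ℚ.* p → c ℚ.* c ℚ.+ d ℚ.* d ℚ.≤ q ℚ.* q →
    a ℚ.* c ℚ.+ b ℚ.* d ℚ.≤ p ℚ.* q
  cauchy-schwarz a b c d {p} {q} p≥0 q≥0 h k = square-cancel-≤ (*≥0 p≥0 q≥0) (begin
    (a ℚ.* c ℚ.+ b ℚ.* d) ℚ.* (a ℚ.* c ℚ.+ b ℚ.* d)
      ≤⟨ p≤p+q (square≥0 (a ℚ.* d ℚ.- b ℚ.* c)) ⟩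
    (a ℚ.* c ℚ.+ b ℚ.* d) ℚ.* (a ℚ.* c ℚ.+ b ℚ.* d)
      ℚ.+ (a ℚ.* d ℚ.- b ℚ.* c) ℚ.* (a ℚ.* d ℚ.- b ℚ.* c)
      ≡⟨ lagrange a b c d ⟩
    (a ℚ.* a ℚ.+ b ℚ.* b) ℚ.* (c ℚ.* c ℚ.+ d ℚ.* d)
      ≤⟨ *-mono-≤ (+≥0 (square≥0 a) (square≥0 b)) (square≥0 q) h k ⟩
    (p ℚ.* p) ℚ.* (q ℚ.* q)
      ≡⟨ interchange p q ⟩
    (p ℚ.* q) ℚ.* (p ℚ.* q) ∎)
    where
    open ℚₚ.≤-Reasoning
    lagrange : ∀ a b c d → (a ℚ.* c ℚ.+ b ℚ.* d) ℚ.* (a ℚ.* c ℚ.+ b ℚ.* d)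
      ℚ.+ (a ℚ.* d ℚ.- b ℚ.* c) ℚ.* (a ℚ.* d ℚ.- b ℚ.* c)
      ≡ (a ℚ.* a ℚ.+ b ℚ.* b) ℚ.* (c ℚ.* c ℚ.+ d ℚ.* d)
    lagrange = solve-∀ ℚ-ring
    interchange : ∀ p q → (p ℚ.* p) ℚ.* (q ℚ.* q) ≡ (p ℚ.* q) ℚ.* (p ℚ.* q)
    interchange = solve-∀ ℚ-ring

  normSq-+-≤ : ∀ a b c d {p q} → 0ℚ ℚ.≤ p → 0ℚ ℚ.≤ q →
    a ℚ.* a ℚ.+ b ℚ.* b ℚ.≤ p ℚ.* p → c ℚ.* c ℚ.+ d ℚ.* d ℚ.≤ q ℚ.* q →
    (a ℚ.+ c) ℚ.* (a ℚ.+ c) ℚ.+ (b ℚ.+ d) ℚ.* (b ℚ.+ d) ℚ.≤ (p ℚ.+ q) ℚ.* (p ℚ.+ q)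
  normSq-+-≤ a b c d {p} {q} p≥0 q≥0 h k = begin
    (a ℚ.+ c) ℚ.* (a ℚ.+ c) ℚ.+ (b ℚ.+ d) ℚ.* (b ℚ.+ d)
      ≡⟨ expand a b c d ⟩
    ((a ℚ.* a ℚ.+ b ℚ.* b) ℚ.+ (c ℚ.* c ℚ.+ d ℚ.* d)) ℚ.+ (e ℚ.+ e)
      ≤⟨ ℚₚ.+-mono-≤ (ℚₚ.+-mono-≤ h k) (ℚₚ.+-mono-≤ e≤pq e≤pq) ⟩
    (p ℚ.* p ℚ.+ q ℚ.* q) ℚ.+ (p ℚ.* q ℚ.+ p ℚ.* q)
      ≡⟨ square-+ p q ⟩
    (p ℚ.+ q) ℚ.* (p ℚ.+ q) ∎
    where
    open ℚₚ.≤-Reasoning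
    e : ℚ
    e = a ℚ.* c ℚ.+ b ℚ.* d
    e≤pq : e ℚ.≤ p ℚ.* q
    e≤pq = cauchy-schwarz a b c d p≥0 q≥0 h k
    expand : ∀ a b c d → (a ℚ.+ c) ℚ.* (a ℚ.+ c) ℚ.+ (b ℚ.+ d) ℚ.* (b ℚ.+ d)
      ≡ ((a ℚ.* a ℚ.+ b ℚ.* b) ℚ.+ (c ℚ.* c ℚ.+ d ℚ.* d))
        ℚ.+ ((a ℚ.* c ℚ.+ b ℚ.* d) ℚ.+ (a ℚ.* c ℚ.+ b ℚ.* d))
    expand = solve-∀ ℚ-ring

  -- The Brahmagupta-Fibonacci identity, that is, multiplicativity of the modulus.
  normSq-* : ∀ a b c d →
    (a ℚ.* c ℚ.+ ℚ.- (b ℚ.* d)) ℚ.* (a ℚ.* c ℚ.+ ℚ.- (b ℚ.* d))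
      ℚ.+ (a ℚ.* d ℚ.+ b ℚ.* c) ℚ.* (a ℚ.* d ℚ.+ b ℚ.* c)
    ≡ (a ℚ.* a ℚ.+ b ℚ.* b) ℚ.* (c ℚ.* c ℚ.+ d ℚ.* d)
  normSq-* = solve-∀ ℚ-ring

  square-* : ∀ p q → (p ℚ.* p) ℚ.* (q ℚ.* q) ≡ (p ℚ.* q) ℚ.* (p ℚ.* q)
  square-* = solve-∀ ℚ-ring

  normSq-≤-∣∣ : ∀ {a b p q} → ℚ.∣ a ∣ ℚ.≤ p → ℚ.∣ b ∣ ℚ.≤ q →
    a ℚ.* a ℚ.+ b ℚ.* b ℚ.≤ (p ℚ.+ q) ℚ.* (p ℚ.+ q)
  normSq-≤-∣∣ {a} {b} {p} {q} a≤p b≤q = begin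
    a ℚ.* a ℚ.+ b ℚ.* b
      ≤⟨ ℚₚ.+-mono-≤ (square-≤ a p≥0 a≤p) (square-≤ b q≥0 b≤q) ⟩
    p ℚ.* p ℚ.+ q ℚ.* q
      ≤⟨ p≤p+q (+≥0 (*≥0 p≥0 q≥0) (*≥0 p≥0 q≥0)) ⟩
    (p ℚ.* p ℚ.+ q ℚ.* q) ℚ.+ (p ℚ.* q ℚ.+ p ℚ.* q)
      ≡⟨ square-+ p q ⟩
    (p ℚ.+ q) ℚ.* (p ℚ.+ q) ∎
    where
    open ℚₚ.≤-Reasoning
    p≥0 : 0ℚ ℚ.≤ p
    p≥0 = ℚₚ.≤-trans (ℚₚ.0≤∣p∣ a) a≤p
    q≥0 : 0ℚ ℚ.≤ q
    q≥0 = ℚₚ.≤-trans (ℚₚ.0≤∣p∣ b) b≤q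
    square-≤ : ∀ a {p} → 0ℚ ℚ.≤ p → ℚ.∣ a ∣ ℚ.≤ p → a ℚ.* a ℚ.≤ p ℚ.* p
    square-≤ a {p} p≥0 h = subst (ℚ._≤ p ℚ.* p) (square-∣∣ a)
      (*-mono-≤ (ℚₚ.0≤∣p∣ a) p≥0 h h)

infix 4 _≺_

-- The modulus of z is less than the rational q.
record _≺_ (z : ℂ) (q : ℚ) : Set where
  constructor mk≺
  field
    bound   : ℚ
    bound≥0 : 0ℚ ℚ.≤ bound
    bound<q : bound ℚ.< q
    from    : ℕ
    below   : ∀ n → from ℕ.≤ n → seq (normSq z) n ℚ.≤ bound ℚ.* bound

≺⇒>0 : ∀ {z q} → z ≺ q → 0ℚ ℚ.< q
≺⇒>0 (mk≺ _ p≥0 p<q _ _) = ℚₚ.≤-<-trans p≥0 p<q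

≺-≤-trans : ∀ {z p q} → z ≺ p → p ℚ.≤ q → z ≺ q
≺-≤-trans (mk≺ r r≥0 r<p N h) p≤q = mk≺ r r≥0 (ℚₚ.<-≤-trans r<p p≤q) N h

opaque

  ≺-+ : ∀ {z w p q} → z ≺ p → w ≺ q → z + w ≺ p ℚ.+ q
  ≺-+ {z} {w} (mk≺ r r≥0 r<p M h) (mk≺ s s≥0 s<q N k) =
    mk≺ (r ℚ.+ s) (+≥0 r≥0 s≥0) (ℚₚ.+-mono-< r<p s<q) (M ℕ.+ N) λ n ≤n →
      normSq-+-≤ (seq (re z) n) (seq (im z) n) (seq (re w) n) (seq (im w) n) r≥0 s≥0
        (h n (ℕₚ.m+n≤o⇒m≤o M ≤n)) (k n (ℕₚ.m+n≤o⇒n≤o M ≤n))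

  ≺-* : ∀ {z w p q} → z ≺ p → w ≺ q → z * w ≺ p ℚ.* q
  ≺-* {z} {w} {p} {q} (mk≺ r r≥0 r<p M h) (mk≺ s s≥0 s<q N k) =
    mk≺ (r ℚ.* s) (*≥0 r≥0 s≥0) rs<pq (M ℕ.+ N) λ n ≤n →
      let a = seq (re z) n
          b = seq (im z) n
          c = seq (re w) n
          d = seq (im w) n
      in subst₂ ℚ._≤_ (sym (normSq-* a b c d)) (square-* r s)
        (*-mono-≤ (+≥0 (square≥0 a) (square≥0 b)) (square≥0 s)
          (h n (ℕₚ.m+n≤o⇒m≤o M ≤n)) (k n (ℕₚ.m+n≤o⇒n≤o M ≤n)))
    where
    rs<pq : r ℚ.* s ℚ.< p ℚ.* q
    rs<pq = ℚₚ.≤-<-trans (ℚₚ.*-monoˡ-≤-nonNeg r {{ℚ.nonNegative r≥0}} (ℚₚ.<⇒≤ s<q))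
      (ℚₚ.*-monoˡ-<-pos q {{ℚ.positive (ℚₚ.≤-<-trans s≥0 s<q)}} r<p)

  ≺-neg : ∀ {z q} → z ≺ q → - z ≺ q
  ≺-neg {z} (mk≺ r r≥0 r<q N h) = mk≺ r r≥0 r<q N λ n N≤n →
    subst (ℚ._≤ r ℚ.* r)
      (sym (cong₂ ℚ._+_ (square-neg (seq (re z) n)) (square-neg (seq (im z) n))))
      (h n N≤n)

  ≈0⇒≺ : ∀ {z} → z ≈ ℕ→ℂ 0 → ∀ {δ} → 0ℚ ℚ.< δ → z ≺ δ
  ≈0⇒≺ {z} (mk≈ (mk≈ᵣ h) (mk≈ᵣ k)) {δ} δ>0 =
    -- A quarter of δ: real and imaginary part together contribute at most 2 η = δ/2 to the modulus,
    -- which is strictly below δ.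
    let η = ½ ℚ.* (½ ℚ.* δ)
        η>0 = half>0 (half>0 δ>0)
        M , h′ = h η η>0
        N , k′ = k η η>0
    in mk≺ (η ℚ.+ η) (+≥0 (ℚₚ.<⇒≤ η>0) (ℚₚ.<⇒≤ η>0))
      (subst₂ ℚ._<_ (sym (half+half (½ ℚ.* δ))) (half+half δ) (p<p+q (half>0 δ>0)))
      (M ℕ.+ N) λ n ≤n → normSq-≤-∣∣ {seq (re z) n} {seq (im z) n}
        (ℚₚ.<⇒≤ (subst (λ q → ℚ.∣ q ∣ ℚ.< η) (ℚₚ.+-identityʳ (seq (re z) n))
          (h′ n (ℕₚ.m+n≤o⇒m≤o M ≤n))))
        (ℚₚ.<⇒≤ (subst (λ q → ℚ.∣ q ∣ ℚ.< η) (ℚₚ.+-identityʳ (seq (im z) n))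
          (k′ n (ℕₚ.m+n≤o⇒n≤o M ≤n))))

  bounded-ℂ : ∀ z → ∃[ q ] z ≺ q
  bounded-ℂ z =
    let A , A>0 , M , h = bounded {seq (re z)} (cauchy (re z))
        B , B>0 , N , k = bounded {seq (im z)} (cauchy (im z))
    in (A ℚ.+ B) ℚ.+ 1ℚ , mk≺ (A ℚ.+ B) (+≥0 (ℚₚ.<⇒≤ A>0) (ℚₚ.<⇒≤ B>0))
      (p<p+q (ℚₚ.positive⁻¹ 1ℚ)) (M ℕ.+ N) λ n ≤n →
        normSq-≤-∣∣ {seq (re z) n} {seq (im z) n}
          (h n (ℕₚ.m+n≤o⇒m≤o M ≤n)) (k n (ℕₚ.m+n≤o⇒n≤o M ≤n))

  ℕ→ℂ-≺ : ∀ m {q} → + m ℚ./ 1 ℚ.< q → ℕ→ℂ m ≺ q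
  ℕ→ℂ-≺ m m<q = mk≺ (+ m ℚ./ 1) (ℚₚ.nonNegative⁻¹ _ {{ℚₚ.normalize-nonNeg m 1}}) m<q 0 λ _ _ →
    ℚₚ.≤-reflexive (ℚₚ.+-identityʳ ((+ m ℚ./ 1) ℚ.* (+ m ℚ./ 1)))

≺-minus : ∀ {z w p q} → z ≺ p → w ≺ q → z - w ≺ p ℚ.+ q
≺-minus h k = ≺-+ h (≺-neg k)

-- The gap between the bound `r` and `q` pays for the change of representative: one half goes to z,
-- the other to w - z.
≺-resp-≈ : ∀ {z w q} → z ≈ w → z ≺ q → w ≺ q
≺-resp-≈ {z} {w} {q} z≈w (mk≺ r r≥0 r<q N h) =
  ≺-resp-≗ (≺-≤-trans (≺-+ z≺m w-z≺η) (ℚₚ.≤-reflexive sum≡q))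
  where
  η : ℚ
  η = ½ ℚ.* (q ℚ.- r)
  η>0 : 0ℚ ℚ.< η
  η>0 = half>0 (p<q⇒0<q-p r<q)
  z≺m : z ≺ r ℚ.+ η
  z≺m = mk≺ r r≥0 (p<p+q η>0) N h
  w-z≺η : w - z ≺ η
  w-z≺η = ≈0⇒≺ (≈-trans (+-cong (≈-sym z≈w) ≈-refl)
    (≈-trans (+-comm z (- z)) (+-inverseˡ z))) η>0
  sum≡q : r ℚ.+ η ℚ.+ η ≡ q
  sum≡q = trans (ℚₚ.+-assoc r η η) (trans (cong (r ℚ.+_) (half+half (q ℚ.- r))) (sym (plus-minus q r)))
  -- z + (w - z) and w have equal terms, so the bound is carried over term by term; carrying it over
  -- along `_≈_` would be circular.
  ≺-resp-≗ : z + (w - z) ≺ q → w ≺ q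
  ≺-resp-≗ (mk≺ s s≥0 s<q M k) = mk≺ s s≥0 s<q M λ n M≤n → subst (ℚ._≤ s ℚ.* s)
    (cong₂ (λ a b → a ℚ.* a ℚ.+ b ℚ.* b)
      (sym (plus-minus (seq (re w) n) (seq (re z) n)))
      (sym (plus-minus (seq (im w) n) (seq (im z) n))))
    (k n M≤n)

opaque

  -- Re (z * w) stays above 1 - r > 0, and normSq z * normSq w ≥ (Re (z * w))².
  near-one⇒≉0 : ∀ z w → ℕ→ℂ 1 - z * w ≺ 1ℚ → z ≉0
  near-one⇒≉0 z w (mk≺ r r≥0 r<1 M h) =
    let W , mk≺ s s≥0 s<W N k = bounded-ℂ w
        η = 1ℚ ℚ.- r
        η>0 = p<q⇒0<q-p r<1
        W>0 = ℚₚ.≤-<-trans s≥0 s<W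
        WW>0 = *>0 W>0 W>0
        V = (ℚ.1/ (W ℚ.* W)) {{ℚ.>-nonZero WW>0}}
        VW≡1 = ℚₚ.*-inverseˡ (W ℚ.* W) {{ℚ.>-nonZero WW>0}}
        -- |z|² ≥ (Re (z w))² / |w|² ≥ η² / W²; halving gives the strict inequality that `_<ᵣ_` asks
        -- for.
        μ = ½ ℚ.* (V ℚ.* (η ℚ.* η))
        m>0 = *>0 (1/>0 WW>0) (*>0 η>0 η>0)
    in mk<ᵣ μ (half>0 m>0) (M ℕ.+ N) λ n ≤n →
      let a = seq (re z) n
          b = seq (im z) n
          c = seq (re w) n
          d = seq (im w) n
          z² = seq (normSq z) n
          w² = seq (normSq w) n
          u = a ℚ.* c ℚ.+ ℚ.- (b ℚ.* d)
          v = a ℚ.* d ℚ.+ b ℚ.* c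
          1-u≤r : 1ℚ ℚ.- u ℚ.≤ r
          1-u≤r = square-cancel-≤ r≥0 (ℚₚ.≤-trans
            (p≤p+q (square≥0 (0ℚ ℚ.- v))) (h n (ℕₚ.m+n≤o⇒m≤o M ≤n)))
          η≤u : η ℚ.≤ u
          η≤u = subst₂ ℚ._≤_ (shift₁ u r) (shift₂ u r) (ℚₚ.+-monoʳ-≤ (u ℚ.- r) 1-u≤r)
          u≥0 : 0ℚ ℚ.≤ u
          u≥0 = ℚₚ.≤-trans (ℚₚ.<⇒≤ η>0) η≤u
          z²≥0 : 0ℚ ℚ.≤ z²
          z²≥0 = +≥0 (square≥0 a) (square≥0 b)
          V≥0 : ℚ.NonNegative V
          V≥0 = ℚ.nonNegative (ℚₚ.<⇒≤ (1/>0 WW>0))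
      in begin-strict
        0ℚ ℚ.+ μ
          ≡⟨ ℚₚ.+-identityˡ μ ⟩
        μ
          <⟨ p<p+q (half>0 m>0) ⟩
        μ ℚ.+ μ
          ≡⟨ half+half (V ℚ.* (η ℚ.* η)) ⟩
        V ℚ.* (η ℚ.* η)
          ≤⟨ ℚₚ.*-monoˡ-≤-nonNeg V {{V≥0}} (*-mono-≤ (ℚₚ.<⇒≤ η>0) u≥0 η≤u η≤u) ⟩
        V ℚ.* (u ℚ.* u)
          ≤⟨ ℚₚ.*-monoˡ-≤-nonNeg V {{V≥0}} (p≤p+q (square≥0 v)) ⟩
        V ℚ.* (u ℚ.* u ℚ.+ v ℚ.* v)
          ≡⟨ cong (V ℚ.*_) (normSq-* a b c d) ⟩
        V ℚ.* (z² ℚ.* w²)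
          ≤⟨ ℚₚ.*-monoˡ-≤-nonNeg V {{V≥0}} (ℚₚ.*-monoˡ-≤-nonNeg z² {{ℚ.nonNegative z²≥0}}
               (ℚₚ.≤-trans (k n (ℕₚ.m+n≤o⇒n≤o M ≤n))
                 (*-mono-≤ s≥0 (ℚₚ.<⇒≤ W>0) (ℚₚ.<⇒≤ s<W) (ℚₚ.<⇒≤ s<W)))) ⟩
        V ℚ.* (z² ℚ.* (W ℚ.* W))
          ≡⟨ swap V z² (W ℚ.* W) ⟩
        (V ℚ.* (W ℚ.* W)) ℚ.* z²
          ≡⟨ cong (ℚ._* z²) VW≡1 ⟩
        1ℚ ℚ.* z²
          ≡⟨ ℚₚ.*-identityˡ z² ⟩
        z² ∎
    where
    open ℚₚ.≤-Reasoning
    shift₁ : ∀ u r → (u ℚ.- r) ℚ.+ (1ℚ ℚ.- u) ≡ 1ℚ ℚ.- r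
    shift₁ = solve-∀ ℚ-ring
    shift₂ : ∀ u r → (u ℚ.- r) ℚ.+ r ≡ u
    shift₂ = solve-∀ ℚ-ring
    swap : ∀ p q r → p ℚ.* (q ℚ.* r) ≡ (p ℚ.* r) ℚ.* q
    swap = solve-∀ ℚ-ring

opaque

  -- `approxRoot` rounds down, so the bound `r` on the modulus eventually bounds the terms of
  -- `∣ z ∣` without error, and δ - r is left as margin.
  ≺⇒∣∣<ᵣ : ∀ {z δ ε} → z ≺ δ → (∃[ N ] ∀ n → N ℕ.≤ n → δ ℚ.< seq ε n) → ∣ z ∣ <ᵣ ε
  ≺⇒∣∣<ᵣ {z} {δ} {ε} (mk≺ r r≥0 r<δ M h) (N , k) =
    mk<ᵣ (δ ℚ.- r) (p<q⇒0<q-p r<δ) (M ℕ.+ N) λ n ≤n → begin-strict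
      approxRoot (seq (normSq z) n) n ℚ.+ (δ ℚ.- r)
        ≤⟨ ℚₚ.+-monoˡ-≤ (δ ℚ.- r) (root≤ (approxRoot-lower (seq (normSq z) n) n)
             (h n (ℕₚ.m+n≤o⇒m≤o M ≤n))) ⟩
      r ℚ.+ (δ ℚ.- r)
        ≡⟨ plus-minus δ r ⟨
      δ
        <⟨ k n (ℕₚ.m+n≤o⇒n≤o M ≤n) ⟩
      seq ε n ∎
    where
    open ℚₚ.≤-Reasoning
    root≤ : ∀ {s t} → s ≡ 0ℚ ⊎ s ℚ.* s ℚ.≤ t → t ℚ.≤ r ℚ.* r → s ℚ.≤ r
    root≤ (inj₁ refl) _ = r≥0
    root≤ (inj₂ ss≤t) t≤rr = square-cancel-≤ r≥0 (ℚₚ.≤-trans ss≤t t≤rr)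

recip-inverse : ∀ z (z≉0 : z ≉0) → z * recip z z≉0 ≈ ℕ→ℂ 1
recip-inverse z z≉0 = mk≈
  (≈ᵣ-trans (≗⇒≈ᵣ λ n → re-part (seq (re z) n) (seq (im z) n) (seq i n))
    (inv-inverse (normSq z) z≉0))
  (≗⇒≈ᵣ λ n → im-part (seq (re z) n) (seq (im z) n) (seq i n))
  where
  i : ℝ
  i = inv (normSq z) z≉0
  re-part : ∀ a b i → a ℚ.* (a ℚ.* i) ℚ.+ ℚ.- (b ℚ.* ((ℚ.- b) ℚ.* i)) ≡ (a ℚ.* a ℚ.+ b ℚ.* b) ℚ.* i
  re-part = solve-∀ ℚ-ring
  im-part : ∀ a b i → a ℚ.* ((ℚ.- b) ℚ.* i) ℚ.+ b ℚ.* (a ℚ.* i) ≡ 0ℚ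
  im-part = solve-∀ ℚ-ring

-- Geometric decay against the growth of binomial coefficients.

opaque

  nC0≡1 : ∀ n → n C 0 ≡ 1
  nC0≡1 n = trans (nCk≡nC[n∸k] {0} {n} ℕ.z≤n) (nCn≡1 n)

  ^ℚ>0 : ∀ {q} → 0ℚ ℚ.< q → ∀ n → 0ℚ ℚ.< q ^ℚ n
  ^ℚ>0 q>0 zero    = ℚₚ.positive⁻¹ 1ℚ
  ^ℚ>0 q>0 (suc n) = *>0 q>0 (^ℚ>0 q>0 n)

  ^ℚ≥0 : ∀ {q} → 0ℚ ℚ.≤ q → ∀ n → 0ℚ ℚ.≤ q ^ℚ n
  ^ℚ≥0 q≥0 zero    = ℚₚ.nonNegative⁻¹ 1ℚ
  ^ℚ≥0 q≥0 (suc n) = *≥0 q≥0 (^ℚ≥0 q≥0 n)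

  ℕ/1≥0 : ∀ n → 0ℚ ℚ.≤ + n ℚ./ 1
  ℕ/1≥0 n = ℚₚ.nonNegative⁻¹ _ {{ℚₚ.normalize-nonNeg n 1}}

  suc/1 : ∀ n → + suc n ℚ./ 1 ≡ 1ℚ ℚ.+ + n ℚ./ 1
  suc/1 n = /1-homo-+ (+ 1) (+ n)

  suc/1-inverse : ∀ n → (+ suc n ℚ./ 1) ℚ.* (+ 1 ℚ./ suc n) ≡ 1ℚ
  suc/1-inverse n = ℚₚ.toℚᵘ-injective (begin
    ℚ.toℚᵘ ((+ suc n ℚ./ 1) ℚ.* (+ 1 ℚ./ suc n))
      ≈⟨ ℚₚ.toℚᵘ-homo-* (+ suc n ℚ./ 1) (+ 1 ℚ./ suc n) ⟩
    ℚ.toℚᵘ (+ suc n ℚ./ 1) ℚᵘ.* ℚ.toℚᵘ (+ 1 ℚ./ suc n)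
      ≈⟨ ℚᵘₚ.*-cong (ℚₚ.toℚᵘ-fromℚᵘ (mkℚᵘ (+ suc n) 0)) (ℚₚ.toℚᵘ-fromℚᵘ (mkℚᵘ (+ 1) n)) ⟩
    mkℚᵘ (+ suc n) 0 ℚᵘ.* mkℚᵘ (+ 1) n
      ≈⟨ ℚᵘₚ.*-inverseʳ (mkℚᵘ (+ suc n) 0) ⟩
    ℚ.toℚᵘ 1ℚ ∎)
    where open ℚᵘₚ.≃-Reasoning

  -- This is qⁿ ≤ 1 / (1 + n (1 - q)) without division. One step of the induction loses exactly qⁿ
  -- (1 - q)² (n + 1).
  bernoulli : ∀ {q} → 0ℚ ℚ.≤ q → ∀ n →
    q ^ℚ n ℚ.* (1ℚ ℚ.+ (+ n ℚ./ 1) ℚ.* (1ℚ ℚ.- q)) ℚ.≤ 1ℚ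
  bernoulli {q} q≥0 zero = ℚₚ.≤-reflexive (trans
    (ℚₚ.*-identityˡ (1ℚ ℚ.+ 0ℚ ℚ.* (1ℚ ℚ.- q)))
    (cong (1ℚ ℚ.+_) (ℚₚ.*-zeroˡ (1ℚ ℚ.- q))))
  bernoulli {q} q≥0 (suc n) = begin
    (q ℚ.* q ^ℚ n) ℚ.* (1ℚ ℚ.+ (+ suc n ℚ./ 1) ℚ.* (1ℚ ℚ.- q))
      ≡⟨ cong (λ m → (q ℚ.* q ^ℚ n) ℚ.* (1ℚ ℚ.+ m ℚ.* (1ℚ ℚ.- q))) (suc/1 n) ⟩
    (q ℚ.* q ^ℚ n) ℚ.* (1ℚ ℚ.+ (1ℚ ℚ.+ + n ℚ./ 1) ℚ.* (1ℚ ℚ.- q))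
      ≤⟨ p≤p+q (*≥0 (*≥0 (^ℚ≥0 q≥0 n) (square≥0 (1ℚ ℚ.- q)))
           (+≥0 (ℚₚ.nonNegative⁻¹ 1ℚ) (ℕ/1≥0 n))) ⟩
    (q ℚ.* q ^ℚ n) ℚ.* (1ℚ ℚ.+ (1ℚ ℚ.+ + n ℚ./ 1) ℚ.* (1ℚ ℚ.- q))
      ℚ.+ (q ^ℚ n ℚ.* ((1ℚ ℚ.- q) ℚ.* (1ℚ ℚ.- q))) ℚ.* (1ℚ ℚ.+ + n ℚ./ 1)
      ≡⟨ telescope q (q ^ℚ n) (+ n ℚ./ 1) ⟩
    q ^ℚ n ℚ.* (1ℚ ℚ.+ (+ n ℚ./ 1) ℚ.* (1ℚ ℚ.- q))
      ≤⟨ bernoulli q≥0 n ⟩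
    1ℚ ∎
    where
    open ℚₚ.≤-Reasoning
    telescope : ∀ q p m →
      (q ℚ.* p) ℚ.* (1ℚ ℚ.+ (1ℚ ℚ.+ m) ℚ.* (1ℚ ℚ.- q))
        ℚ.+ (p ℚ.* ((1ℚ ℚ.- q) ℚ.* (1ℚ ℚ.- q))) ℚ.* (1ℚ ℚ.+ m)
      ≡ p ℚ.* (1ℚ ℚ.+ m ℚ.* (1ℚ ℚ.- q))
    telescope = solve-∀ ℚ-ring

  ^ℚ→0 : ∀ {q} → 0ℚ ℚ.≤ q → q ℚ.< 1ℚ → ∀ δ → 0ℚ ℚ.< δ →
    ∃[ N ] ∀ n → N ℕ.≤ n → q ^ℚ n ℚ.< δ
  ^ℚ→0 {q} q≥0 q<1 δ δ>0 =
    let s = 1ℚ ℚ.- q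
        s>0 = p<q⇒0<q-p q<1
        N , h = archimedean (s ℚ.* δ) (*>0 s>0 δ>0)
    in N , λ n N≤n →
      let m = + n ℚ./ 1
          1+ms≥0 = +≥0 (ℚₚ.nonNegative⁻¹ 1ℚ) (*≥0 (ℕ/1≥0 n) (ℚₚ.<⇒≤ s>0))
          1+m>0 = +>0 (ℚₚ.positive⁻¹ 1ℚ) (ℕ/1≥0 n)
      in ℚₚ.*-cancelʳ-<-nonNeg (1ℚ ℚ.+ m ℚ.* s) {{ℚ.nonNegative 1+ms≥0}} (begin-strict
        q ^ℚ n ℚ.* (1ℚ ℚ.+ m ℚ.* s)
          ≤⟨ bernoulli q≥0 n ⟩
        1ℚ
          ≡⟨ suc/1-inverse n ⟨
        (+ suc n ℚ./ 1) ℚ.* (+ 1 ℚ./ suc n)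
          ≡⟨ cong (ℚ._* (+ 1 ℚ./ suc n)) (suc/1 n) ⟩
        (1ℚ ℚ.+ m) ℚ.* (+ 1 ℚ./ suc n)
          <⟨ ℚₚ.*-monoʳ-<-pos (1ℚ ℚ.+ m) {{ℚ.positive 1+m>0}} (h n N≤n) ⟩
        (1ℚ ℚ.+ m) ℚ.* (s ℚ.* δ)
          ≤⟨ p≤p+q (*≥0 (ℚₚ.<⇒≤ δ>0) q≥0) ⟩
        (1ℚ ℚ.+ m) ℚ.* (s ℚ.* δ) ℚ.+ δ ℚ.* q
          ≡⟨ rearrange m q δ ⟩
        δ ℚ.* (1ℚ ℚ.+ m ℚ.* s) ∎)
    where
    open ℚₚ.≤-Reasoning
    rearrange : ∀ m q δ → (1ℚ ℚ.+ m) ℚ.* ((1ℚ ℚ.- q) ℚ.* δ) ℚ.+ δ ℚ.* q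
      ≡ δ ℚ.* (1ℚ ℚ.+ m ℚ.* (1ℚ ℚ.- q))
    rearrange = solve-∀ ℚ-ring

  ∃-quotient : ∀ p {q} → 0ℚ ℚ.< p → 0ℚ ℚ.< q → ∃[ r ] 0ℚ ℚ.< r × q ℚ.* r ≡ p
  ∃-quotient p {q} p>0 q>0 = q⁻¹ ℚ.* p , *>0 (1/>0 q>0) p>0 ,
    trans (sym (ℚₚ.*-assoc q q⁻¹ p))
      (trans (cong (ℚ._* p) (ℚₚ.*-inverseʳ q {{ℚ.>-nonZero q>0}})) (ℚₚ.*-identityˡ p))
    where
    q⁻¹ : ℚ
    q⁻¹ = (ℚ.1/ q) {{ℚ.>-nonZero q>0}}

  -- The constant is t⁻ʲ, as C(n , j) tʲ is one term in the expansion of (1 + t)ⁿ. With K = t K′ the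
  -- step by Pascal's rule closes exactly: t K′ + K′ = K′ (1 + t).
  C-bound : ∀ {t} → 0ℚ ℚ.< t → ∀ j →
    ∃[ K ] 0ℚ ℚ.< K × ∀ n → + (n C j) ℚ./ 1 ℚ.≤ K ℚ.* (1ℚ ℚ.+ t) ^ℚ n
  C-bound {t} t>0 zero = 1ℚ , ℚₚ.positive⁻¹ 1ℚ , λ n → begin
    + (n C 0) ℚ./ 1           ≡⟨ cong (λ m → + m ℚ./ 1) (nC0≡1 n) ⟩
    1ℚ                        ≤⟨ 1≤[1+t]^ n ⟩
    (1ℚ ℚ.+ t) ^ℚ n           ≡⟨ ℚₚ.*-identityˡ ((1ℚ ℚ.+ t) ^ℚ n) ⟨
    1ℚ ℚ.* (1ℚ ℚ.+ t) ^ℚ n    ∎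
    where
    open ℚₚ.≤-Reasoning
    1≤[1+t]^ : ∀ n → 1ℚ ℚ.≤ (1ℚ ℚ.+ t) ^ℚ n
    1≤[1+t]^ zero    = ℚₚ.≤-refl
    1≤[1+t]^ (suc n) = *-mono-≤ {1ℚ} {1ℚ ℚ.+ t} {1ℚ} (ℚₚ.nonNegative⁻¹ 1ℚ)
      (^ℚ≥0 (+≥0 (ℚₚ.nonNegative⁻¹ 1ℚ) (ℚₚ.<⇒≤ t>0)) n) (p≤p+q (ℚₚ.<⇒≤ t>0)) (1≤[1+t]^ n)
  C-bound {t} t>0 (suc j) with C-bound t>0 j
  ... | K , K>0 , h with ∃-quotient K K>0 t>0
  ...   | K′ , K′>0 , tK′≡K = K′ , K′>0 , go
    where
    open ℚₚ.≤-Reasoning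
    factor : ∀ t K p → (t ℚ.* K) ℚ.* p ℚ.+ K ℚ.* p ≡ K ℚ.* ((1ℚ ℚ.+ t) ℚ.* p)
    factor = solve-∀ ℚ-ring
    go : ∀ n → + (n C suc j) ℚ./ 1 ℚ.≤ K′ ℚ.* (1ℚ ℚ.+ t) ^ℚ n
    go zero    = begin
      + (0 C suc j) ℚ./ 1   ≡⟨ cong (λ m → + m ℚ./ 1) (k>n⇒nCk≡0 {0} {suc j} (ℕ.s≤s ℕ.z≤n)) ⟩
      0ℚ                    ≤⟨ ℚₚ.<⇒≤ K′>0 ⟩
      K′                    ≡⟨ ℚₚ.*-identityʳ K′ ⟨
      K′ ℚ.* 1ℚ             ∎
    go (suc n) = begin
      + (suc n C suc j) ℚ./ 1
        ≡⟨ cong (λ m → + m ℚ./ 1) (nCk+nC[k+1]≡[n+1]C[k+1] n j) ⟨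
      + (n C j ℕ.+ n C suc j) ℚ./ 1
        ≡⟨ /1-homo-+ (+ (n C j)) (+ (n C suc j)) ⟩
      + (n C j) ℚ./ 1 ℚ.+ + (n C suc j) ℚ./ 1
        ≤⟨ ℚₚ.+-mono-≤ (h n) (go n) ⟩
      K ℚ.* p ℚ.+ K′ ℚ.* p
        ≡⟨ cong (λ k → k ℚ.* p ℚ.+ K′ ℚ.* p) tK′≡K ⟨
      (t ℚ.* K′) ℚ.* p ℚ.+ K′ ℚ.* p
        ≡⟨ factor t K′ p ⟩
      K′ ℚ.* ((1ℚ ℚ.+ t) ℚ.* p) ∎
      where
      p : ℚ
      p = (1ℚ ℚ.+ t) ^ℚ n

-- Null sequences, finite sums and convergent series.

Null : (ℕ → ℂ) → Set
Null u = ∀ δ → 0ℚ ℚ.< δ → ∃[ N ] ∀ n → N ℕ.≤ n → u n ≺ δ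

Null-cong : ∀ {u v} → (∀ n → u n ≈ v n) → Null u → Null v
Null-cong u≈v h δ δ>0 = let N , k = h δ δ>0 in N , λ n N≤n → ≺-resp-≈ (u≈v n) (k n N≤n)

Null-+ : ∀ {u v} → Null u → Null v → Null (λ n → u n + v n)
Null-+ h k δ δ>0 =
  let M , h′ = h (½ ℚ.* δ) (half>0 δ>0)
      N , k′ = k (½ ℚ.* δ) (half>0 δ>0)
  in M ℕ.+ N , λ n ≤n → ≺-≤-trans
    (≺-+ (h′ n (ℕₚ.m+n≤o⇒m≤o M ≤n)) (k′ n (ℕₚ.m+n≤o⇒n≤o M ≤n)))
    (ℚₚ.≤-reflexive (half+half δ))

Null-scale : ∀ z {u} → Null u → Null (λ n → z * u n)
Null-scale z h δ δ>0 =
  let q , z≺q = bounded-ℂ z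
      η , η>0 , qη≡δ = ∃-quotient δ δ>0 (≺⇒>0 z≺q)
      N , k = h η η>0
  in N , λ n N≤n → ≺-≤-trans (≺-* z≺q (k n N≤n)) (ℚₚ.≤-reflexive qη≡δ)

Null-neg : ∀ {u} → Null u → Null (λ n → - u n)
Null-neg h δ δ>0 = let N , k = h δ δ>0 in N , λ n N≤n → ≺-neg (k n N≤n)

Null-C* : ∀ j {u : ℕ → ℂ} {A r} → 0ℚ ℚ.< A → 0ℚ ℚ.≤ r → r ℚ.< 1ℚ →
          (∀ n → u n ≺ A ℚ.* r ^ℚ n) → Null (λ n → ℕ→ℂ (n C j) * u n)
Null-C* j {u} {A} {r} A>0 r≥0 r<1 h δ δ>0 =
  -- With t = 1 - r the ratio (1 + t) r equals 1 - (1 - r)², which is below 1.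
  let t = 1ℚ ℚ.- r
      t>0 = p<q⇒0<q-p r<1
      1+t>0 = +>0 (ℚₚ.positive⁻¹ 1ℚ) (ℚₚ.<⇒≤ t>0)
      K , K>0 , C≤ = C-bound t>0 j
      -- K + 1 in place of K, because `ℕ→ℂ-≺` asks for a strict bound.
      B = (K ℚ.+ 1ℚ) ℚ.* A
      B>0 = *>0 (+>0 K>0 (ℚₚ.nonNegative⁻¹ 1ℚ)) A>0
      η , η>0 , Bη≡δ = ∃-quotient δ δ>0 B>0
      q = (1ℚ ℚ.+ t) ℚ.* r
      q<1 = subst (q ℚ.<_) (complete r) (p<p+q {q} (*>0 t>0 t>0))
      N , k = ^ℚ→0 (*≥0 (ℚₚ.<⇒≤ 1+t>0) r≥0) q<1 η η>0
  in N , λ n N≤n → ≺-≤-trans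
    (≺-* (ℕ→ℂ-≺ (n C j) (ℚₚ.≤-<-trans (C≤ n)
           (ℚₚ.*-monoˡ-<-pos ((1ℚ ℚ.+ t) ^ℚ n) {{ℚ.positive (^ℚ>0 1+t>0 n)}}
             (p<p+q {K} (ℚₚ.positive⁻¹ 1ℚ)))))
         (h n))
    (begin
      ((K ℚ.+ 1ℚ) ℚ.* (1ℚ ℚ.+ t) ^ℚ n) ℚ.* (A ℚ.* r ^ℚ n)
        ≡⟨ interchange (K ℚ.+ 1ℚ) ((1ℚ ℚ.+ t) ^ℚ n) A (r ^ℚ n) ⟩
      B ℚ.* ((1ℚ ℚ.+ t) ^ℚ n ℚ.* r ^ℚ n)
        ≡⟨ cong (B ℚ.*_) (^ℚ-distrib-* (1ℚ ℚ.+ t) r n) ⟨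
      B ℚ.* q ^ℚ n
        ≤⟨ ℚₚ.*-monoˡ-≤-nonNeg B {{ℚ.nonNegative (ℚₚ.<⇒≤ B>0)}} (ℚₚ.<⇒≤ (k n N≤n)) ⟩
      B ℚ.* η
        ≡⟨ Bη≡δ ⟩
      δ ∎)
  where
  open ℚₚ.≤-Reasoning
  complete : ∀ r → (1ℚ ℚ.+ (1ℚ ℚ.- r)) ℚ.* r ℚ.+ (1ℚ ℚ.- r) ℚ.* (1ℚ ℚ.- r) ≡ 1ℚ
  complete = solve-∀ ℚ-ring
  interchange : ∀ a b c d → (a ℚ.* b) ℚ.* (c ℚ.* d) ≡ (a ℚ.* c) ℚ.* (b ℚ.* d)
  interchange = solve-∀ ℚ-ring

∑-cong : ∀ n {f g} → (∀ k → f k ≈ g k) → ∑[k< n ] f ≈ ∑[k< n ] g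
∑-cong zero    h = ≈-refl
∑-cong (suc n) h = +-cong (h 0) (∑-cong n (λ k → h (suc k)))

∑-last : ∀ n f → ∑[k< suc n ] f ≈ ∑[k< n ] f + f n
∑-last zero    f = +-comm (f 0) (ℕ→ℂ 0)
∑-last (suc n) f = ≈-trans (+-cong ≈-refl (∑-last n (λ k → f (suc k))))
  (solve 3 (λ a b c → a :+ (b :+ c) := (a :+ b) :+ c) ≈-refl
    (f 0) (∑[k< n ] (λ k → f (suc k))) (f (suc n)))

∑-+ : ∀ n f g → ∑[k< n ] (λ k → f k + g k) ≈ ∑[k< n ] f + ∑[k< n ] g
∑-+ zero    f g = ≈-sym (+-identityˡ (ℕ→ℂ 0))
∑-+ (suc n) f g = ≈-trans (+-cong ≈-refl (∑-+ n (λ k → f (suc k)) (λ k → g (suc k))))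
  (solve 4 (λ a b c d → (a :+ b) :+ (c :+ d) := (a :+ c) :+ (b :+ d)) ≈-refl
    (f 0) (g 0) (∑[k< n ] (λ k → f (suc k))) (∑[k< n ] (λ k → g (suc k))))

∑-scale : ∀ n z f → ∑[k< n ] (λ k → z * f k) ≈ z * ∑[k< n ] f
∑-scale zero    z f = solve 1 (λ z → con (+ 0) := z :* con (+ 0)) ≈-refl z
∑-scale (suc n) z f = ≈-trans (+-cong ≈-refl (∑-scale n z (λ k → f (suc k))))
  (≈-sym (*-distribˡ-+ z (f 0) (∑[k< n ] (λ k → f (suc k)))))

-- HasSum with rational instead of real error bounds.
Sums : (ℕ → ℂ) → ℂ → Set
Sums f s = Null (λ n → ∑[k< n ] f - s)

-- A positive real eventually lies above its rational margin, so rational error bounds suffice.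
Sums⇒HasSum : ∀ {f s} → Sums f s → HasSum f s
Sums⇒HasSum h ε (mk<ᵣ δ δ>0 M gap) =
  let N , k = h δ δ>0
  in N , λ n N≤n → ≺⇒∣∣<ᵣ (k n N≤n) (M , λ m M≤m →
       subst (ℚ._< seq ε m) (ℚₚ.+-identityˡ δ) (gap m M≤m))

Sums-cong : ∀ {f g s t} → (∀ k → f k ≈ g k) → s ≈ t → Sums f s → Sums g t
Sums-cong f≈g s≈t = Null-cong λ n →
  +-cong (∑-cong n f≈g) (-‿cong s≈t)

Sums-+ : ∀ {f g s t} → Sums f s → Sums g t → Sums (λ k → f k + g k) (s + t)
Sums-+ {f} {g} {s} {t} h k = Null-cong
  (λ n → ≈-trans
    (solve 4 (λ a b s t → (a :- s) :+ (b :- t) := (a :+ b) :- (s :+ t)) ≈-refl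
      (∑[k< n ] f) (∑[k< n ] g) s t)
    (+-cong (≈-sym (∑-+ n f g)) ≈-refl))
  (Null-+ h k)

Sums-scale : ∀ z {f s} → Sums f s → Sums (λ k → z * f k) (z * s)
Sums-scale z {f} {s} h = Null-cong
  (λ n → ≈-trans
    (solve 3 (λ z a s → z :* (a :- s) := z :* a :- z :* s) ≈-refl z (∑[k< n ] f) s)
    (+-cong (≈-sym (∑-scale n z f)) ≈-refl))
  (Null-scale z h)

-- Signs, Lucas numbers and the recurrence along the indices a + b i.

≡⇒≈ : ∀ {z w} → z ≡ w → z ≈ w
≡⇒≈ refl = ≈-refl

opaque

  [-1]^-square : ∀ b → ([-1]^ b) ℤ.* ([-1]^ b) ≡ + 1
  [-1]^-square b = go ℤ.∣ b ∣
    where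
    go : ∀ n → ℤ.-1ℤ ℤ.^ n ℤ.* ℤ.-1ℤ ℤ.^ n ≡ + 1
    go zero    = refl
    go (suc n) = trans (cancel (ℤ.-1ℤ ℤ.^ n)) (go n)
      where
      cancel : ∀ s → (ℤ.-1ℤ ℤ.* s) ℤ.* (ℤ.-1ℤ ℤ.* s) ≡ s ℤ.* s
      cancel = ℤ-Solver.solve-∀

  [-1]^-suc : ∀ b → [-1]^ (b ℤ.+ + 1) ≡ ℤ.- ([-1]^ b)
  [-1]^-suc (+ n)          = trans (cong (ℤ.-1ℤ ℤ.^_) (ℕₚ.+-comm n 1)) (ℤₚ.-1*i≡-i (ℤ.-1ℤ ℤ.^ n))
  [-1]^-suc -[1+ zero ]    = refl
  [-1]^-suc -[1+ suc n ]   = negate (ℤ.-1ℤ ℤ.^ n)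
    where
    negate : ∀ s → ℤ.-1ℤ ℤ.* s ≡ ℤ.- (ℤ.-1ℤ ℤ.* (ℤ.-1ℤ ℤ.* s))
    negate = ℤ-Solver.solve-∀

  [-1]^-* : ∀ b k → [-1]^ ((b ℤ.+ + 1) ℤ.* + k) ≡ (ℤ.- ([-1]^ b)) ℤ.^ k
  [-1]^-* b k = begin
    ℤ.-1ℤ ℤ.^ ℤ.∣ (b ℤ.+ + 1) ℤ.* + k ∣   ≡⟨ cong (ℤ.-1ℤ ℤ.^_) (ℤₚ.abs-* (b ℤ.+ + 1) (+ k)) ⟩
    ℤ.-1ℤ ℤ.^ (ℤ.∣ b ℤ.+ + 1 ∣ ℕ.* k)     ≡⟨ ℤₚ.^-*-assoc ℤ.-1ℤ ℤ.∣ b ℤ.+ + 1 ∣ k ⟨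
    ([-1]^ (b ℤ.+ + 1)) ℤ.^ k              ≡⟨ cong (ℤ._^ k) ([-1]^-suc b) ⟩
    (ℤ.- ([-1]^ b)) ℤ.^ k                  ∎
    where open ≡-Reasoning

  lucas-recurrence : ∀ m → lucas (m ℤ.+ + 2) ≡ lucas (m ℤ.+ + 1) ℤ.+ lucas m
  lucas-recurrence (+ n) rewrite ℕₚ.+-comm n 2 | ℕₚ.+-comm n 1 = refl
  lucas-recurrence -[1+ 0 ]             = refl
  lucas-recurrence -[1+ 1 ]             = refl
  lucas-recurrence -[1+ suc (suc n) ]   = cancel (lucas -[1+ n ]) (lucas -[1+ suc n ])
    where
    cancel : ∀ i j → i ≡ j ℤ.+ (i ℤ.- j)
    cancel = ℤ-Solver.solve-∀

  -- Serves the passage from positive to negative `b` in `lucas-shift`.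
  lucas-neg : ∀ n → lucas (ℤ.- (+ n)) ≡ ([-1]^ (+ n)) ℤ.* lucas (+ n)
  lucas-neg zero          = refl
  lucas-neg (suc zero)    = refl
  lucas-neg (suc (suc n)) = begin
    lucas (ℤ.- (+ suc (suc n)))
      ≡⟨ backward n ⟩
    lucas (ℤ.- (+ n)) ℤ.- lucas (ℤ.- (+ suc n))
      ≡⟨ cong₂ ℤ._-_ (lucas-neg n) (lucas-neg (suc n)) ⟩
    s ℤ.* lucas (+ n) ℤ.- (ℤ.-1ℤ ℤ.* s) ℤ.* lucas (+ suc n)
      ≡⟨ collect s (lucas (+ n)) (lucas (+ suc n)) ⟩
    (ℤ.-1ℤ ℤ.* (ℤ.-1ℤ ℤ.* s)) ℤ.* (lucas (+ suc n) ℤ.+ lucas (+ n)) ∎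
    where
    open ≡-Reasoning
    s : ℤ
    s = [-1]^ (+ n)
    backward : ∀ n → lucas (ℤ.- (+ suc (suc n))) ≡ lucas (ℤ.- (+ n)) ℤ.- lucas (ℤ.- (+ suc n))
    backward zero    = refl
    backward (suc n) = refl
    collect : ∀ s i j → s ℤ.* i ℤ.- (ℤ.-1ℤ ℤ.* s) ℤ.* j ≡ (ℤ.-1ℤ ℤ.* (ℤ.-1ℤ ℤ.* s)) ℤ.* (j ℤ.+ i)
    collect = ℤ-Solver.solve-∀

lucas-isGeneralizedFibonacci : IsGeneralizedFibonacci (λ m → ℤ→ℂ (lucas m))
lucas-isGeneralizedFibonacci m =
  ≈-trans (≡⇒≈ (cong ℤ→ℂ (lucas-recurrence m))) (ℤ→ℂ-homo-+ (lucas (m ℤ.+ + 1)) (lucas m))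

module _ {G : ℤ → ℂ} (fib : IsGeneralizedFibonacci G) where

  -- The index equations are separate arguments because integer sums such as m - n + 2 do not
  -- compute for variable m.
  fib-at : ∀ {i j k} → i ≡ k ℤ.+ + 2 → j ≡ k ℤ.+ + 1 → G i ≈ G j + G k
  fib-at refl refl = fib _

  opaque

    -- As functions of n, both summands on the left satisfy the Fibonacci recurrence: the
    -- alternating sign turns the backward recurrence of G (m - n) into a forward one. So does L_n,
    -- and the two sides agree at n = 0 and n = 1.
    lucas-shift-ℕ : ∀ n m →
      G (m ℤ.+ + n) + ℤ→ℂ ([-1]^ (+ n)) * G (m ℤ.- + n) ≈ ℤ→ℂ (lucas (+ n)) * G m
    lucas-shift-ℕ zero m = begin
      G (m ℤ.+ + 0) + ℤ→ℂ (+ 1) * G (m ℤ.- + 0)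
        ≡⟨ cong₂ (λ i j → G i + ℤ→ℂ (+ 1) * G j) (ℤₚ.+-identityʳ m) (ℤₚ.+-identityʳ m) ⟩
      G m + ℤ→ℂ (+ 1) * G m
        ≈⟨ solve 1 (λ g → g :+ con (+ 1) :* g := con (+ 2) :* g) ≈-refl (G m) ⟩
      ℤ→ℂ (+ 2) * G m ∎
      where open ≈-Reasoning
    lucas-shift-ℕ (suc zero) m = begin
      G (m ℤ.+ + 1) + ℤ→ℂ (ℤ.-1ℤ) * G (m ℤ.- + 1)
        ≈⟨ +-cong (fib-at (forward m) (here m)) ≈-refl ⟩
      (G m + G (m ℤ.- + 1)) + ℤ→ℂ (ℤ.-1ℤ) * G (m ℤ.- + 1)
        ≈⟨ solve 2 (λ g h → (g :+ h) :+ con ℤ.-1ℤ :* h := con (+ 1) :* g) ≈-refl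
             (G m) (G (m ℤ.- + 1)) ⟩
      ℤ→ℂ (+ 1) * G m ∎
      where
      open ≈-Reasoning
      forward : ∀ m → m ℤ.+ + 1 ≡ (m ℤ.- + 1) ℤ.+ + 2
      forward = ℤ-Solver.solve-∀
      here : ∀ m → m ≡ (m ℤ.- + 1) ℤ.+ + 1
      here = ℤ-Solver.solve-∀
    lucas-shift-ℕ (suc (suc n)) m = begin
      C + ℤ→ℂ (ℤ.-1ℤ ℤ.* (ℤ.-1ℤ ℤ.* s)) * c
        ≈⟨ +-cong C≈B+A (*-cong
             (≈-trans (ℤ→ℂ-homo-* ℤ.-1ℤ (ℤ.-1ℤ ℤ.* s)) (*-cong ≈-refl (ℤ→ℂ-homo-* ℤ.-1ℤ s))) ≈-refl) ⟩
      (B + A) + ℤ→ℂ ℤ.-1ℤ * (ℤ→ℂ ℤ.-1ℤ * S) * c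
        ≈⟨ solve 5 (λ A B S b c → (B :+ A) :+ con ℤ.-1ℤ :* (con ℤ.-1ℤ :* S) :* c
             := (B :+ con ℤ.-1ℤ :* S :* b) :+ (A :+ S :* (b :+ c))) ≈-refl A B S b c ⟩
      (B + ℤ→ℂ ℤ.-1ℤ * S * b) + (A + S * (b + c))
        ≈⟨ +-cong (+-cong ≈-refl (*-cong (≈-sym (ℤ→ℂ-homo-* ℤ.-1ℤ s)) ≈-refl))
             (+-cong ≈-refl (*-cong ≈-refl (≈-sym a≈b+c))) ⟩
      (B + ℤ→ℂ ([-1]^ (+ suc n)) * b) + (A + S * a)
        ≈⟨ +-cong (lucas-shift-ℕ (suc n) m) (lucas-shift-ℕ n m) ⟩
      ℤ→ℂ (lucas (+ suc n)) * G m + ℤ→ℂ (lucas (+ n)) * G m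
        ≈⟨ solve 3 (λ p q g → p :* g :+ q :* g := (p :+ q) :* g) ≈-refl
             (ℤ→ℂ (lucas (+ suc n))) (ℤ→ℂ (lucas (+ n))) (G m) ⟩
      (ℤ→ℂ (lucas (+ suc n)) + ℤ→ℂ (lucas (+ n))) * G m
        ≈⟨ *-cong (ℤ→ℂ-homo-+ (lucas (+ suc n)) (lucas (+ n))) ≈-refl ⟨
      ℤ→ℂ (lucas (+ suc (suc n))) * G m ∎
      where
      open ≈-Reasoning
      s : ℤ
      s = [-1]^ (+ n)
      A B C S a b c : ℂ
      A = G (m ℤ.+ + n)
      B = G (m ℤ.+ + suc n)
      C = G (m ℤ.+ + suc (suc n))
      S = ℤ→ℂ s
      a = G (m ℤ.- + n)
      b = G (m ℤ.- + suc n)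
      c = G (m ℤ.- + suc (suc n))
      up₂ : ∀ m k → m ℤ.+ (+ 2 ℤ.+ k) ≡ (m ℤ.+ k) ℤ.+ + 2
      up₂ = ℤ-Solver.solve-∀
      up₁ : ∀ m k → m ℤ.+ (+ 1 ℤ.+ k) ≡ (m ℤ.+ k) ℤ.+ + 1
      up₁ = ℤ-Solver.solve-∀
      C≈B+A : C ≈ B + A
      C≈B+A = fib-at (up₂ m (+ n)) (up₁ m (+ n))
      down₂ : ∀ m k → m ℤ.- k ≡ (m ℤ.- (+ 2 ℤ.+ k)) ℤ.+ + 2
      down₂ = ℤ-Solver.solve-∀
      down₁ : ∀ m k → m ℤ.- (+ 1 ℤ.+ k) ≡ (m ℤ.- (+ 2 ℤ.+ k)) ℤ.+ + 1
      down₁ = ℤ-Solver.solve-∀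
      a≈b+c : a ≈ b + c
      a≈b+c = fib-at (down₂ m (+ n)) (down₁ m (+ n))

    lucas-shift : ∀ b m →
      G (m ℤ.+ b) + ℤ→ℂ ([-1]^ b) * G (m ℤ.- b) ≈ ℤ→ℂ (lucas b) * G m
    lucas-shift (+ n)      m = lucas-shift-ℕ n m
    lucas-shift -[1+ n ] m = begin
      -- Since S² = 1, factoring out S exchanges the roles of the neighbours m + b and m - b.
      g + S * h
        ≈⟨ +-cong (≈-trans (≈-sym (*-identityˡ g))
             (*-cong (≈-trans (≡⇒≈ (cong ℤ→ℂ (sym ([-1]^-square (+ suc n))))) (ℤ→ℂ-homo-* s s)) ≈-refl)) ≈-refl ⟩
      S * S * g + S * h
        ≈⟨ solve 3 (λ g h S → S :* S :* g :+ S :* h := S :* (h :+ S :* g)) ≈-refl g h S ⟩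
      S * (h + S * g)
        ≈⟨ *-cong ≈-refl (lucas-shift-ℕ (suc n) m) ⟩
      S * (ℤ→ℂ (lucas (+ suc n)) * G m)
        ≈⟨ solve 3 (λ S l g → S :* (l :* g) := S :* l :* g) ≈-refl S (ℤ→ℂ (lucas (+ suc n))) (G m) ⟩
      S * ℤ→ℂ (lucas (+ suc n)) * G m
        ≈⟨ *-cong (ℤ→ℂ-homo-* s (lucas (+ suc n))) ≈-refl ⟨
      ℤ→ℂ (s ℤ.* lucas (+ suc n)) * G m
        ≡⟨ cong (λ l → ℤ→ℂ l * G m) (lucas-neg (suc n)) ⟨
      ℤ→ℂ (lucas -[1+ n ]) * G m ∎
      where
      open ≈-Reasoning
      s : ℤ
      s = [-1]^ (+ suc n)
      S g h : ℂ
      S = ℤ→ℂ s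
      g = G (m ℤ.+ -[1+ n ])
      h = G (m ℤ.+ + suc n)

    -- This is `lucas-shift` centred at the middle index a + b (i + 1).
    subsequence-recurrence : ∀ a b i →
      G (a ℤ.+ b ℤ.* ℤ.suc (ℤ.suc i))
      ≈ ℤ→ℂ (lucas b) * G (a ℤ.+ b ℤ.* ℤ.suc i) - ℤ→ℂ ([-1]^ b) * G (a ℤ.+ b ℤ.* i)
    subsequence-recurrence a b i = begin
      G (a ℤ.+ b ℤ.* ℤ.suc (ℤ.suc i))
        ≡⟨ cong G (next a b i) ⟩
      G (m ℤ.+ b)
        ≈⟨ solve 2 (λ g h → g := (g :+ h) :- h) ≈-refl (G (m ℤ.+ b)) (S * G (m ℤ.- b)) ⟩
      (G (m ℤ.+ b) + S * G (m ℤ.- b)) - S * G (m ℤ.- b)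
        ≈⟨ +-cong (lucas-shift b m) ≈-refl ⟩
      ℤ→ℂ (lucas b) * G m - S * G (m ℤ.- b)
        ≡⟨ cong (λ j → ℤ→ℂ (lucas b) * G m - S * G j) (previous a b i) ⟨
      ℤ→ℂ (lucas b) * G m - S * G (a ℤ.+ b ℤ.* i) ∎
      where
      open ≈-Reasoning
      m : ℤ
      m = a ℤ.+ b ℤ.* ℤ.suc i
      S : ℂ
      S = ℤ→ℂ ([-1]^ b)
      next : ∀ a b i → a ℤ.+ b ℤ.* (+ 1 ℤ.+ (+ 1 ℤ.+ i)) ≡ a ℤ.+ b ℤ.* (+ 1 ℤ.+ i) ℤ.+ b
      next = ℤ-Solver.solve-∀
      previous : ∀ a b i → a ℤ.+ b ℤ.* i ≡ a ℤ.+ b ℤ.* (+ 1 ℤ.+ i) ℤ.- b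
      previous = ℤ-Solver.solve-∀

-- Exponential growth of generalized Fibonacci sequences.

opaque

  -- The abstract `step` covers both directions of the recurrence: forwards the next term is a sum,
  -- backwards a difference, and bounds on moduli add in either case.
  fibonacci-growth : ∀ {u : ℕ → ℂ} {A ψ} → 0ℚ ℚ.≤ A → 0ℚ ℚ.≤ ψ → 1ℚ ℚ.+ ψ ℚ.≤ ψ ℚ.* ψ →
    (∀ n {p q} → u n ≺ p → u (suc n) ≺ q → u (suc (suc n)) ≺ p ℚ.+ q) →
    u 0 ≺ A → u 1 ≺ A ℚ.* ψ → ∀ n → u n ≺ A ℚ.* ψ ^ℚ n
  fibonacci-growth {u} {A} {ψ} A≥0 ψ≥0 1+ψ≤ψψ step u₀ u₁ = go
    where
    factor : ∀ A p ψ → A ℚ.* p ℚ.+ A ℚ.* (ψ ℚ.* p) ≡ (A ℚ.* p) ℚ.* (1ℚ ℚ.+ ψ)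
    factor = solve-∀ ℚ-ring
    regroup : ∀ A p ψ → (A ℚ.* p) ℚ.* (ψ ℚ.* ψ) ≡ A ℚ.* (ψ ℚ.* (ψ ℚ.* p))
    regroup = solve-∀ ℚ-ring
    go : ∀ n → u n ≺ A ℚ.* ψ ^ℚ n
    go zero          = ≺-≤-trans u₀ (ℚₚ.≤-reflexive (sym (ℚₚ.*-identityʳ A)))
    go (suc zero)    = ≺-≤-trans u₁ (ℚₚ.≤-reflexive (cong (A ℚ.*_) (sym (ℚₚ.*-identityʳ ψ))))
    go (suc (suc n)) = ≺-≤-trans (step n (go n) (go (suc n))) (begin
      A ℚ.* ψ ^ℚ n ℚ.+ A ℚ.* (ψ ℚ.* ψ ^ℚ n)
        ≡⟨ factor A (ψ ^ℚ n) ψ ⟩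
      (A ℚ.* ψ ^ℚ n) ℚ.* (1ℚ ℚ.+ ψ)
        ≤⟨ ℚₚ.*-monoˡ-≤-nonNeg (A ℚ.* ψ ^ℚ n) {{ℚ.nonNegative (*≥0 A≥0 (^ℚ≥0 ψ≥0 n))}} 1+ψ≤ψψ ⟩
      (A ℚ.* ψ ^ℚ n) ℚ.* (ψ ℚ.* ψ)
        ≡⟨ regroup A (ψ ^ℚ n) ψ ⟩
      A ℚ.* (ψ ℚ.* (ψ ℚ.* ψ ^ℚ n)) ∎)
      where open ℚₚ.≤-Reasoning

  p≤p*q : ∀ {p q} → 0ℚ ℚ.≤ p → 1ℚ ℚ.≤ q → p ℚ.≤ p ℚ.* q
  p≤p*q {p} {q} p≥0 1≤q = subst (ℚ._≤ p ℚ.* q) (ℚₚ.*-identityʳ p)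
    (ℚₚ.*-monoˡ-≤-nonNeg p {{ℚ.nonNegative p≥0}} 1≤q)

  1≤^ℚ : ∀ {q} → 1ℚ ℚ.≤ q → ∀ n → 1ℚ ℚ.≤ q ^ℚ n
  1≤^ℚ 1≤q zero    = ℚₚ.≤-refl
  1≤^ℚ {q} 1≤q (suc n) = ℚₚ.≤-trans 1≤q
    (p≤p*q (ℚₚ.≤-trans (ℚₚ.nonNegative⁻¹ 1ℚ) 1≤q) (1≤^ℚ 1≤q n))

  ^ℚ-monoʳ-≤ : ∀ {q} → 1ℚ ℚ.≤ q → ∀ {m n} → m ℕ.≤ n → q ^ℚ m ℚ.≤ q ^ℚ n
  ^ℚ-monoʳ-≤ {q} 1≤q {m} {n} m≤n = subst (λ k → q ^ℚ m ℚ.≤ q ^ℚ k) (ℕₚ.m+[n∸m]≡n m≤n)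
    (subst (q ^ℚ m ℚ.≤_) (sym (^ℚ-homo-* q m (n ℕ.∸ m)))
      (p≤p*q (^ℚ≥0 (ℚₚ.≤-trans (ℚₚ.nonNegative⁻¹ 1ℚ) 1≤q) m) (1≤^ℚ 1≤q (n ℕ.∸ m))))

module _ {G : ℤ → ℂ} (fib : IsGeneralizedFibonacci G)
         {ψ : ℚ} (1≤ψ : 1ℚ ℚ.≤ ψ) (1+ψ≤ψψ : 1ℚ ℚ.+ ψ ℚ.≤ ψ ℚ.* ψ) where

  opaque

    generalizedFibonacci-growth : ∃[ A ] 0ℚ ℚ.< A × ∀ m → G m ≺ A ℚ.* ψ ^ℚ ℤ.∣ m ∣
    generalizedFibonacci-growth =
      let p , G₀≺p  = bounded-ℂ (G (+ 0))
          q , G₁≺q  = bounded-ℂ (G (+ 1))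
          r , G₋₁≺r = bounded-ℂ (G -[1+ 0 ])
          p≥0 = ℚₚ.<⇒≤ (≺⇒>0 G₀≺p)
          q≥0 = ℚₚ.<⇒≤ (≺⇒>0 G₁≺q)
          r≥0 = ℚₚ.<⇒≤ (≺⇒>0 G₋₁≺r)
          -- One constant above all three seed bounds serves both directions; `1≤ψ` lifts it to A ψ
          -- at the indices 1 and -1.
          A = p ℚ.+ (q ℚ.+ r)
          A>0 = +>0 (≺⇒>0 G₀≺p) (+≥0 q≥0 r≥0)
          A≥0 = ℚₚ.<⇒≤ A>0
          A≤Aψ = p≤p*q {A} {ψ} A≥0 1≤ψ
          G₀ = ≺-≤-trans G₀≺p (p≤p+q {p} (+≥0 q≥0 r≥0))
          G₁ = ≺-≤-trans G₁≺q (ℚₚ.≤-trans (ℚₚ.≤-trans (p≤p+q {q} r≥0) (p≤q+p p≥0)) A≤Aψ)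
          G₋₁ = ≺-≤-trans G₋₁≺r (ℚₚ.≤-trans (ℚₚ.≤-trans (p≤q+p {r} q≥0) (p≤q+p p≥0)) A≤Aψ)
          positive = fibonacci-growth {λ n → G (+ n)} A≥0 ψ≥0 1+ψ≤ψψ step⁺ G₀ G₁
          negative = fibonacci-growth {λ n → G (ℤ.- (+ n))} A≥0 ψ≥0 1+ψ≤ψψ step⁻ G₀ G₋₁
      in A , A>0 , λ { (+ n) → positive n ; -[1+ n ] → negative (suc n) }
      where
      ψ≥0 : 0ℚ ℚ.≤ ψ
      ψ≥0 = ℚₚ.≤-trans (ℚₚ.nonNegative⁻¹ 1ℚ) 1≤ψ
      p≤q+p : ∀ {p q} → 0ℚ ℚ.≤ q → p ℚ.≤ q ℚ.+ p
      p≤q+p {p} {q} q≥0 = subst (p ℚ.≤_) (ℚₚ.+-comm p q) (p≤p+q q≥0)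
      step⁺ : ∀ n {p q} → G (+ n) ≺ p → G (+ suc n) ≺ q → G (+ suc (suc n)) ≺ p ℚ.+ q
      step⁺ n {p} {q} h k = ≺-resp-≈
        (≈-trans (+-comm (G (+ n)) (G (+ suc n)))
          (≈-sym (fib-at fib (cong +_ (ℕₚ.+-comm 2 n)) (cong +_ (ℕₚ.+-comm 1 n)))))
        (≺-+ h k)
      step⁻ : ∀ n {p q} → G (ℤ.- (+ n)) ≺ p → G (ℤ.- (+ suc n)) ≺ q →
              G (ℤ.- (+ suc (suc n))) ≺ p ℚ.+ q
      step⁻ n h k = ≺-resp-≈
        (≈-trans
          (+-cong (fib-at fib (down₂ (+ n)) (down₁ (+ n))) ≈-refl)
          (solve 2 (λ g h → (g :+ h) :- g := h) ≈-refl
            (G (ℤ.- (+ suc n))) (G (ℤ.- (+ suc (suc n))))))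
        (≺-minus h k)
        where
        down₂ : ∀ k → ℤ.- k ≡ (ℤ.- (+ 2 ℤ.+ k)) ℤ.+ + 2
        down₂ = ℤ-Solver.solve-∀
        down₁ : ∀ k → ℤ.- (+ 1 ℤ.+ k) ≡ (ℤ.- (+ 2 ℤ.+ k)) ℤ.+ + 1
        down₁ = ℤ-Solver.solve-∀

    -- |a + b k| ≤ |a| + |b| k and ψ ≥ 1; the factor ψ^|a| goes into the constant.
    subsequence-growth : ∀ a b → ∃[ A ] 0ℚ ℚ.< A ×
      ∀ k → G (a ℤ.+ b ℤ.* + k) ≺ A ℚ.* (ψ ^ℚ ℤ.∣ b ∣) ^ℚ k
    subsequence-growth a b =
      let A , A>0 , h = generalizedFibonacci-growth
          ψ>0 = ℚₚ.<-≤-trans (ℚₚ.positive⁻¹ 1ℚ) 1≤ψ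
      in A ℚ.* ψ ^ℚ ℤ.∣ a ∣ , *>0 A>0 (^ℚ>0 ψ>0 ℤ.∣ a ∣) , λ k →
        ≺-≤-trans (h (a ℤ.+ b ℤ.* + k)) (begin
          A ℚ.* ψ ^ℚ ℤ.∣ a ℤ.+ b ℤ.* + k ∣
            ≤⟨ ℚₚ.*-monoˡ-≤-nonNeg A {{ℚ.nonNegative (ℚₚ.<⇒≤ A>0)}} (^ℚ-monoʳ-≤ 1≤ψ (index≤ k)) ⟩
          A ℚ.* ψ ^ℚ (ℤ.∣ a ∣ ℕ.+ ℤ.∣ b ∣ ℕ.* k)
            ≡⟨ cong (A ℚ.*_) (^ℚ-homo-* ψ ℤ.∣ a ∣ (ℤ.∣ b ∣ ℕ.* k)) ⟩
          A ℚ.* (ψ ^ℚ ℤ.∣ a ∣ ℚ.* ψ ^ℚ (ℤ.∣ b ∣ ℕ.* k))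
            ≡⟨ cong (λ p → A ℚ.* (ψ ^ℚ ℤ.∣ a ∣ ℚ.* p)) (^ℚ-assocʳ ψ ℤ.∣ b ∣ k) ⟨
          A ℚ.* (ψ ^ℚ ℤ.∣ a ∣ ℚ.* (ψ ^ℚ ℤ.∣ b ∣) ^ℚ k)
            ≡⟨ ℚₚ.*-assoc A (ψ ^ℚ ℤ.∣ a ∣) ((ψ ^ℚ ℤ.∣ b ∣) ^ℚ k) ⟨
          A ℚ.* ψ ^ℚ ℤ.∣ a ∣ ℚ.* (ψ ^ℚ ℤ.∣ b ∣) ^ℚ k ∎)
      where
      open ℚₚ.≤-Reasoning
      index≤ : ∀ k → ℤ.∣ a ℤ.+ b ℤ.* + k ∣ ℕ.≤ ℤ.∣ a ∣ ℕ.+ ℤ.∣ b ∣ ℕ.* k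
      index≤ k = subst (λ n → ℤ.∣ a ℤ.+ b ℤ.* + k ∣ ℕ.≤ ℤ.∣ a ∣ ℕ.+ n)
        (ℤₚ.abs-* b (+ k)) (ℤₚ.∣i+j∣≤∣i∣+∣j∣ a (b ℤ.* + k))

-- Rational radii extracted from the real hypothesis on x.

opaque

  seq-^ᵣ : ∀ x n m → seq (x ^ᵣ n) m ≡ seq x m ^ℚ n
  seq-^ᵣ x zero    m = refl
  seq-^ᵣ x (suc n) m = cong (seq x m ℚ.*_) (seq-^ᵣ x n m)

  -- Bernoulli's qⁿ ≥ 1 - n (1 - q). It limits the loss when `rational-radii` replaces one
  -- approximation of φ by another.
  bernoulli-lower : ∀ {q} → 0ℚ ℚ.≤ q → q ℚ.≤ 1ℚ → ∀ n →
    1ℚ ℚ.≤ q ^ℚ n ℚ.+ (+ n ℚ./ 1) ℚ.* (1ℚ ℚ.- q)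
  bernoulli-lower {q} q≥0 q≤1 zero = ℚₚ.≤-reflexive (cong (1ℚ ℚ.+_) (sym (ℚₚ.*-zeroˡ (1ℚ ℚ.- q))))
  bernoulli-lower {q} q≥0 q≤1 (suc n) = begin
    1ℚ
      ≡⟨ split q ⟩
    q ℚ.* 1ℚ ℚ.+ (1ℚ ℚ.- q)
      ≤⟨ ℚₚ.+-monoˡ-≤ (1ℚ ℚ.- q)
           (ℚₚ.*-monoˡ-≤-nonNeg q {{ℚ.nonNegative q≥0}} (bernoulli-lower q≥0 q≤1 n)) ⟩
    q ℚ.* (p ℚ.+ m ℚ.* s) ℚ.+ s
      ≤⟨ p≤p+q (*≥0 (ℕ/1≥0 n) (square≥0 s)) ⟩
    q ℚ.* (p ℚ.+ m ℚ.* s) ℚ.+ s ℚ.+ m ℚ.* (s ℚ.* s)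
      ≡⟨ collect q p m ⟩
    q ℚ.* p ℚ.+ (1ℚ ℚ.+ m) ℚ.* s
      ≡⟨ cong (λ k → q ℚ.* p ℚ.+ k ℚ.* s) (suc/1 n) ⟨
    q ℚ.* p ℚ.+ (+ suc n ℚ./ 1) ℚ.* s ∎
    where
    open ℚₚ.≤-Reasoning
    p m s : ℚ
    p = q ^ℚ n
    m = + n ℚ./ 1
    s = 1ℚ ℚ.- q
    split : ∀ q → 1ℚ ≡ q ℚ.* 1ℚ ℚ.+ (1ℚ ℚ.- q)
    split = solve-∀ ℚ-ring
    collect : ∀ q p m → q ℚ.* (p ℚ.+ m ℚ.* (1ℚ ℚ.- q)) ℚ.+ (1ℚ ℚ.- q)
      ℚ.+ m ℚ.* ((1ℚ ℚ.- q) ℚ.* (1ℚ ℚ.- q)) ≡ q ℚ.* p ℚ.+ (1ℚ ℚ.+ m) ℚ.* (1ℚ ℚ.- q)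
    collect = solve-∀ ℚ-ring

  ^ℚ-monoˡ-≤ : ∀ {p q} → 0ℚ ℚ.≤ p → p ℚ.≤ q → ∀ n → p ^ℚ n ℚ.≤ q ^ℚ n
  ^ℚ-monoˡ-≤ p≥0 p≤q zero    = ℚₚ.≤-refl
  ^ℚ-monoˡ-≤ p≥0 p≤q (suc n) =
    *-mono-≤ p≥0 (^ℚ≥0 (ℚₚ.≤-trans p≥0 p≤q) n) p≤q (^ℚ-monoˡ-≤ p≥0 p≤q n)

  1/suc≥0 : ∀ n → 0ℚ ℚ.≤ + 1 ℚ./ suc n
  1/suc≥0 n = ℚₚ.nonNegative⁻¹ _ {{ℚₚ.normalize-nonNeg 1 (suc n)}}

  1/suc≤1 : ∀ n → + 1 ℚ./ suc n ℚ.≤ 1ℚ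
  1/suc≤1 n = frac-≤ (+ 1) n (+ 1) 0 (ℤ.+≤+ (ℕ.s≤s ℕ.z≤n))

  -- A term below 1 would give 5 < (1 + 1)², because the rounding error is at most 1.
  1≤approxRoot-5 : ∀ n → 1ℚ ℚ.≤ approxRoot (+ 5 ℚ./ 1) n
  1≤approxRoot-5 n = ℚₚ.≮⇒≥ λ a<1 → ℚₚ.<-irrefl refl (begin-strict
    + 5 ℚ./ 1
      <⟨ approxRoot-upper (+ 5 ℚ./ 1) n ⟩
    (a ℚ.+ δ) ℚ.* (a ℚ.+ δ)
      ≤⟨ *-mono-≤ (+≥0 (approxRoot≥0 (+ 5 ℚ./ 1) n) (1/suc≥0 n)) (from-yes (0ℚ ℚₚ.≤? 1ℚ ℚ.+ 1ℚ))
           (a+δ≤2 a<1) (a+δ≤2 a<1) ⟩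
    (1ℚ ℚ.+ 1ℚ) ℚ.* (1ℚ ℚ.+ 1ℚ)
      ≤⟨ from-yes ((1ℚ ℚ.+ 1ℚ) ℚ.* (1ℚ ℚ.+ 1ℚ) ℚₚ.≤? + 5 ℚ./ 1) ⟩
    + 5 ℚ./ 1 ∎)
    where
    open ℚₚ.≤-Reasoning
    a δ : ℚ
    a = approxRoot (+ 5 ℚ./ 1) n
    δ = + 1 ℚ./ suc n
    a+δ≤2 : a ℚ.< 1ℚ → a ℚ.+ δ ℚ.≤ 1ℚ ℚ.+ 1ℚ
    a+δ≤2 a<1 = ℚₚ.+-mono-≤ (ℚₚ.<⇒≤ a<1) (1/suc≤1 n)

  -- For ψ = ½ (1 + r) the difference ψ² - ψ - 1 is ¼ (r² - 5).
  golden-≤ : ∀ {r} → + 5 ℚ./ 1 ℚ.≤ r ℚ.* r →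
    1ℚ ℚ.+ ½ ℚ.* (1ℚ ℚ.+ r) ℚ.≤ (½ ℚ.* (1ℚ ℚ.+ r)) ℚ.* (½ ℚ.* (1ℚ ℚ.+ r))
  golden-≤ {r} 5≤rr = begin
    1ℚ ℚ.+ ½ ℚ.* (1ℚ ℚ.+ r)
      ≡⟨ left r ⟩
    -- The five ones evaluate to `+ 5 ℚ./ 1`, where the hypothesis applies.
    ½ ℚ.* ½ ℚ.* (1ℚ ℚ.+ (r ℚ.+ r) ℚ.+ (1ℚ ℚ.+ 1ℚ ℚ.+ 1ℚ ℚ.+ 1ℚ ℚ.+ 1ℚ))
      ≤⟨ ℚₚ.*-monoˡ-≤-nonNeg (½ ℚ.* ½) (ℚₚ.+-monoʳ-≤ (1ℚ ℚ.+ (r ℚ.+ r)) 5≤rr) ⟩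
    ½ ℚ.* ½ ℚ.* (1ℚ ℚ.+ (r ℚ.+ r) ℚ.+ r ℚ.* r)
      ≡⟨ right r ⟩
    (½ ℚ.* (1ℚ ℚ.+ r)) ℚ.* (½ ℚ.* (1ℚ ℚ.+ r)) ∎
    where
    open ℚₚ.≤-Reasoning
    left : ∀ r → 1ℚ ℚ.+ ½ ℚ.* (1ℚ ℚ.+ r)
      ≡ ½ ℚ.* ½ ℚ.* (1ℚ ℚ.+ (r ℚ.+ r) ℚ.+ (1ℚ ℚ.+ 1ℚ ℚ.+ 1ℚ ℚ.+ 1ℚ ℚ.+ 1ℚ))
    left = solve-∀ ℚ-ring
    right : ∀ r → ½ ℚ.* ½ ℚ.* (1ℚ ℚ.+ (r ℚ.+ r) ℚ.+ r ℚ.* r)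
      ≡ (½ ℚ.* (1ℚ ℚ.+ r)) ℚ.* (½ ℚ.* (1ℚ ℚ.+ r))
    right = solve-∀ ℚ-ring

  -- Clears the reciprocal in φ^(-B). Since `inv` starts at a later index of its argument, the terms
  -- of |x| and of φ are taken at the different indices n and M + n.
  <φ^-⇒ : ∀ B x → ∣ x ∣ <ᵣ φ^ (ℤ.- (+ B)) →
    ∃[ ε ] 0ℚ ℚ.< ε × ∃[ M ] ∃[ N ] ∀ n → N ℕ.≤ n →
      (approxRoot (seq (normSq x) n) n ℚ.+ ε) ℚ.* seq φ (M ℕ.+ n) ^ℚ B ℚ.< 1ℚ
  <φ^-⇒ zero    x (mk<ᵣ ε ε>0 N gap) = ε , ε>0 , 0 , N , λ n N≤n →
    subst (ℚ._< 1ℚ) (sym (ℚₚ.*-identityʳ (seq ∣ x ∣ n ℚ.+ ε))) (gap n N≤n)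
  <φ^-⇒ (suc B) x (mk<ᵣ ε ε>0 N gap) = ε , ε>0 , M , N , λ n N≤n →
    let p = seq (φ ^ᵣ suc B) (M ℕ.+ n)
        p>0 = term>0 φ^>0 n
    in subst₂ ℚ._<_
         (cong ((seq ∣ x ∣ n ℚ.+ ε) ℚ.*_) (seq-^ᵣ φ (suc B) (M ℕ.+ n)))
         (ℚₚ.*-inverseˡ p {{ℚ.>-nonZero p>0}})
         (ℚₚ.*-monoˡ-<-pos p {{ℚ.positive p>0}} (gap n N≤n))
    where
    φ^>0 : 0ᵣ <ᵣ φ ^ᵣ suc B
    φ^>0 = ^>0ᵣ φ>0 (suc B)
    M : ℕ
    M = _<ᵣ_.from φ^>0

  -- A single late term a bounds the modulus: later terms of `∣ x ∣` stay within θ of it, and the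
  -- true root exceeds a rounded term by less than θ, so a + 2 θ = a + η is a bound.
  ∣∣-bound : ∀ x η → 0ℚ ℚ.< η → ∃[ N ] ∀ n → N ℕ.≤ n →
    x ≺ approxRoot (seq (normSq x) n) n ℚ.+ (η ℚ.+ η)
  ∣∣-bound x η η>0 =
    let θ = ½ ℚ.* η
        θ>0 = half>0 η>0
        K , h = cauchy ∣ x ∣ θ θ>0
        L , k = archimedean θ θ>0
    in K , λ n K≤n →
      let a = seq ∣ x ∣ n
          a≥0 = approxRoot≥0 (seq (normSq x) n) n
          a+η≥0 = +≥0 a≥0 (ℚₚ.<⇒≤ η>0)
      in mk≺ (a ℚ.+ η) a+η≥0 (ℚₚ.+-monoʳ-< a (p<p+q {η} η>0)) (K ℕ.+ L) λ m ≤m →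
        let a′ = seq ∣ x ∣ m
            δ  = + 1 ℚ./ suc m
            a′+δ≤ : a′ ℚ.+ δ ℚ.≤ a ℚ.+ η
            a′+δ≤ = begin
              a′ ℚ.+ δ                  ≡⟨ cong (ℚ._+ δ) (plus-minus a′ a) ⟩
              a ℚ.+ (a′ ℚ.- a) ℚ.+ δ    ≡⟨ ℚₚ.+-assoc a (a′ ℚ.- a) δ ⟩
              a ℚ.+ (a′ ℚ.- a ℚ.+ δ)    ≤⟨ ℚₚ.+-monoʳ-≤ a (ℚₚ.<⇒≤ (ℚₚ.+-mono-<
                  (ℚₚ.≤-<-trans (p≤∣p∣ (a′ ℚ.- a)) (h m n (ℕₚ.m+n≤o⇒m≤o K ≤m) K≤n))
                  (k m (ℕₚ.m+n≤o⇒n≤o K ≤m)))) ⟩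
              a ℚ.+ (θ ℚ.+ θ)           ≡⟨ cong (a ℚ.+_) (half+half η) ⟩
              a ℚ.+ η                   ∎
        in ℚₚ.≤-trans (ℚₚ.<⇒≤ (approxRoot-upper (seq (normSq x) m) m))
          (*-mono-≤ (+≥0 (approxRoot≥0 (seq (normSq x) m) m) (1/suc≥0 m)) a+η≥0 a′+δ≤ a′+δ≤)
    where open ℚₚ.≤-Reasoning

  -- ψ is the upper approximation ½(1 + r) of φ with r ≥ √5; it exceeds the lower
  -- approximation v that occurs in the hypothesis by at most the factor 1/(1 - δ).
  rational-radii : ∀ B x → ∣ x ∣ <ᵣ φ^ (ℤ.- (+ B)) → ∃[ ρ ] ∃[ ψ ]
    x ≺ ρ × 1ℚ ℚ.≤ ψ × 1ℚ ℚ.+ ψ ℚ.≤ ψ ℚ.* ψ × ρ ℚ.* ψ ^ℚ B ℚ.< 1ℚ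
  rational-radii B x ∣x∣< =
    let ε , ε>0 , M , N , h = <φ^-⇒ B x ∣x∣<
        -- ρ = a + 2 η = a + ε/2 spends half of the margin; the other half covers the step from v to
        -- ψ.
        η = ½ ℚ.* (½ ℚ.* ε)
        K , k = ∣∣-bound x η (half>0 (half>0 ε>0))
        -- μ (1 + B) = ε/2, so with δ < μ the loss B δ caused by B factors 1 - δ is at most ε/2.
        μ , μ>0 , 1+Bμ≡ = ∃-quotient (½ ℚ.* ε) {1ℚ ℚ.+ + B ℚ./ 1} (half>0 ε>0)
          (+>0 (ℚₚ.positive⁻¹ 1ℚ) (ℕ/1≥0 B))
        L , l = archimedean μ μ>0
        n = N ℕ.+ (K ℕ.+ L)
        m = M ℕ.+ n
        a = approxRoot (seq (normSq x) n) n
        √5 = approxRoot (+ 5 ℚ./ 1) m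
        δ = + 1 ℚ./ suc m
        q = 1ℚ ℚ.- δ
        v = ½ ℚ.* (1ℚ ℚ.+ √5)
        ψ = ½ ℚ.* (1ℚ ℚ.+ (√5 ℚ.+ δ))
        c = + B ℚ./ 1
        K+L≤n = ℕₚ.m≤n+m (K ℕ.+ L) N
        a≥0 = approxRoot≥0 (seq (normSq x) n) n
        a+ε≥0 = +≥0 a≥0 (ℚₚ.<⇒≤ ε>0)
        δ<μ = l m (ℕₚ.≤-trans (ℕₚ.m+n≤o⇒n≤o K K+L≤n) (ℕₚ.m≤n+m n M))
        1≤v = 1≤half {√5} (1≤approxRoot-5 m)
        1≤ψ = 1≤half (ℚₚ.≤-trans (1≤approxRoot-5 m) (p≤p+q (1/suc≥0 m)))
        ψ≥0 = ℚₚ.≤-trans (ℚₚ.nonNegative⁻¹ 1ℚ) 1≤ψ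
        q≥0 = p≤q⇒0≤q-p (1/suc≤1 m)
        q≤1 = subst (q ℚ.≤_) (q+δ≡1 δ) (p≤p+q {q} (1/suc≥0 m))
        -- v ≥ 1 removes the factor v^B from the hypothesis. With a + ε ≤ 1 the relative loss (a +
        -- ε) B δ is no larger than B δ.
        a+ε≤1 : a ℚ.+ ε ℚ.≤ 1ℚ
        a+ε≤1 = ℚₚ.≤-trans (p≤p*q a+ε≥0 (1≤^ℚ 1≤v B)) (ℚₚ.<⇒≤ (h n (ℕₚ.m≤m+n N (K ℕ.+ L))))
        -- v - ψ (1 - δ) = δ (ψ - ½), which is nonnegative because ψ ≥ 1.
        ψq≤v : ψ ℚ.* q ℚ.≤ v
        ψq≤v = begin
          ψ ℚ.* q
            ≤⟨ p≤p+q (*≥0 (1/suc≥0 m) (+≥0 (p≤q⇒0≤q-p 1≤ψ) (ℚₚ.nonNegative⁻¹ ½))) ⟩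
          ψ ℚ.* q ℚ.+ δ ℚ.* ((ψ ℚ.- 1ℚ) ℚ.+ ½)
            ≡⟨ ψq-defect √5 δ ⟩
          v ∎
        cδ≤ : c ℚ.* δ ℚ.≤ ½ ℚ.* ε
        cδ≤ = begin
          c ℚ.* δ                   ≤⟨ p≤p+q (1/suc≥0 m) ⟩
          c ℚ.* δ ℚ.+ δ             ≡⟨ c*δ+δ c δ ⟩
          (1ℚ ℚ.+ c) ℚ.* δ          ≤⟨ ℚₚ.*-monoˡ-≤-nonNeg (1ℚ ℚ.+ c)
            {{ℚ.nonNegative (+≥0 (ℚₚ.nonNegative⁻¹ 1ℚ) (ℕ/1≥0 B))}} (ℚₚ.<⇒≤ δ<μ) ⟩
          (1ℚ ℚ.+ c) ℚ.* μ          ≡⟨ 1+Bμ≡ ⟩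
          ½ ℚ.* ε                   ∎
        ρ≤ : a ℚ.+ (η ℚ.+ η) ℚ.≤ (a ℚ.+ ε) ℚ.* q ^ℚ B
        ρ≤ = begin
          a ℚ.+ (η ℚ.+ η)
            ≡⟨ cong (a ℚ.+_) (half+half (½ ℚ.* ε)) ⟩
          a ℚ.+ ½ ℚ.* ε
            ≡⟨ half-difference a ε ⟩
          (a ℚ.+ ε) ℚ.- ½ ℚ.* ε
            ≤⟨ ℚₚ.+-monoʳ-≤ (a ℚ.+ ε) (ℚₚ.neg-antimono-≤ cδ≤) ⟩
          (a ℚ.+ ε) ℚ.- c ℚ.* δ
            ≡⟨ cong (λ p → (a ℚ.+ ε) ℚ.- p) (ℚₚ.*-identityˡ (c ℚ.* δ)) ⟨
          (a ℚ.+ ε) ℚ.- 1ℚ ℚ.* (c ℚ.* δ)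
            ≤⟨ ℚₚ.+-monoʳ-≤ (a ℚ.+ ε) (ℚₚ.neg-antimono-≤
                 (ℚₚ.*-monoʳ-≤-nonNeg (c ℚ.* δ)
                   {{ℚ.nonNegative (*≥0 (ℕ/1≥0 B) (1/suc≥0 m))}} a+ε≤1)) ⟩
          (a ℚ.+ ε) ℚ.- (a ℚ.+ ε) ℚ.* (c ℚ.* δ)
            ≡⟨ pull-out (a ℚ.+ ε) c δ ⟩
          (a ℚ.+ ε) ℚ.* (1ℚ ℚ.- c ℚ.* (1ℚ ℚ.- q))
            ≤⟨ ℚₚ.*-monoˡ-≤-nonNeg (a ℚ.+ ε) {{ℚ.nonNegative a+ε≥0}}
                 (≤+⇒-≤ {q ^ℚ B} (bernoulli-lower q≥0 q≤1 B)) ⟩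
          (a ℚ.+ ε) ℚ.* q ^ℚ B ∎
    in a ℚ.+ (η ℚ.+ η) , ψ , k n (ℕₚ.m+n≤o⇒m≤o K K+L≤n) , 1≤ψ ,
      golden-≤ {√5 ℚ.+ δ} (ℚₚ.<⇒≤ (approxRoot-upper (+ 5 ℚ./ 1) m)) , (begin-strict
        (a ℚ.+ (η ℚ.+ η)) ℚ.* ψ ^ℚ B
          ≤⟨ ℚₚ.*-monoʳ-≤-nonNeg (ψ ^ℚ B) {{ℚ.nonNegative (^ℚ≥0 ψ≥0 B)}} ρ≤ ⟩
        (a ℚ.+ ε) ℚ.* q ^ℚ B ℚ.* ψ ^ℚ B
          ≡⟨ swap (a ℚ.+ ε) (q ^ℚ B) (ψ ^ℚ B) ⟩
        (a ℚ.+ ε) ℚ.* (ψ ^ℚ B ℚ.* q ^ℚ B)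
          ≡⟨ cong ((a ℚ.+ ε) ℚ.*_) (^ℚ-distrib-* ψ q B) ⟨
        (a ℚ.+ ε) ℚ.* (ψ ℚ.* q) ^ℚ B
          ≤⟨ ℚₚ.*-monoˡ-≤-nonNeg (a ℚ.+ ε) {{ℚ.nonNegative a+ε≥0}}
               (^ℚ-monoˡ-≤ (*≥0 ψ≥0 q≥0) ψq≤v B) ⟩
        (a ℚ.+ ε) ℚ.* v ^ℚ B
          <⟨ h n (ℕₚ.m≤m+n N (K ℕ.+ L)) ⟩
        1ℚ ∎)
    where
    open ℚₚ.≤-Reasoning
    1≤half : ∀ {r} → 1ℚ ℚ.≤ r → 1ℚ ℚ.≤ ½ ℚ.* (1ℚ ℚ.+ r)
    1≤half 1≤r = ℚₚ.*-monoˡ-≤-nonNeg ½ (ℚₚ.+-monoʳ-≤ 1ℚ 1≤r)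
    q+δ≡1 : ∀ δ → (1ℚ ℚ.- δ) ℚ.+ δ ≡ 1ℚ
    q+δ≡1 = solve-∀ ℚ-ring
    ψq-defect : ∀ s δ → (½ ℚ.* (1ℚ ℚ.+ (s ℚ.+ δ))) ℚ.* (1ℚ ℚ.- δ)
      ℚ.+ δ ℚ.* ((½ ℚ.* (1ℚ ℚ.+ (s ℚ.+ δ)) ℚ.- 1ℚ) ℚ.+ ½) ≡ ½ ℚ.* (1ℚ ℚ.+ s)
    ψq-defect = solve-∀ ℚ-ring
    c*δ+δ : ∀ c δ → c ℚ.* δ ℚ.+ δ ≡ (1ℚ ℚ.+ c) ℚ.* δ
    c*δ+δ = solve-∀ ℚ-ring
    half-difference : ∀ a ε → a ℚ.+ ½ ℚ.* ε ≡ (a ℚ.+ ε) ℚ.- ½ ℚ.* ε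
    half-difference = solve-∀ ℚ-ring
    pull-out : ∀ e c δ → e ℚ.- e ℚ.* (c ℚ.* δ) ≡ e ℚ.* (1ℚ ℚ.- c ℚ.* (1ℚ ℚ.- (1ℚ ℚ.- δ)))
    pull-out = solve-∀ ℚ-ring
    swap : ∀ p q r → p ℚ.* q ℚ.* r ≡ p ℚ.* (r ℚ.* q)
    swap = solve-∀ ℚ-ring
    ≤+⇒-≤ : ∀ {p q r} → r ℚ.≤ p ℚ.+ q → r ℚ.- q ℚ.≤ p
    ≤+⇒-≤ {p} {q} {r} h = subst (r ℚ.- q ℚ.≤_) (cancel p q) (ℚₚ.+-monoˡ-≤ (ℚ.- q) h)
      where
      cancel : ∀ p q → p ℚ.+ q ℚ.- q ≡ p
      cancel = solve-∀ ℚ-ring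

-- Powers as combinations of binomial coefficients.

ℕ→ℂ-homo-+ : ∀ m n → ℕ→ℂ (m ℕ.+ n) ≈ ℕ→ℂ m + ℕ→ℂ n
ℕ→ℂ-homo-+ m n = ℤ→ℂ-homo-+ (+ m) (+ n)

ℕ→ℂ-homo-* : ∀ m n → ℕ→ℂ (m ℕ.* n) ≈ ℕ→ℂ m * ℕ→ℂ n
ℕ→ℂ-homo-* m n = ≈-trans (≡⇒≈ (cong ℤ→ℂ (ℤₚ.pos-* m n))) (ℤ→ℂ-homo-* (+ m) (+ n))

ℤ→ℂ-homo-^ : ∀ i n → ℤ→ℂ (i ℤ.^ n) ≈ ℤ→ℂ i ^ n
ℤ→ℂ-homo-^ i zero    = ≈-refl
ℤ→ℂ-homo-^ i (suc n) = ≈-trans (ℤ→ℂ-homo-* i (i ℤ.^ n)) (*-cong ≈-refl (ℤ→ℂ-homo-^ i n))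

∑-shift : ∀ n f → f 0 ≈ ℕ→ℂ 0 → f n ≈ ℕ→ℂ 0 → ∑[k< n ] f ≈ ∑[k< n ] (λ k → f (suc k))
∑-shift n f f₀≈0 fₙ≈0 = begin
  ∑[k< n ] f
    ≈⟨ solve 1 (λ a → a := a :+ con (+ 0)) ≈-refl (∑[k< n ] f) ⟩
  ∑[k< n ] f + ℕ→ℂ 0
    ≈⟨ +-cong ≈-refl fₙ≈0 ⟨
  ∑[k< n ] f + f n
    ≈⟨ ∑-last n f ⟨
  f 0 + ∑[k< n ] (λ k → f (suc k))
    ≈⟨ +-cong f₀≈0 ≈-refl ⟩
  ℕ→ℂ 0 + ∑[k< n ] (λ k → f (suc k))
    ≈⟨ +-identityˡ (∑[k< n ] (λ k → f (suc k))) ⟩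
  ∑[k< n ] (λ k → f (suc k)) ∎
  where open ≈-Reasoning

Sums-∑ : ∀ n {F : ℕ → ℕ → ℂ} {S : ℕ → ℂ} → (∀ j → Sums (F j) (S j)) →
         Sums (λ k → ∑[k< n ] (λ j → F j k)) (∑[k< n ] S)
Sums-∑ zero    h δ δ>0 = 0 , λ n _ → ≈0⇒≺ (zero-sum n) δ>0
  where
  zero-sum : ∀ n → ∑[k< n ] (λ _ → ℕ→ℂ 0) - ℕ→ℂ 0 ≈ ℕ→ℂ 0
  zero-sum zero    = solve 0 (con (+ 0) :- con (+ 0) := con (+ 0)) ≈-refl
  zero-sum (suc n) = ≈-trans (+-cong (+-identityˡ (∑[k< n ] (λ _ → ℕ→ℂ 0))) ≈-refl) (zero-sum n)
Sums-∑ (suc n) {F} h = Sums-+ {F 0} {λ k → ∑[k< n ] (λ j → F (suc j) k)} (h 0)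
  (Sums-∑ n {λ j → F (suc j)} (λ j → h (suc j)))

-- Equals j! S(m, j), with S the Stirling numbers of the second kind.
surjections : ℕ → ℕ → ℕ
surjections zero    zero    = 1
surjections zero    (suc j) = 0
surjections (suc m) zero    = 0
surjections (suc m) (suc j) = suc j ℕ.* (surjections m j ℕ.+ surjections m (suc j))

opaque

  surjections-> : ∀ m {j} → m ℕ.< j → surjections m j ≡ 0
  surjections-> zero    (ℕ.s≤s _) = refl
  surjections-> (suc m) {suc j} (ℕ.s≤s m<j) = trans
    (cong₂ (λ p q → suc j ℕ.* (p ℕ.+ q)) (surjections-> m m<j) (surjections-> m (ℕₚ.m<n⇒m<1+n m<j)))
    (ℕₚ.*-zeroʳ (suc j))

  -- This is (k - j) C(k , j) = (j + 1) C(k , j + 1) with the subtraction moved to the other side,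
  -- so that k < j is covered as well.
  C-absorb : ∀ k j → k ℕ.* (k C j) ≡ j ℕ.* (k C j) ℕ.+ suc j ℕ.* (k C suc j)
  C-absorb zero zero = refl
  C-absorb zero (suc j) = sym (cong₂ (λ p q → suc j ℕ.* p ℕ.+ suc (suc j) ℕ.* q)
    (k>n⇒nCk≡0 {0} {suc j} (ℕ.s≤s ℕ.z≤n)) (k>n⇒nCk≡0 {0} {suc (suc j)} (ℕ.s≤s ℕ.z≤n))
    ⟨ trans ⟩ cong₂ ℕ._+_ (ℕₚ.*-zeroʳ (suc j)) (ℕₚ.*-zeroʳ (suc (suc j))))
    where open import Function.Base using (_⟨_⟩_)
  C-absorb (suc k) zero = begin
    suc k ℕ.* (suc k C 0)             ≡⟨ cong (suc k ℕ.*_) (nC0≡1 (suc k)) ⟩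
    suc k ℕ.* 1                       ≡⟨ cong suc (cong (k ℕ.*_) (nC0≡1 k)) ⟨
    suc (k ℕ.* (k C 0))               ≡⟨ cong suc (C-absorb k 0) ⟩
    1 ℕ.+ 1 ℕ.* (k C 1)               ≡⟨ cong₂ ℕ._+_ (nC0≡1 k) (sym (ℕₚ.*-identityˡ (k C 1))) ⟨
    k C 0 ℕ.+ k C 1                   ≡⟨ nCk+nC[k+1]≡[n+1]C[k+1] k 0 ⟩
    suc k C 1                         ≡⟨ ℕₚ.*-identityˡ (suc k C 1) ⟨
    1 ℕ.* (suc k C 1)                 ∎
    where open ≡-Reasoning
  C-absorb (suc k) (suc j) = begin
    suc k ℕ.* (suc k C suc j)
      ≡⟨ cong (suc k ℕ.*_) (pascal j) ⟩
    suc k ℕ.* (p ℕ.+ q)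
      ≡⟨ expand k p q ⟩
    k ℕ.* p ℕ.+ k ℕ.* q ℕ.+ (p ℕ.+ q)
      ≡⟨ cong₂ (λ u v → u ℕ.+ v ℕ.+ (p ℕ.+ q)) (C-absorb k j) (C-absorb k (suc j)) ⟩
    (j ℕ.* p ℕ.+ suc j ℕ.* q) ℕ.+ (suc j ℕ.* q ℕ.+ suc (suc j) ℕ.* r) ℕ.+ (p ℕ.+ q)
      ≡⟨ collect j p q r ⟩
    suc j ℕ.* (p ℕ.+ q) ℕ.+ suc (suc j) ℕ.* (q ℕ.+ r)
      ≡⟨ cong₂ (λ u v → suc j ℕ.* u ℕ.+ suc (suc j) ℕ.* v) (pascal j) (pascal (suc j)) ⟨
    suc j ℕ.* (suc k C suc j) ℕ.+ suc (suc j) ℕ.* (suc k C suc (suc j)) ∎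
    where
    open ≡-Reasoning
    p q r : ℕ
    p = k C j
    q = k C suc j
    r = k C suc (suc j)
    pascal : ∀ j → suc k C suc j ≡ k C j ℕ.+ k C suc j
    pascal j = sym (nCk+nC[k+1]≡[n+1]C[k+1] k j)
    expand : ∀ k p q → (1 ℕ.+ k) ℕ.* (p ℕ.+ q) ≡ k ℕ.* p ℕ.+ k ℕ.* q ℕ.+ (p ℕ.+ q)
    expand = ℕ-Solver.solve-∀
    collect : ∀ j p q r →
      (j ℕ.* p ℕ.+ (1 ℕ.+ j) ℕ.* q) ℕ.+ ((1 ℕ.+ j) ℕ.* q ℕ.+ (2 ℕ.+ j) ℕ.* r) ℕ.+ (p ℕ.+ q)
      ≡ (1 ℕ.+ j) ℕ.* (p ℕ.+ q) ℕ.+ (2 ℕ.+ j) ℕ.* (q ℕ.+ r)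
    collect = ℕ-Solver.solve-∀

  -- Multiplication by k turns C(k , j) into j C(k , j) + (j + 1) C(k , j + 1) by `C-absorb`;
  -- collecting coefficients gives the recurrence that defines `surjections`.
  power-as-binomials : ∀ m k →
    ℕ→ℂ k ^ m ≈ ∑[k< suc m ] (λ j → ℕ→ℂ (surjections m j) * ℕ→ℂ (k C j))
  power-as-binomials zero k = ≈-trans
    (solve 0 (con (+ 1) := con (+ 1) :* con (+ 1) :+ con (+ 0)) ≈-refl)
    (+-cong (*-cong ≈-refl (≡⇒≈ (cong ℕ→ℂ (sym (nC0≡1 k))))) ≈-refl)
  power-as-binomials (suc m) k = begin
    K * K ^ m
      ≈⟨ *-cong ≈-refl (power-as-binomials m k) ⟩
    K * ∑[k< suc m ] (λ j → W j * E j)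
      ≈⟨ ∑-scale (suc m) K (λ j → W j * E j) ⟨
    ∑[k< suc m ] (λ j → K * (W j * E j))
      ≈⟨ ∑-cong (suc m) absorb ⟩
    ∑[k< suc m ] (λ j → f j + ℕ→ℂ (suc j) * (W j * E (suc j)))
      ≈⟨ ∑-+ (suc m) f (λ j → ℕ→ℂ (suc j) * (W j * E (suc j))) ⟩
    ∑[k< suc m ] f + ∑[k< suc m ] (λ j → ℕ→ℂ (suc j) * (W j * E (suc j)))
      -- The shift aligns both sums at C(k , j + 1). Nothing is lost: f 0 has the factor 0, and f (m
      -- + 1) has the factor `surjections m (suc m)` = 0.
      ≈⟨ +-cong (∑-shift (suc m) f f₀≈0 fₘ₊₁≈0) ≈-refl ⟩
    ∑[k< suc m ] (λ j → f (suc j)) + ∑[k< suc m ] (λ j → ℕ→ℂ (suc j) * (W j * E (suc j)))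
      ≈⟨ ∑-+ (suc m) (λ j → f (suc j)) (λ j → ℕ→ℂ (suc j) * (W j * E (suc j))) ⟨
    ∑[k< suc m ] (λ j → f (suc j) + ℕ→ℂ (suc j) * (W j * E (suc j)))
      ≈⟨ ∑-cong (suc m) collect ⟩
    ∑[k< suc m ] (λ j → ℕ→ℂ (surjections (suc m) (suc j)) * E (suc j))
      ≈⟨ solve 2 (λ e t → t := con (+ 0) :* e :+ t) ≈-refl (E 0)
           (∑[k< suc m ] (λ j → ℕ→ℂ (surjections (suc m) (suc j)) * E (suc j))) ⟩
    ∑[k< suc (suc m) ] (λ j → ℕ→ℂ (surjections (suc m) j) * E j) ∎
    where
    open ≈-Reasoning
    K : ℂ
    K = ℕ→ℂ k
    W E f : ℕ → ℂ
    W j = ℕ→ℂ (surjections m j)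
    E j = ℕ→ℂ (k C j)
    f j = ℕ→ℂ j * (W j * E j)
    f₀≈0 : f 0 ≈ ℕ→ℂ 0
    f₀≈0 = solve 1 (λ a → con (+ 0) :* a := con (+ 0)) ≈-refl (W 0 * E 0)
    fₘ₊₁≈0 : f (suc m) ≈ ℕ→ℂ 0
    fₘ₊₁≈0 = ≈-trans
      (*-cong ≈-refl (*-cong (≡⇒≈ (cong ℕ→ℂ (surjections-> m (ℕₚ.n<1+n m)))) ≈-refl))
      (solve 2 (λ a e → a :* (con (+ 0) :* e) := con (+ 0)) ≈-refl (ℕ→ℂ (suc m)) (E (suc m)))
    K*E : ∀ j → K * E j ≈ ℕ→ℂ j * E j + ℕ→ℂ (suc j) * E (suc j)
    K*E j = begin
      K * E j
        ≈⟨ ℕ→ℂ-homo-* k (k C j) ⟨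
      ℕ→ℂ (k ℕ.* (k C j))
        ≡⟨ cong ℕ→ℂ (C-absorb k j) ⟩
      ℕ→ℂ (j ℕ.* (k C j) ℕ.+ suc j ℕ.* (k C suc j))
        ≈⟨ ℕ→ℂ-homo-+ (j ℕ.* (k C j)) (suc j ℕ.* (k C suc j)) ⟩
      ℕ→ℂ (j ℕ.* (k C j)) + ℕ→ℂ (suc j ℕ.* (k C suc j))
        ≈⟨ +-cong (ℕ→ℂ-homo-* j (k C j)) (ℕ→ℂ-homo-* (suc j) (k C suc j)) ⟩
      ℕ→ℂ j * E j + ℕ→ℂ (suc j) * E (suc j) ∎
    absorb : ∀ j → K * (W j * E j) ≈ f j + ℕ→ℂ (suc j) * (W j * E (suc j))
    absorb j = begin
      K * (W j * E j)
        ≈⟨ solve 3 (λ k w e → k :* (w :* e) := w :* (k :* e)) ≈-refl K (W j) (E j) ⟩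
      W j * (K * E j)
        ≈⟨ *-cong ≈-refl (K*E j) ⟩
      W j * (ℕ→ℂ j * E j + ℕ→ℂ (suc j) * E (suc j))
        ≈⟨ solve 5 (λ w i e i′ e′ → w :* (i :* e :+ i′ :* e′) := i :* (w :* e) :+ i′ :* (w :* e′))
             ≈-refl (W j) (ℕ→ℂ j) (E j) (ℕ→ℂ (suc j)) (E (suc j)) ⟩
      f j + ℕ→ℂ (suc j) * (W j * E (suc j)) ∎
    collect : ∀ j → f (suc j) + ℕ→ℂ (suc j) * (W j * E (suc j))
      ≈ ℕ→ℂ (surjections (suc m) (suc j)) * E (suc j)
    collect j = begin
      f (suc j) + ℕ→ℂ (suc j) * (W j * E (suc j))
        ≈⟨ solve 4 (λ i w w′ e → i :* (w′ :* e) :+ i :* (w :* e) := i :* (w :+ w′) :* e)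
             ≈-refl (ℕ→ℂ (suc j)) (W j) (W (suc j)) (E (suc j)) ⟩
      ℕ→ℂ (suc j) * (W j + W (suc j)) * E (suc j)
        ≈⟨ *-cong (*-cong ≈-refl (ℕ→ℂ-homo-+ (surjections m j) (surjections m (suc j)))) ≈-refl ⟨
      ℕ→ℂ (suc j) * ℕ→ℂ (surjections m j ℕ.+ surjections m (suc j)) * E (suc j)
        ≈⟨ *-cong (ℕ→ℂ-homo-* (suc j) (surjections m j ℕ.+ surjections m (suc j))) ≈-refl ⟨
      ℕ→ℂ (surjections (suc m) (suc j)) * E (suc j) ∎

-- Binomial sums and second-order linear recurrences.

binomialSum : ℂ → ℕ → (ℕ → ℂ) → ℂ
binomialSum t v g = ∑[k< suc v ] (λ k → ℕ→ℂ (v C k) * (t ^ k * g k))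

opaque

  -- With E the shift, `binomialSum t v g` is (1 + t E)^v g at 0, and Pascal's rule splits off one
  -- factor. The surplus last term vanishes because C(v , v + 1) = 0.
  binomialSum-suc : ∀ t v g →
    binomialSum t (suc v) g ≈ binomialSum t v (λ k → g k + t * g (suc k))
  binomialSum-suc t v g = begin
    ℕ→ℂ (suc v C 0) * h 0 + ∑[k< suc v ] (λ k → ℕ→ℂ (suc v C suc k) * h (suc k))
      ≈⟨ +-cong (≡⇒≈ (cong (λ n → ℕ→ℂ n * h 0) (trans (nC0≡1 (suc v)) (sym (nC0≡1 v)))))
           (∑-cong (suc v) pascal) ⟩
    f 0 + ∑[k< suc v ] (λ k → ℕ→ℂ (v C k) * h (suc k) + f (suc k))
      ≈⟨ +-cong ≈-refl (∑-+ (suc v) (λ k → ℕ→ℂ (v C k) * h (suc k)) (λ k → f (suc k))) ⟩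
    f 0 + (∑[k< suc v ] (λ k → ℕ→ℂ (v C k) * h (suc k)) + ∑[k< suc v ] (λ k → f (suc k)))
      ≈⟨ solve 3 (λ a b c → a :+ (b :+ c) := (a :+ c) :+ b) ≈-refl (f 0)
           (∑[k< suc v ] (λ k → ℕ→ℂ (v C k) * h (suc k))) (∑[k< suc v ] (λ k → f (suc k))) ⟩
    ∑[k< suc (suc v) ] f + ∑[k< suc v ] (λ k → ℕ→ℂ (v C k) * h (suc k))
      ≈⟨ +-cong (≈-trans (∑-last (suc v) f) drop-last) ≈-refl ⟩
    ∑[k< suc v ] f + ∑[k< suc v ] (λ k → ℕ→ℂ (v C k) * h (suc k))
      ≈⟨ ∑-+ (suc v) f (λ k → ℕ→ℂ (v C k) * h (suc k)) ⟨
    ∑[k< suc v ] (λ k → f k + ℕ→ℂ (v C k) * h (suc k))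
      ≈⟨ ∑-cong (suc v) (λ k → solve 5
           (λ c p t g g′ → c :* (p :* g) :+ c :* ((t :* p) :* g′) := c :* (p :* (g :+ t :* g′)))
           ≈-refl (ℕ→ℂ (v C k)) (t ^ k) t (g k) (g (suc k))) ⟩
    binomialSum t v (λ k → g k + t * g (suc k)) ∎
    where
    open ≈-Reasoning
    h f : ℕ → ℂ
    h k = t ^ k * g k
    f k = ℕ→ℂ (v C k) * h k
    pascal : ∀ k → ℕ→ℂ (suc v C suc k) * h (suc k) ≈ ℕ→ℂ (v C k) * h (suc k) + f (suc k)
    pascal k = begin
      ℕ→ℂ (suc v C suc k) * h (suc k)
        ≡⟨ cong (λ n → ℕ→ℂ n * h (suc k)) (nCk+nC[k+1]≡[n+1]C[k+1] v k) ⟨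
      ℕ→ℂ (v C k ℕ.+ v C suc k) * h (suc k)
        ≈⟨ *-cong (ℕ→ℂ-homo-+ (v C k) (v C suc k)) ≈-refl ⟩
      (ℕ→ℂ (v C k) + ℕ→ℂ (v C suc k)) * h (suc k)
        ≈⟨ solve 3 (λ a b c → (a :+ b) :* c := a :* c :+ b :* c) ≈-refl
             (ℕ→ℂ (v C k)) (ℕ→ℂ (v C suc k)) (h (suc k)) ⟩
      ℕ→ℂ (v C k) * h (suc k) + f (suc k) ∎
    drop-last : ∑[k< suc v ] f + f (suc v) ≈ ∑[k< suc v ] f
    drop-last = ≈-trans
      (+-cong ≈-refl (*-cong (≡⇒≈ (cong ℕ→ℂ (k>n⇒nCk≡0 {v} {suc v} (ℕₚ.n<1+n v)))) ≈-refl))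
      (solve 2 (λ a b → a :+ con (+ 0) :* b := a) ≈-refl (∑[k< suc v ] f) (h (suc v)))

opaque

  -- A bound on zⁿ alone fails at n = 0, because `_≺_` is strict and the modulus of 1 is not below
  -- ρ⁰; the strictness comes from the factor `w`.
  ^*-≺ : ∀ {z w ρ q} → z ≺ ρ → w ≺ q → ∀ n → z ^ n * w ≺ ρ ^ℚ n ℚ.* q
  ^*-≺ {z} {w} {ρ} {q} z≺ρ w≺q zero =
    ≺-≤-trans (≺-resp-≈ (≈-sym (*-identityˡ w)) w≺q) (ℚₚ.≤-reflexive (sym (ℚₚ.*-identityˡ q)))
  ^*-≺ {z} {w} {ρ} {q} z≺ρ w≺q (suc n) = ≺-≤-trans
    (≺-resp-≈ (solve 3 (λ a b c → a :* (b :* c) := (a :* b) :* c) ≈-refl z (z ^ n) w)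
      (≺-* z≺ρ (^*-≺ z≺ρ w≺q n)))
    (ℚₚ.≤-reflexive (sym (ℚₚ.*-assoc ρ (ρ ^ℚ n) q)))

  [-1]^*-≺ : ∀ b {z q} → z ≺ q → ℤ→ℂ ([-1]^ b) * z ≺ q
  [-1]^*-≺ b {z} {q} z≺q = go ℤ.∣ b ∣
    where
    go : ∀ n → ℤ→ℂ (ℤ.-1ℤ ℤ.^ n) * z ≺ q
    go zero    = ≺-resp-≈ (≈-sym (*-identityˡ z)) z≺q
    go (suc n) = ≺-resp-≈
      (≈-trans
        (solve 2 (λ s z → :- (s :* z) := con ℤ.-1ℤ :* s :* z) ≈-refl (ℤ→ℂ (ℤ.-1ℤ ℤ.^ n)) z)
        (*-cong (≈-sym (ℤ→ℂ-homo-* ℤ.-1ℤ (ℤ.-1ℤ ℤ.^ n))) ≈-refl))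
      (≺-neg (go n))

-- With E the shift c ↦ c ∘ suc, a sequence with E² = L E - s satisfies
-- (1 - x E) D = Δ for D = 1 - x (L - E) and Δ = 1 - L x + s x².
module LinearRecurrence (L s x : ℂ) where

  Recurrent : (ℤ → ℂ) → Set
  Recurrent c = ∀ i → c (ℤ.suc (ℤ.suc i)) ≈ L * c (ℤ.suc i) - s * c i

  -- For recurrent c the bracket is s c (i - 1). The form with the forward shift refers to no
  -- earlier index, so bounds on c at natural indices carry over to `D c`.
  D : (ℤ → ℂ) → ℤ → ℂ
  D c i = c i - x * (L * c i - c (ℤ.suc i))

  D^ : ℕ → (ℤ → ℂ) → ℤ → ℂ
  D^ zero    c = c
  D^ (suc n) c = D^ n (D c)

  δ : ℂ
  δ = ℕ→ℂ 1 - L * x + s * x ^ 2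

  -- `D` is built pointwise from its argument, so it commutes with the shift definitionally.
  D^-shift : ∀ n c i → D^ n (λ k → c (ℤ.suc k)) i ≡ D^ n c (ℤ.suc i)
  D^-shift zero    c i = refl
  D^-shift (suc n) c i = D^-shift n (D c) i

  opaque

    D-recurrent : ∀ {c} → Recurrent c → Recurrent (D c)
    D-recurrent {c} rec i = begin
      c₂ - x * (L * c₂ - c (ℤ.suc (ℤ.suc (ℤ.suc i))))
        ≈⟨ +-cong (rec i) (-‿cong (*-cong ≈-refl
             (+-cong (*-cong ≈-refl (rec i)) (-‿cong (rec (ℤ.suc i)))))) ⟩
      (L * c₁ - s * c i) - x * (L * (L * c₁ - s * c i) - (L * c₂ - s * c₁))
        ≈⟨ solve 6 (λ L s x c₀ c₁ c₂ →
             (L :* c₁ :- s :* c₀) :- x :* (L :* (L :* c₁ :- s :* c₀) :- (L :* c₂ :- s :* c₁))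
             := L :* (c₁ :- x :* (L :* c₁ :- c₂)) :- s :* (c₀ :- x :* (L :* c₀ :- c₁)))
             ≈-refl L s x (c i) c₁ c₂ ⟩
      L * D c (ℤ.suc i) - s * D c i ∎
      where
      open ≈-Reasoning
      c₁ c₂ : ℂ
      c₁ = c (ℤ.suc i)
      c₂ = c (ℤ.suc (ℤ.suc i))

    δ-telescope : ∀ {c} → Recurrent c → ∀ i → δ * c i ≈ D c i - x * D c (ℤ.suc i)
    δ-telescope {c} rec i = ≈-trans
      (solve 5 (λ L s x c₀ c₁ →
         (con (+ 1) :- L :* x :+ s :* (x :* (x :* con (+ 1)))) :* c₀
         := (c₀ :- x :* (L :* c₀ :- c₁)) :- x :* (c₁ :- x :* (L :* c₁ :- (L :* c₁ :- s :* c₀))))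
         ≈-refl L s x (c i) (c (ℤ.suc i)))
      (+-cong ≈-refl (-‿cong (*-cong ≈-refl (+-cong ≈-refl (-‿cong
        (*-cong ≈-refl (+-cong ≈-refl (-‿cong (≈-sym (rec i))))))))))

    D≈binomial : ∀ {c} → Recurrent c → ∀ i → D c i ≈ c i + - (s * x) * c (ℤ.pred i)
    D≈binomial {c} rec i = ≈-trans
      (+-cong ≈-refl (-‿cong (*-cong ≈-refl (+-cong ≈-refl (-‿cong c-suc)))))
      (solve 5 (λ L s x c₀ c₋ → c₀ :- x :* (L :* c₀ :- (L :* c₀ :- s :* c₋))
         := c₀ :+ :- (s :* x) :* c₋) ≈-refl L s x (c i) (c (ℤ.pred i)))
      where
      c-suc : c (ℤ.suc i) ≈ L * c i - s * c (ℤ.pred i)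
      c-suc = subst (λ j → c (ℤ.suc j) ≈ L * c j - s * c (ℤ.pred i)) (ℤₚ.suc-pred i) (rec (ℤ.pred i))

    D^-binomial : ∀ v {c} → Recurrent c → ∀ w →
      D^ v c w ≈ binomialSum (- (s * x)) v (λ k → c (w ℤ.- + k))
    D^-binomial zero {c} rec w = ≈-trans
      (solve 1 (λ z → z := con (+ 1) :* (con (+ 1) :* z) :+ con (+ 0)) ≈-refl (c w))
      (≡⇒≈ (cong₂ (λ m i → ℕ→ℂ m * (ℕ→ℂ 1 * c i) + ℕ→ℂ 0) (sym (nC0≡1 0)) (sym (ℤₚ.+-identityʳ w))))
    D^-binomial (suc v) {c} rec w = begin
      D^ v (D c) w
        ≈⟨ D^-binomial v (D-recurrent rec) w ⟩
      binomialSum t v (λ k → D c (w ℤ.- + k))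
        ≈⟨ ∑-cong (suc v) (λ k → *-cong (≈-refl {ℕ→ℂ (v C k)}) (*-cong (≈-refl {t ^ k}) (D-term k))) ⟩
      binomialSum t v (λ k → c (w ℤ.- + k) + t * c (w ℤ.- + suc k))
        ≈⟨ binomialSum-suc t v (λ k → c (w ℤ.- + k)) ⟨
      binomialSum t (suc v) (λ k → c (w ℤ.- + k)) ∎
      where
      open ≈-Reasoning
      t : ℂ
      t = - (s * x)
      pred-minus : ∀ w k → ℤ.-1ℤ ℤ.+ (w ℤ.- k) ≡ w ℤ.- (+ 1 ℤ.+ k)
      pred-minus = ℤ-Solver.solve-∀
      D-term : ∀ k → D c (w ℤ.- + k) ≈ c (w ℤ.- + k) + t * c (w ℤ.- + suc k)
      D-term k = ≈-trans (D≈binomial rec (w ℤ.- + k))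
        (≡⇒≈ (cong (λ i → c (w ℤ.- + k) + t * c i) (pred-minus w (+ k))))

    -- The factor C(k , 0) = 1 is kept so that the boundary term has the shape treated by
    -- `boundary-null`.
    ∑-telescope : ∀ {c} → Recurrent c → ∀ n →
      δ * ∑[k< n ] (λ k → ℕ→ℂ (k C 0) * (x ^ k * c (+ k)))
      ≈ D c (+ 0) - ℕ→ℂ (n C 0) * (x ^ n * D c (+ n))
    ∑-telescope {c} rec zero = ≈-trans
      (solve 2 (λ d z → d :* con (+ 0) := z :- con (+ 1) :* (con (+ 1) :* z)) ≈-refl δ (D c (+ 0)))
      (≡⇒≈ (cong (λ m → D c (+ 0) - ℕ→ℂ m * (ℕ→ℂ 1 * D c (+ 0))) (sym (nC0≡1 0))))
    ∑-telescope {c} rec (suc n) = begin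
      δ * ∑[k< suc n ] f
        ≈⟨ *-cong ≈-refl (∑-last n f) ⟩
      δ * (∑[k< n ] f + B * (X * c (+ n)))
        ≈⟨ solve 5 (λ d S B X c → d :* (S :+ B :* (X :* c)) := d :* S :+ B :* (X :* (d :* c)))
             ≈-refl δ (∑[k< n ] f) B X (c (+ n)) ⟩
      δ * ∑[k< n ] f + B * (X * (δ * c (+ n)))
        ≈⟨ +-cong (∑-telescope rec n) (*-cong ≈-refl (*-cong ≈-refl (δ-telescope rec (+ n)))) ⟩
      (D c (+ 0) - B * (X * D c (+ n))) + B * (X * (D c (+ n) - x * D c (+ suc n)))
        ≈⟨ solve 6 (λ z B X x d d′ → (z :- B :* (X :* d)) :+ B :* (X :* (d :- x :* d′))
             := z :- B :* ((x :* X) :* d′)) ≈-refl (D c (+ 0)) B X x (D c (+ n)) (D c (+ suc n)) ⟩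
      D c (+ 0) - B * (x ^ suc n * D c (+ suc n))
        ≡⟨ cong (λ m → D c (+ 0) - ℕ→ℂ m * (x ^ suc n * D c (+ suc n)))
             (trans (nC0≡1 n) (sym (nC0≡1 (suc n)))) ⟩
      D c (+ 0) - ℕ→ℂ (suc n C 0) * (x ^ suc n * D c (+ suc n)) ∎
      where
      open ≈-Reasoning
      f : ℕ → ℂ
      f k = ℕ→ℂ (k C 0) * (x ^ k * c (+ k))
      B X : ℂ
      B = ℕ→ℂ (n C 0)
      X = x ^ n

    -- By Pascal's rule the weights C(k + 1 , j + 1) and C(k , j + 1) differ by C(k , j). This
    -- lowers j and moves `D c` one place on.
    ∑-by-parts : ∀ j {c} → Recurrent c → ∀ n →
      δ * ∑[k< n ] (λ k → ℕ→ℂ (k C suc j) * (x ^ k * c (+ k)))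
      ≈ x * ∑[k< n ] (λ k → ℕ→ℂ (k C j) * (x ^ k * D c (+ suc k)))
        - ℕ→ℂ (n C suc j) * (x ^ n * D c (+ n))
    ∑-by-parts j {c} rec zero = ≈-trans
      (solve 3 (λ d x z → d :* con (+ 0) := x :* con (+ 0) :- con (+ 0) :* (con (+ 1) :* z))
         ≈-refl δ x (D c (+ 0)))
      (≡⇒≈ (cong (λ m → x * ℕ→ℂ 0 - ℕ→ℂ m * (ℕ→ℂ 1 * D c (+ 0)))
        (sym (k>n⇒nCk≡0 {0} {suc j} (ℕ.s≤s ℕ.z≤n)))))
    ∑-by-parts j {c} rec (suc n) = begin
      δ * ∑[k< suc n ] f
        ≈⟨ *-cong ≈-refl (∑-last n f) ⟩
      δ * (∑[k< n ] f + B * (X * c (+ n)))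
        ≈⟨ solve 5 (λ d S B X c → d :* (S :+ B :* (X :* c)) := d :* S :+ B :* (X :* (d :* c)))
             ≈-refl δ (∑[k< n ] f) B X (c (+ n)) ⟩
      δ * ∑[k< n ] f + B * (X * (δ * c (+ n)))
        ≈⟨ +-cong (∑-by-parts j rec n) (*-cong ≈-refl (*-cong ≈-refl (δ-telescope rec (+ n)))) ⟩
      (x * ∑[k< n ] g - B * (X * d)) + B * (X * (d - x * d′))
        ≈⟨ solve 7 (λ x S B A X d d′ → (x :* S :- B :* (X :* d)) :+ B :* (X :* (d :- x :* d′))
             := x :* (S :+ A :* (X :* d′)) :- (A :+ B) :* ((x :* X) :* d′))
             ≈-refl x (∑[k< n ] g) B A X d d′ ⟩
      x * (∑[k< n ] g + A * (X * d′)) - (A + B) * (x ^ suc n * d′)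
        ≈⟨ +-cong (*-cong ≈-refl (∑-last n g)) (-‿cong (*-cong pascal ≈-refl)) ⟨
      x * ∑[k< suc n ] g - ℕ→ℂ (suc n C suc j) * (x ^ suc n * d′) ∎
      where
      open ≈-Reasoning
      f g : ℕ → ℂ
      f k = ℕ→ℂ (k C suc j) * (x ^ k * c (+ k))
      g k = ℕ→ℂ (k C j) * (x ^ k * D c (+ suc k))
      A B X d d′ : ℂ
      A = ℕ→ℂ (n C j)
      B = ℕ→ℂ (n C suc j)
      X = x ^ n
      d = D c (+ n)
      d′ = D c (+ suc n)
      pascal : ℕ→ℂ (suc n C suc j) ≈ A + B
      pascal = ≈-trans (≡⇒≈ (cong ℕ→ℂ (sym (nCk+nC[k+1]≡[n+1]C[k+1] n j))))
        (ℕ→ℂ-homo-+ (n C j) (n C suc j))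

  -- Convergence of the series with binomial weights.

  module Convergence {ρ μ} (x≺ρ : x ≺ ρ) (μ>0 : 0ℚ ℚ.< μ) (ρμ<1 : ρ ℚ.* μ ℚ.< 1ℚ) where

    Growth : (ℤ → ℂ) → Set
    Growth c = ∃[ A ] 0ℚ ℚ.< A × ∀ k → c (+ k) ≺ A ℚ.* μ ^ℚ k

    private
      ρ≥0 : 0ℚ ℚ.≤ ρ
      ρ≥0 = ℚₚ.<⇒≤ (≺⇒>0 x≺ρ)

    opaque

      Growth-shift : ∀ {c} → Growth c → Growth (λ i → c (ℤ.suc i))
      Growth-shift (A , A>0 , h) = A ℚ.* μ , *>0 A>0 μ>0 , λ k →
        ≺-≤-trans (h (suc k)) (ℚₚ.≤-reflexive (sym (ℚₚ.*-assoc A μ (μ ^ℚ k))))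

      Growth-D : ∀ {c} → Growth c → Growth (D c)
      Growth-D (A , A>0 , h) =
        let Λ , L≺Λ = bounded-ℂ L
            Λ≥0 = ℚₚ.<⇒≤ (≺⇒>0 L≺Λ)
            A≥0 = ℚₚ.<⇒≤ A>0
        in A ℚ.+ ρ ℚ.* (Λ ℚ.* A ℚ.+ A ℚ.* μ)
          , +>0 A>0 (*≥0 ρ≥0 (+≥0 (*≥0 Λ≥0 A≥0) (*≥0 A≥0 (ℚₚ.<⇒≤ μ>0))))
          , λ k → ≺-≤-trans
              (≺-minus (h k) (≺-* x≺ρ (≺-minus (≺-* L≺Λ (h k)) (h (suc k)))))
              (ℚₚ.≤-reflexive (factor A ρ Λ μ (μ ^ℚ k)))
        where
        factor : ∀ A ρ Λ μ p → A ℚ.* p ℚ.+ ρ ℚ.* (Λ ℚ.* (A ℚ.* p) ℚ.+ A ℚ.* (μ ℚ.* p))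
          ≡ (A ℚ.+ ρ ℚ.* (Λ ℚ.* A ℚ.+ A ℚ.* μ)) ℚ.* p
        factor = solve-∀ ℚ-ring

      boundary-null : ∀ j {c} → Growth c → Null (λ n → ℕ→ℂ (n C j) * (x ^ n * c (+ n)))
      boundary-null j {c} (A , A>0 , h) =
        Null-C* j A>0 (*≥0 ρ≥0 (ℚₚ.<⇒≤ μ>0)) ρμ<1 λ n →
          ≺-≤-trans (^*-≺ x≺ρ (h n) n) (ℚₚ.≤-reflexive (begin
            ρ ^ℚ n ℚ.* (A ℚ.* μ ^ℚ n)   ≡⟨ swap (ρ ^ℚ n) A (μ ^ℚ n) ⟩
            A ℚ.* (ρ ^ℚ n ℚ.* μ ^ℚ n)   ≡⟨ cong (A ℚ.*_) (^ℚ-distrib-* ρ μ n) ⟨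
            A ℚ.* (ρ ℚ.* μ) ^ℚ n        ∎))
        where
        open ≡-Reasoning
        swap : ∀ p q r → p ℚ.* (q ℚ.* r) ≡ q ℚ.* (p ℚ.* r)
        swap = solve-∀ ℚ-ring

    -- The inverse of δ is assumed only here: the preceding facts on growth and boundary terms enter
    -- the proof that Δ is nonzero.
    module _ {δ⁻¹} (δδ⁻¹≈1 : δ * δ⁻¹ ≈ ℕ→ℂ 1) where

      opaque

        -- δ times the partial sum has to agree with s - e n only up to a null sequence. For j = 0
        -- the agreement is exact; for larger j the error is x times that of the preceding series.
        Sums-divide : ∀ {f e s} → Null e → Null (λ n → δ * ∑[k< n ] f - (s - e n)) → Sums f (δ⁻¹ * s)
        Sums-divide {f} {e} {s} e→0 h = Null-cong
          (λ n → begin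
            δ⁻¹ * ((δ * ∑[k< n ] f - (s - e n)) + - e n)
              ≈⟨ solve 5 (λ i d S s e → i :* ((d :* S :- (s :- e)) :+ :- e) := (d :* i) :* S :- i :* s)
                   ≈-refl δ⁻¹ δ (∑[k< n ] f) s (e n) ⟩
            δ * δ⁻¹ * ∑[k< n ] f - δ⁻¹ * s
              ≈⟨ +-cong (*-cong δδ⁻¹≈1 ≈-refl) ≈-refl ⟩
            ℕ→ℂ 1 * ∑[k< n ] f - δ⁻¹ * s
              ≈⟨ +-cong (*-identityˡ (∑[k< n ] f)) ≈-refl ⟩
            ∑[k< n ] f - δ⁻¹ * s ∎)
          (Null-scale δ⁻¹ (Null-+ h (Null-neg e→0)))
          where open ≈-Reasoning

        binomial-series : ∀ j {c} → Recurrent c → Growth c →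
          Sums (λ k → ℕ→ℂ (k C j) * (x ^ k * c (+ k)))
               (δ⁻¹ ^ suc j * x ^ j * D^ (suc j) c (+ j))
        binomial-series zero {c} rec gr = Sums-cong {f} {f} (λ _ → ≈-refl)
          (solve 2 (λ i d → i :* d := i :* con (+ 1) :* con (+ 1) :* d) ≈-refl δ⁻¹ (D c (+ 0)))
          (Sums-divide {f} (boundary-null 0 {D c} (Growth-D {c} gr)) λ ε ε>0 → 0 , λ n _ → ≈0⇒≺ (≈-trans
            (+-cong (∑-telescope rec n) ≈-refl)
            (solve 1 (λ a → a :- a := con (+ 0)) ≈-refl (D c (+ 0) - e n))) ε>0)
          where
          f e : ℕ → ℂ
          f k = ℕ→ℂ (k C 0) * (x ^ k * c (+ k))
          e n = ℕ→ℂ (n C 0) * (x ^ n * D c (+ n))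
        binomial-series (suc j) {c} rec gr = Sums-cong {f} {f} (λ _ → ≈-refl)
          (≈-trans
            (solve 5 (λ i x p q d → i :* (x :* (p :* q :* d)) := (i :* p) :* (x :* q) :* d) ≈-refl
              δ⁻¹ x (δ⁻¹ ^ suc j) (x ^ j) (D^ (suc j) d (+ j)))
            -- The induction hypothesis concerns `d`, the shift of `D c`; its D^(j+1) at j is
            -- D^(j+2) of c at j + 1.
            (≡⇒≈ (cong (δ⁻¹ ^ suc (suc j) * x ^ suc j *_) (D^-shift (suc j) (D c) (+ j)))))
          (Sums-divide {f} (boundary-null (suc j) {D c} (Growth-D {c} gr)) (Null-cong
            (λ n → begin
              x * (∑[k< n ] g - σ)
                ≈⟨ solve 4 (λ x S s e → x :* (S :- s) := (x :* S :- e) :- (x :* s :- e)) ≈-refl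
                     x (∑[k< n ] g) σ (e n) ⟩
              (x * ∑[k< n ] g - e n) - (x * σ - e n)
                ≈⟨ +-cong (∑-by-parts j rec n) ≈-refl ⟨
              δ * ∑[k< n ] f - (x * σ - e n) ∎)
            (Null-scale x (binomial-series j {d} d-rec (Growth-shift {D c} (Growth-D {c} gr))))))
          where
          open ≈-Reasoning
          d : ℤ → ℂ
          d i = D c (ℤ.suc i)
          d-rec : Recurrent d
          d-rec i = D-recurrent rec (ℤ.suc i)
          f g e : ℕ → ℂ
          f k = ℕ→ℂ (k C suc j) * (x ^ k * c (+ k))
          g k = ℕ→ℂ (k C j) * (x ^ k * d (+ k))
          e n = ℕ→ℂ (n C suc j) * (x ^ n * D c (+ n))
          σ : ℂ
          σ = δ⁻¹ ^ suc j * x ^ j * D^ (suc j) d (+ j)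

-- Specialization to generalized Fibonacci sequences.

opaque

  -- Since (-1)^((b+1)k) = (-(-1)^b)ᵏ, the sign and the power of x merge into one k-th power, with
  -- the base -(s x) of `D^-binomial`.
  P≈binomialSum : ∀ G a b x v w →
    P G a b x v w
    ≈ binomialSum (- (ℤ→ℂ ([-1]^ b) * x)) v (λ k → G (a ℤ.+ b ℤ.* (+ w ℤ.- + k)))
  P≈binomialSum G a b x v w = ∑-cong (suc v) λ k → begin
    ℕ→ℂ (v C k) * ℤ→ℂ ([-1]^ ((b ℤ.+ + 1) ℤ.* + k)) * x ^ k
      * G (a ℤ.+ b ℤ.* + w ℤ.- b ℤ.* + k)
      ≡⟨ cong₂ (λ s i → ℕ→ℂ (v C k) * ℤ→ℂ s * x ^ k * G i) ([-1]^-* b k) (index a b (+ w) (+ k)) ⟩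
    ℕ→ℂ (v C k) * ℤ→ℂ ((ℤ.- ([-1]^ b)) ℤ.^ k) * x ^ k * g k
      ≈⟨ *-cong (*-cong (*-cong ≈-refl (ℤ→ℂ-homo-^ (ℤ.- ([-1]^ b)) k)) ≈-refl) ≈-refl ⟩
    ℕ→ℂ (v C k) * ℤ→ℂ (ℤ.- ([-1]^ b)) ^ k * x ^ k * g k
      ≈⟨ solve 4 (λ c s p g → c :* s :* p :* g := c :* ((s :* p) :* g)) ≈-refl
           (ℕ→ℂ (v C k)) (ℤ→ℂ (ℤ.- ([-1]^ b)) ^ k) (x ^ k) (g k) ⟩
    ℕ→ℂ (v C k) * (ℤ→ℂ (ℤ.- ([-1]^ b)) ^ k * x ^ k * g k)
      ≈⟨ *-cong ≈-refl (*-cong (^-distrib-* (ℤ→ℂ (ℤ.- ([-1]^ b))) x k) ≈-refl) ⟨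
    ℕ→ℂ (v C k) * ((ℤ→ℂ (ℤ.- ([-1]^ b)) * x) ^ k * g k)
      ≈⟨ *-cong ≈-refl (*-cong (^-congˡ k base) ≈-refl) ⟩
    ℕ→ℂ (v C k) * ((- (ℤ→ℂ ([-1]^ b) * x)) ^ k * g k) ∎
    where
    open ≈-Reasoning
    g : ℕ → ℂ
    g k = G (a ℤ.+ b ℤ.* (+ w ℤ.- + k))
    index : ∀ a b i j → a ℤ.+ b ℤ.* i ℤ.- b ℤ.* j ≡ a ℤ.+ b ℤ.* (i ℤ.- j)
    index = ℤ-Solver.solve-∀
    base : ℤ→ℂ (ℤ.- ([-1]^ b)) * x ≈ - (ℤ→ℂ ([-1]^ b) * x)
    base = ≈-trans (*-cong (ℤ→ℂ-homo-neg ([-1]^ b)) ≈-refl)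
      (solve 2 (λ s x → (:- s) :* x := :- (s :* x)) ≈-refl (ℤ→ℂ ([-1]^ b)) x)

module _ (b : ℤ) (x : ℂ) (∣x∣< : ∣ x ∣ <ᵣ φ^ (ℤ.- (+ ℤ.∣ b ∣))) where

  private
    radii : ∃[ ρ ] ∃[ ψ ]
      x ≺ ρ × 1ℚ ℚ.≤ ψ × 1ℚ ℚ.+ ψ ℚ.≤ ψ ℚ.* ψ × ρ ℚ.* ψ ^ℚ ℤ.∣ b ∣ ℚ.< 1ℚ
    radii = rational-radii ℤ.∣ b ∣ x ∣x∣<

    ρ ψ μ : ℚ
    ρ = proj₁ radii
    ψ = proj₁ (proj₂ radii)
    μ = ψ ^ℚ ℤ.∣ b ∣

    x≺ρ : x ≺ ρ
    x≺ρ = proj₁ (proj₂ (proj₂ radii))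

    1≤ψ : 1ℚ ℚ.≤ ψ
    1≤ψ = proj₁ (proj₂ (proj₂ (proj₂ radii)))

    1+ψ≤ψψ : 1ℚ ℚ.+ ψ ℚ.≤ ψ ℚ.* ψ
    1+ψ≤ψψ = proj₁ (proj₂ (proj₂ (proj₂ (proj₂ radii))))

    ρμ<1 : ρ ℚ.* μ ℚ.< 1ℚ
    ρμ<1 = proj₂ (proj₂ (proj₂ (proj₂ (proj₂ radii))))

    μ>0 : 0ℚ ℚ.< μ
    μ>0 = ^ℚ>0 (ℚₚ.<-≤-trans (ℚₚ.positive⁻¹ 1ℚ) 1≤ψ) ℤ.∣ b ∣

    s : ℂ
    s = ℤ→ℂ ([-1]^ b)

  open LinearRecurrence (ℤ→ℂ (lucas b)) s x
  open Convergence x≺ρ μ>0 ρμ<1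

  opaque

    -- For the Lucas numbers the telescoped sums S n satisfy
    -- Δ (S n - 1) = 1 - s x² - e n with e n → 0, and |s x²| < 1.
    Δ-nonzero : Δ b x ≉0
    Δ-nonzero =
      -- The tolerance 1 - ρ² is what the bound ρ² on |s x²| leaves below 1.
      let N , e≺ = boundary-null 0 {D ℓ} (Growth-D {ℓ} growth) (1ℚ ℚ.- ρ ℚ.* ρ) (p<q⇒0<q-p ρρ<1)
          S = ∑[k< N ] (λ k → ℕ→ℂ (k C 0) * (x ^ k * ℓ (+ k)))
          e = ℕ→ℂ (N C 0) * (x ^ N * D ℓ (+ N))
          sx²+e≺1 = ≺-≤-trans (≺-+ ([-1]^*-≺ b (≺-* x≺ρ x≺ρ)) (e≺ N ℕₚ.≤-refl))
            (ℚₚ.≤-reflexive (sym (plus-minus 1ℚ (ρ ℚ.* ρ))))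
      in near-one⇒≉0 (Δ b x) (S - ℕ→ℂ 1) (≺-resp-≈ (begin
        s * (x * x) + e
          ≈⟨ solve 4 (λ L s x e → s :* (x :* x) :+ e
               := con (+ 1) :- ((con (+ 2) :- x :* (L :* con (+ 2) :- L)) :- e
                    :- (con (+ 1) :- L :* x :+ s :* (x :* (x :* con (+ 1))))))
               ≈-refl L s x e ⟩
        -- 2 - x (2 L - L) is `D ℓ` at 0, because ℓ 0 = L_0 = 2 and ℓ 1 = L_b = L.
        ℕ→ℂ 1 - ((ℕ→ℂ 2 - x * (L * ℕ→ℂ 2 - L)) - e - Δ b x)
          ≡⟨ cong₂ (λ i j → ℕ→ℂ 1 - ((ℤ→ℂ (lucas i) - x * (L * ℤ→ℂ (lucas i) - ℤ→ℂ (lucas j))) - e - Δ b x))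
               (index₀ b) (index₁ b) ⟩
        ℕ→ℂ 1 - (D ℓ (+ 0) - e - Δ b x)
          ≈⟨ +-cong ≈-refl (-‿cong (+-cong (≈-sym (∑-telescope {ℓ} rec N)) ≈-refl)) ⟩
        ℕ→ℂ 1 - (Δ b x * S - Δ b x)
          ≈⟨ solve 2 (λ d S → con (+ 1) :- (d :* S :- d) := con (+ 1) :- d :* (S :- con (+ 1)))
               ≈-refl (Δ b x) S ⟩
        ℕ→ℂ 1 - Δ b x * (S - ℕ→ℂ 1) ∎) sx²+e≺1)
      where
      open ≈-Reasoning
      L : ℂ
      L = ℤ→ℂ (lucas b)
      ℓ : ℤ → ℂ
      ℓ i = ℤ→ℂ (lucas (+ 0 ℤ.+ b ℤ.* i))
      rec : Recurrent ℓ
      rec = subsequence-recurrence lucas-isGeneralizedFibonacci (+ 0) b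
      growth : Growth ℓ
      growth = subsequence-growth lucas-isGeneralizedFibonacci 1≤ψ 1+ψ≤ψψ (+ 0) b
      index₀ : ∀ b → + 0 ≡ + 0 ℤ.+ b ℤ.* + 0
      index₀ = ℤ-Solver.solve-∀
      index₁ : ∀ b → b ≡ + 0 ℤ.+ b ℤ.* + 1
      index₁ = ℤ-Solver.solve-∀
      ρ≥0 : 0ℚ ℚ.≤ ρ
      ρ≥0 = ℚₚ.<⇒≤ (≺⇒>0 x≺ρ)
      ρ<1 : ρ ℚ.< 1ℚ
      ρ<1 = ℚₚ.≤-<-trans (p≤p*q ρ≥0 (1≤^ℚ 1≤ψ ℤ.∣ b ∣)) ρμ<1
      ρρ<1 : ρ ℚ.* ρ ℚ.< 1ℚ
      ρρ<1 = ℚₚ.≤-<-trans (*-mono-≤ ρ≥0 (ℚₚ.nonNegative⁻¹ 1ℚ) ℚₚ.≤-refl (ℚₚ.<⇒≤ ρ<1))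
        (subst (ℚ._< 1ℚ) (sym (ℚₚ.*-identityʳ ρ)) ρ<1)

  1/Δ : ℂ
  1/Δ = recip (Δ b x) Δ-nonzero

  module _ {G : ℤ → ℂ} (fib : IsGeneralizedFibonacci G) (a : ℤ) where

    private
      V : ℕ → ℂ
      V j = 1/Δ ^ suc j * x ^ j * P G a b x (suc j) j

    opaque

      binomial-series-P : ∀ j →
        Sums (λ k → ℕ→ℂ (k C j) * (x ^ k * G (a ℤ.+ b ℤ.* + k))) (V j)
      binomial-series-P j = Sums-cong {f} {f} (λ _ → ≈-refl)
        (*-cong ≈-refl (≈-trans (D^-binomial (suc j) {c} rec (+ j))
          (≈-sym (P≈binomialSum G a b x (suc j) j))))
        (binomial-series (recip-inverse (Δ b x) Δ-nonzero) j {c} rec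
          (subsequence-growth fib 1≤ψ 1+ψ≤ψψ a b))
        where
        c : ℤ → ℂ
        c i = G (a ℤ.+ b ℤ.* i)
        f : ℕ → ℂ
        f k = ℕ→ℂ (k C j) * (x ^ k * c (+ k))
        rec : Recurrent c
        rec = subsequence-recurrence fib a b

      power-series : ∀ m →
        Sums (λ k → x ^ k * ℕ→ℂ k ^ m * G (a ℤ.+ b ℤ.* + k))
             (∑[k< suc m ] (λ j → ℕ→ℂ (surjections m j) * V j))
      power-series m = Sums-cong term ≈-refl (Sums-∑ (suc m) {F}
        (λ j → Sums-scale (W j) {λ k → ℕ→ℂ (k C j) * (x ^ k * g k)} (binomial-series-P j)))
        where
        open ≈-Reasoning
        g W : ℕ → ℂ
        g k = G (a ℤ.+ b ℤ.* + k)
        W j = ℕ→ℂ (surjections m j)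
        F : ℕ → ℕ → ℂ
        F j k = W j * (ℕ→ℂ (k C j) * (x ^ k * g k))
        term : ∀ k → ∑[k< suc m ] (λ j → F j k) ≈ x ^ k * ℕ→ℂ k ^ m * g k
        term k = begin
          ∑[k< suc m ] (λ j → F j k)
            ≈⟨ ∑-cong (suc m) (λ j → solve 4 (λ w c p g → w :* (c :* (p :* g)) := (p :* g) :* (w :* c))
                 ≈-refl (W j) (ℕ→ℂ (k C j)) (x ^ k) (g k)) ⟩
          ∑[k< suc m ] (λ j → x ^ k * g k * (W j * ℕ→ℂ (k C j)))
            ≈⟨ ∑-scale (suc m) (x ^ k * g k) (λ j → W j * ℕ→ℂ (k C j)) ⟩
          x ^ k * g k * ∑[k< suc m ] (λ j → W j * ℕ→ℂ (k C j))
            ≈⟨ *-cong ≈-refl (power-as-binomials m k) ⟨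
          x ^ k * g k * ℕ→ℂ k ^ m
            ≈⟨ solve 3 (λ p g q → p :* g :* q := p :* q :* g) ≈-refl (x ^ k) (g k) (ℕ→ℂ k ^ m) ⟩
          x ^ k * ℕ→ℂ k ^ m * g k ∎

mainTheorem8 :
    (G : ℤ → ℂ) → IsGeneralizedFibonacci G →
    (a b : ℤ) (x : ℂ) → ∣ x ∣ <ᵣ φ^ (ℤ.- (+ ℤ.∣ b ∣)) →
    Σ[ Δ≉0 ∈ Δ b x ≉0 ]
      (let 1/Δ = recip (Δ b x) Δ≉0
           Pvw = P G a b x
       in
         HasSum (λ k → x ^ k * G (a ℤ.+ b ℤ.* + k))
                (1/Δ * Pvw 1 0)
       × HasSum (λ k → x ^ k * ℕ→ℂ k * G (a ℤ.+ b ℤ.* + k))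
                (1/Δ ^ 2 * x * Pvw 2 1)
       × HasSum (λ k → x ^ k * ℕ→ℂ k ^ 2 * G (a ℤ.+ b ℤ.* + k))
                (1/Δ ^ 2 * x * Pvw 2 1
                 + ℕ→ℂ 2 * 1/Δ ^ 3 * x ^ 2 * Pvw 3 2)
       × HasSum (λ k → x ^ k * ℕ→ℂ k ^ 3 * G (a ℤ.+ b ℤ.* + k))
                (1/Δ ^ 2 * x * Pvw 2 1
                 + ℕ→ℂ 6 * 1/Δ ^ 3 * x ^ 2 * Pvw 3 2
                 + ℕ→ℂ 6 * 1/Δ ^ 4 * x ^ 3 * Pvw 4 3)
       × HasSum (λ k → x ^ k * ℕ→ℂ k ^ 4 * G (a ℤ.+ b ℤ.* + k))
                (1/Δ ^ 2 * x * Pvw 2 1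
                 + ℕ→ℂ 14 * 1/Δ ^ 3 * x ^ 2 * Pvw 3 2
                 + ℕ→ℂ 36 * 1/Δ ^ 4 * x ^ 3 * Pvw 4 3
                 + ℕ→ℂ 24 * 1/Δ ^ 5 * x ^ 4 * Pvw 5 4)
       × HasSum (λ k → x ^ k * ℕ→ℂ k ^ 5 * G (a ℤ.+ b ℤ.* + k))
                (1/Δ ^ 2 * x * Pvw 2 1
                 + ℕ→ℂ 30 * 1/Δ ^ 3 * x ^ 2 * Pvw 3 2
                 + ℕ→ℂ 150 * 1/Δ ^ 4 * x ^ 3 * Pvw 4 3
                 + ℕ→ℂ 240 * 1/Δ ^ 5 * x ^ 4 * Pvw 5 4
                 + ℕ→ℂ 120 * 1/Δ ^ 6 * x ^ 5 * Pvw 6 5))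
mainTheorem8 G fib a b x ∣x∣< = Δ-nonzero b x ∣x∣< ,
    Sums⇒HasSum {λ k → x ^ k * g k} (Sums-cong {term 0}
      (λ k → solve 2 (λ p g → p :* con (+ 1) :* g := p :* g) ≈-refl (x ^ k) (g k))
      (solve 2 (λ i p → con (+ 1) :* (i :* con (+ 1) :* con (+ 1) :* p) :+ con (+ 0) := i :* p)
        ≈-refl i (Q 0))
      (series 0))
  , Sums⇒HasSum {λ k → x ^ k * ℕ→ℂ k * g k} (Sums-cong {term 1}
      (λ k → solve 3 (λ p q g → p :* (q :* con (+ 1)) :* g := p :* q :* g) ≈-refl (x ^ k) (ℕ→ℂ k) (g k))
      (≈-trans (+-cong ≈-refl (+-cong (head) ≈-refl))
        -- The summand j = 0 has the coefficient `surjections m 0`, which is 0 for m > 0; hence P(1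
        -- , 0) occurs only in the first series.
        (solve 2 (λ v₀ h → con (+ 0) :* v₀ :+ (h :+ con (+ 0)) := h) ≈-refl (V 0) H))
      (series 1))
  , hasSum 2
      (≈-trans (+-cong ≈-refl (+-cong (head) (+-cong (tail 2 1) ≈-refl)))
        (solve 3 (λ v₀ h p → con (+ 0) :* v₀ :+ (h :+ (p :+ con (+ 0))) := h :+ p)
          ≈-refl (V 0) H (T 2 1)))
  , hasSum 3
      (≈-trans (+-cong ≈-refl (+-cong (head) (+-cong (tail 6 1) (+-cong (tail 6 2) ≈-refl))))
        (solve 4 (λ v₀ h p q → con (+ 0) :* v₀ :+ (h :+ (p :+ (q :+ con (+ 0)))) := h :+ p :+ q)
          ≈-refl (V 0) H (T 6 1) (T 6 2)))
  , hasSum 4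
      (≈-trans (+-cong ≈-refl (+-cong (head) (+-cong (tail 14 1) (+-cong (tail 36 2)
                 (+-cong (tail 24 3) ≈-refl)))))
        (solve 5 (λ v₀ h p q r → con (+ 0) :* v₀ :+ (h :+ (p :+ (q :+ (r :+ con (+ 0)))))
            := h :+ p :+ q :+ r)
          ≈-refl (V 0) H (T 14 1) (T 36 2) (T 24 3)))
  , hasSum 5
      -- 30, 150, 240 and 120 are j! S(5 , j) for j = 2 to 5. `surjections` evaluates to them, so
      -- `tail` fits by computation.
      (≈-trans (+-cong ≈-refl (+-cong (head) (+-cong (tail 30 1) (+-cong (tail 150 2)
                 (+-cong (tail 240 3) (+-cong (tail 120 4) ≈-refl))))))
        (solve 6 (λ v₀ h p q r t → con (+ 0) :* v₀ :+ (h :+ (p :+ (q :+ (r :+ (t :+ con (+ 0))))))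
            := h :+ p :+ q :+ r :+ t)
          ≈-refl (V 0) H (T 30 1) (T 150 2) (T 240 3) (T 120 4)))
  where
  i : ℂ
  i = 1/Δ b x ∣x∣<
  g Q V : ℕ → ℂ
  g k = G (a ℤ.+ b ℤ.* + k)
  Q j = P G a b x (suc j) j
  term : ℕ → ℕ → ℂ
  term m k = x ^ k * ℕ→ℂ k ^ m * g k
  V j = i ^ suc j * x ^ j * Q j
  series : ∀ m → Sums (term m) (∑[k< suc m ] (λ j → ℕ→ℂ (surjections m j) * V j))
  series = power-series b x ∣x∣< fib a
  hasSum : ∀ m {s} → ∑[k< suc m ] (λ j → ℕ→ℂ (surjections m j) * V j) ≈ s → HasSum (term m) s
  hasSum m s≈ = Sums⇒HasSum {term m} (Sums-cong {term m} (λ _ → ≈-refl) s≈ (series m))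
  H : ℂ
  H = i ^ 2 * x * Q 1
  T : ℕ → ℕ → ℂ
  T c j = ℕ→ℂ c * i ^ suc (suc j) * x ^ suc j * Q (suc j)
  head : ℕ→ℂ 1 * V 1 ≈ H
  head = solve 3 (λ q x p → con (+ 1) :* (q :* (x :* con (+ 1)) :* p) := q :* x :* p) ≈-refl
    (i ^ 2) x (Q 1)
  tail : ∀ c j → ℕ→ℂ c * V (suc j) ≈ T c j
  tail c j = solve 4 (λ c q y p → c :* (q :* y :* p) := c :* q :* y :* p) ≈-refl
    (ℕ→ℂ c) (i ^ suc (suc j)) (x ^ suc j) (Q (suc j))
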